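{- Every quasirandom-forcing set of $4$-point permutations has cardinality at least five.
   Context: A $k$-point permutation is a bijection $\pi:[k]\to[k]$, $[k]=\{1,\dots,k\}$. For a $k$-point permutation $\sigma$ and an $n$-point permutation $\pi$ with $n\ge k$, the (pattern) density $d(\sigma,\pi)$ is the probability that, for a uniformly random $k$-element subset $A=\{a_1<\dots<a_k\}\subseteq[n]$, the permutation induced by $A$ is $\sigma$, i.e. $\sigma(i)<\sigma(j)\iff\pi(a_i)<\pi(a_j)$ for all $i,j\in[k]$. A sequence $(\pi_n)_{n\in\mathbb N}$ of permutations whose sizes tend to infinity is quasirandom if $d(\sigma,\pi_n)\to 1/|\sigma|!$ for every permutation $\sigma$. A set $S$ of permutations is quasirandom-forcing if every sequence $(\pi_n)$ of permutations with sizes tending to infinity such that $d(\sigma,\pi_n)\to1/|\sigma|!$ for every $\sigma\in S$ is quasirandom. -}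

module Defs where

open import Data.Nat using (ℕ; zero; suc; _≤_; _<?_; _!)
open import Data.Nat.Combinatorics using (_C_)
open import Data.Fin using (Fin; toℕ)
import Data.Fin as F
open import Data.Fin.Permutation using (Permutation′; _⟨$⟩ʳ_)
open import Data.Vec using (Vec; []; _∷_; lookup)
import Data.Vec as V
open import Data.List using (List; []; _∷_; [_]; _++_; map; length; filterᵇ; allFin)
open import Data.Bool.ListAction using (all)
open import Data.List.Membership.Propositional using (_∈_)
open import Data.List.Relation.Unary.AllPairs using (AllPairs)
open import Data.Bool using (Bool; true; false; _∧_)
open import Data.Integer using (+_)
open import Data.Rational using (ℚ; _/_; 0ℚ; _-_; ∣_∣; _<_)
open import Data.Product using (Σ; ∃; _×_)
open import Relation.Nullary using (¬_)
open import Relation.Nullary.Decidable using (⌊_⌋)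
open import Relation.Binary.PropositionalEquality using (_≡_)

Perm : ℕ → Set
Perm = Permutation′

-- all k-element subsets {a₁ < … < a_k} of [n], as strictly increasing vectors
subsets : (n k : ℕ) → List (Vec (Fin n) k)
subsets n zero = [ [] ]
subsets zero (suc k) = []
subsets (suc n) (suc k) =
  map (λ v → F.zero ∷ V.map F.suc v) (subsets n k) ++ map (V.map F.suc) (subsets n (suc k))

_<ᵇ_ : ℕ → ℕ → Bool
a <ᵇ b = ⌊ a <? b ⌋

_==ᵇ_ : Bool → Bool → Bool
true ==ᵇ b = b
false ==ᵇ true = false
false ==ᵇ false = true

induces : ∀ {k n} → Perm k → Perm n → Vec (Fin n) k → Bool
induces {k} σ π A =
  all (λ i → all (λ j →
        (toℕ (σ ⟨$⟩ʳ i) <ᵇ toℕ (σ ⟨$⟩ʳ j)) ==ᵇ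
        (toℕ (π ⟨$⟩ʳ lookup A i) <ᵇ toℕ (π ⟨$⟩ʳ lookup A j)))
      (allFin k)) (allFin k)

-- a / d as a rational (d = 0 never matters; set to 0)
frac : ℕ → ℕ → ℚ
frac a zero = 0ℚ
frac a (suc d) = + a / suc d

density : ∀ {k n} → Perm k → Perm n → ℚ
density {k} {n} σ π = frac (length (filterᵇ (induces σ π) (subsets n k))) (n C k)

record PermSeq : Set where
  field
    size : ℕ → ℕ
    perm : (i : ℕ) → Perm (size i)
open PermSeq public

SizesToInfinity : PermSeq → Set
SizesToInfinity s = ∀ M → ∃ λ N → ∀ i → N ≤ i → M ≤ size s i

ConvergesTo : (ℕ → ℚ) → ℚ → Set
ConvergesTo a q = ∀ ε → 0ℚ < ε → ∃ λ N → ∀ i → N ≤ i → ∣ a i - q ∣ < ε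

DensityTendsToRandom : ∀ {k} → PermSeq → Perm k → Set
DensityTendsToRandom {k} s σ = ConvergesTo (λ i → density σ (perm s i)) (frac 1 (k !))

Quasirandom : PermSeq → Set
Quasirandom s = ∀ k (σ : Perm k) → DensityTendsToRandom s σ

QuasirandomForcing : ∀ {k} → List (Perm k) → Set
QuasirandomForcing {k} S =
  ∀ (s : PermSeq) → SizesToInfinity s →
    (∀ σ → σ ∈ S → DensityTendsToRandom s σ) → Quasirandom s

Distinct : ∀ {k} → Perm k → Perm k → Set
Distinct σ τ = ¬ (∀ i → σ ⟨$⟩ʳ i ≡ τ ⟨$⟩ʳ i)

-- the list has no repeated permutations, so its length is the cardinality of the set
NoDup : ∀ {k} → List (Perm k) → Set
NoDup = AllPairs Distinct

{-# OPTIONS --safe #-}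
module Submission where

-- A template is a finite set of weighted unit cells of a grid.  Blowing every cell up to
-- uniformly spread points gives permutations in which the density of a 4-point pattern σ
-- tends to Φ σ w / (24 s⁴), where Φ σ is a quartic form in the weights w and s their sum.
-- So S is not forcing as soon as some w satisfies Φ σ w = s⁴ for all σ in S and
-- Φ τ w ≠ s⁴ for one τ.  Such a w is approached by Newton's method in ℤ, started at a
-- template where the equations nearly hold and have a regular Jacobian.
--
-- If the permutation matrices of S are linearly independent modulo the all-ones matrix,
-- the uniform 4×4 grid is such a start: up to an invertible change of coordinates the
-- derivatives of the densities there are the permutation matrices.  S then lies in a
-- translate g B h, minus one element τ, of a fixed basis B.  The remaining 42 sets of
-- four patterns have numerically found starts.

-- No exact solution w is ever needed. The n-th permutation of the refuting sequence is a blow-up of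
-- the n-th Newton iterate, by a factor that grows with n. The defects of the densities in S and the
-- error of the blow-up vanish together, while one inequality, checked at the start, keeps the
-- density of τ away from 1/24 at every iterate. So nothing but sequences of rationals occurs, and
-- each start reduces to finitely many integer inequalities that the type checker evaluates. This is
-- why every estimate carries an explicit constant.
--
-- The permutation matrices of order 4 span a space of dimension 10, hence 9 modulo the all-ones
-- matrix. Near the uniform grid nine independent patterns can be steered independently: one of
-- them, τ, is pushed off 1/24, and the other eight are held there. If the matrices of S are
-- dependent modulo the all-ones matrix, the Jacobian at the grid is singular and a different start
-- is required.

open import Defs
open import Data.Nat using (_≤_)
open import Data.List using (List; length)

-- Finite sums over lists and over tuples

module Sums where

  open import Data.Bool using (Bool; true; false; _∧_)
  open import Data.Bool.Properties using (∧-zeroʳ)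
  open import Data.Fin using (Fin; toℕ; zero; suc)
  open import Data.Fin.Permutation as Pm using (Permutation′; _⟨$⟩ʳ_)
  open import Data.List as L using (List; []; _∷_; _++_; length; concatMap; filterᵇ)
  open import Data.List.Relation.Binary.Permutation.Propositional as PP using (_↭_)
  open import Data.Nat as ℕ using (ℕ; zero; suc; _+_; _*_; _≤_; z≤n)
  open import Data.Nat.Properties
  open import Data.Vec as V using (Vec; []; _∷_; lookup; tabulate)
  import Data.Vec.Properties as VP
  open import Relation.Binary.PropositionalEquality
  open ≡-Reasoning

  private variable
    A B C : Set

  ∑ : List A → (A → ℕ) → ℕ
  ∑ [] f = 0
  ∑ (x ∷ xs) f = f x + ∑ xs f

  ∑-cong : (xs : List A) {f g : A → ℕ} → (∀ x → f x ≡ g x) → ∑ xs f ≡ ∑ xs g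
  ∑-cong [] h = refl
  ∑-cong (x ∷ xs) h = cong₂ _+_ (h x) (∑-cong xs h)

  ∑-mono : (xs : List A) {f g : A → ℕ} → (∀ x → f x ≤ g x) → ∑ xs f ≤ ∑ xs g
  ∑-mono [] h = z≤n
  ∑-mono (x ∷ xs) h = +-mono-≤ (h x) (∑-mono xs h)

  +-interchange : ∀ a b c d → (a + b) + (c + d) ≡ (a + c) + (b + d)
  +-interchange a b c d = begin
    (a + b) + (c + d)  ≡⟨ +-assoc a b (c + d) ⟩
    a + (b + (c + d))  ≡⟨ cong (a +_) (sym (+-assoc b c d)) ⟩
    a + ((b + c) + d)  ≡⟨ cong (λ e → a + (e + d)) (+-comm b c) ⟩
    a + ((c + b) + d)  ≡⟨ cong (a +_) (+-assoc c b d) ⟩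
    a + (c + (b + d))  ≡⟨ sym (+-assoc a c (b + d)) ⟩
    (a + c) + (b + d)  ∎

  ∑-+ : (xs : List A) (f g : A → ℕ) → ∑ xs (λ x → f x + g x) ≡ ∑ xs f + ∑ xs g
  ∑-+ [] f g = refl
  ∑-+ (x ∷ xs) f g =
    trans (cong (f x + g x +_) (∑-+ xs f g)) (+-interchange (f x) (g x) (∑ xs f) (∑ xs g))

  ∑-0 : (xs : List A) → ∑ xs (λ _ → 0) ≡ 0
  ∑-0 [] = refl
  ∑-0 (x ∷ xs) = ∑-0 xs

  ∑-*ˡ : ∀ c (xs : List A) (f : A → ℕ) → ∑ xs (λ x → c * f x) ≡ c * ∑ xs f
  ∑-*ˡ c [] f = sym (*-zeroʳ c)
  ∑-*ˡ c (x ∷ xs) f =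
    trans (cong (c * f x +_) (∑-*ˡ c xs f)) (sym (*-distribˡ-+ c (f x) (∑ xs f)))

  ∑-const : ∀ c (xs : List A) → ∑ xs (λ _ → c) ≡ length xs * c
  ∑-const c [] = refl
  ∑-const c (x ∷ xs) = cong (c +_) (∑-const c xs)

  ∑-swap : (xs : List A) (ys : List B) (f : A → B → ℕ) →
           ∑ xs (λ x → ∑ ys (f x)) ≡ ∑ ys (λ y → ∑ xs (λ x → f x y))
  ∑-swap [] ys f = sym (∑-0 ys)
  ∑-swap (x ∷ xs) ys f =
    trans (cong (∑ ys (f x) +_) (∑-swap xs ys f)) (sym (∑-+ ys (f x) (λ y → ∑ xs (λ x → f x y))))

  ∑-map : (h : A → B) (xs : List A) (f : B → ℕ) → ∑ (L.map h xs) f ≡ ∑ xs (λ x → f (h x))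
  ∑-map h [] f = refl
  ∑-map h (x ∷ xs) f = cong (f (h x) +_) (∑-map h xs f)

  ∑-++ : (xs ys : List A) (f : A → ℕ) → ∑ (xs ++ ys) f ≡ ∑ xs f + ∑ ys f
  ∑-++ [] ys f = refl
  ∑-++ (x ∷ xs) ys f =
    trans (cong (f x +_) (∑-++ xs ys f)) (sym (+-assoc (f x) (∑ xs f) (∑ ys f)))

  ∑-concatMap : (h : A → List B) (xs : List A) (f : B → ℕ) →
                ∑ (concatMap h xs) f ≡ ∑ xs (λ x → ∑ (h x) f)
  ∑-concatMap h [] f = refl
  ∑-concatMap h (x ∷ xs) f =
    trans (∑-++ (h x) (concatMap h xs) f) (cong (∑ (h x) f +_) (∑-concatMap h xs f))

  ∑-↭ : {xs ys : List A} → xs ↭ ys → (f : A → ℕ) → ∑ xs f ≡ ∑ ys f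
  ∑-↭ PP.refl f = refl
  ∑-↭ (PP.prep x p) f = cong (f x +_) (∑-↭ p f)
  ∑-↭ (PP.swap {xs} {ys} x y p) f = begin
    f x + (f y + ∑ xs f)  ≡⟨ sym (+-assoc (f x) (f y) _) ⟩
    (f x + f y) + ∑ xs f  ≡⟨ cong₂ _+_ (+-comm (f x) (f y)) (∑-↭ p f) ⟩
    (f y + f x) + ∑ ys f  ≡⟨ +-assoc (f y) (f x) _ ⟩
    f y + (f x + ∑ ys f)  ∎
  ∑-↭ (PP.trans p q) f = trans (∑-↭ p f) (∑-↭ q f)

  ∑-length : (xs : List A) → ∑ xs (λ _ → 1) ≡ length xs
  ∑-length xs = trans (∑-const 1 xs) (*-identityʳ (length xs))

  ∑ⁿ : ∀ k → List A → (Vec A k → ℕ) → ℕ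
  ∑ⁿ zero xs f = f []
  ∑ⁿ (suc k) xs f = ∑ xs (λ x → ∑ⁿ k xs (λ v → f (x ∷ v)))

  ∑ⁿ-cong : ∀ k (xs : List A) {f g : Vec A k → ℕ} → (∀ v → f v ≡ g v) → ∑ⁿ k xs f ≡ ∑ⁿ k xs g
  ∑ⁿ-cong zero xs h = h []
  ∑ⁿ-cong (suc k) xs h = ∑-cong xs (λ x → ∑ⁿ-cong k xs (λ v → h (x ∷ v)))

  ∑ⁿ-mono : ∀ k (xs : List A) {f g : Vec A k → ℕ} → (∀ v → f v ≤ g v) → ∑ⁿ k xs f ≤ ∑ⁿ k xs g
  ∑ⁿ-mono zero xs h = h []
  ∑ⁿ-mono (suc k) xs h = ∑-mono xs (λ x → ∑ⁿ-mono k xs (λ v → h (x ∷ v)))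

  ∑ⁿ-+ : ∀ k (xs : List A) (f g : Vec A k → ℕ) →
         ∑ⁿ k xs (λ v → f v + g v) ≡ ∑ⁿ k xs f + ∑ⁿ k xs g
  ∑ⁿ-+ zero xs f g = refl
  ∑ⁿ-+ (suc k) xs f g =
    trans (∑-cong xs (λ x → ∑ⁿ-+ k xs (λ v → f (x ∷ v)) (λ v → g (x ∷ v)))) (∑-+ xs _ _)

  ∑ⁿ-*ˡ : ∀ c k (xs : List A) (f : Vec A k → ℕ) → ∑ⁿ k xs (λ v → c * f v) ≡ c * ∑ⁿ k xs f
  ∑ⁿ-*ˡ c zero xs f = refl
  ∑ⁿ-*ˡ c (suc k) xs f =
    trans (∑-cong xs (λ x → ∑ⁿ-*ˡ c k xs (λ v → f (x ∷ v)))) (∑-*ˡ c xs _)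

  ∑ⁿ-0 : ∀ k (xs : List A) → ∑ⁿ k xs (λ _ → 0) ≡ 0
  ∑ⁿ-0 zero xs = refl
  ∑ⁿ-0 (suc k) xs = trans (∑-cong xs (λ _ → ∑ⁿ-0 k xs)) (∑-0 xs)

  ∑ⁿ-const : ∀ c k (xs : List A) → ∑ⁿ k xs (λ _ → c) ≡ length xs ℕ.^ k * c
  ∑ⁿ-const c zero xs = sym (+-identityʳ c)
  ∑ⁿ-const c (suc k) xs = begin
    ∑ xs (λ _ → ∑ⁿ k xs (λ _ → c))        ≡⟨ ∑-cong xs (λ _ → ∑ⁿ-const c k xs) ⟩
    ∑ xs (λ _ → length xs ℕ.^ k * c)      ≡⟨ ∑-const _ xs ⟩
    length xs * (length xs ℕ.^ k * c)     ≡⟨ sym (*-assoc (length xs) _ c) ⟩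
    length xs * length xs ℕ.^ k * c       ∎

  ∑ⁿ-map : ∀ k (h : A → B) (xs : List A) (f : Vec B k → ℕ) →
           ∑ⁿ k (L.map h xs) f ≡ ∑ⁿ k xs (λ v → f (V.map h v))
  ∑ⁿ-map zero h xs f = refl
  ∑ⁿ-map (suc k) h xs f =
    trans (∑-map h xs _) (∑-cong xs (λ x → ∑ⁿ-map k h xs (λ v → f (h x ∷ v))))

  ∑ⁿ-↭ : ∀ k {xs ys : List A} → xs ↭ ys → (f : Vec A k → ℕ) → ∑ⁿ k xs f ≡ ∑ⁿ k ys f
  ∑ⁿ-↭ zero p f = refl
  ∑ⁿ-↭ (suc k) {xs} p f =
    trans (∑-cong xs (λ x → ∑ⁿ-↭ k p (λ v → f (x ∷ v)))) (∑-↭ p _)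

  ∑-∑ⁿ-swap : ∀ k (xs : List A) (ys : List B) (f : A → Vec B k → ℕ) →
              ∑ xs (λ x → ∑ⁿ k ys (f x)) ≡ ∑ⁿ k ys (λ v → ∑ xs (λ x → f x v))
  ∑-∑ⁿ-swap zero xs ys f = refl
  ∑-∑ⁿ-swap (suc k) xs ys f =
    trans (∑-swap xs ys (λ x y → ∑ⁿ k ys (λ v → f x (y ∷ v))))
          (∑-cong ys (λ y → ∑-∑ⁿ-swap k xs ys (λ x v → f x (y ∷ v))))

  ∏ : ∀ {k} → (A → ℕ) → Vec A k → ℕ
  ∏ w [] = 1
  ∏ w (c ∷ v) = w c * ∏ w v

  zip₃ : ∀ {k} {D : Set} → (A → B → C → D) → Vec A k → Vec B k → Vec C k → Vec D k
  zip₃ h [] [] [] = []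
  zip₃ h (a ∷ u) (b ∷ v) (c ∷ w) = h a b c ∷ zip₃ h u v w

  -- One point is a choice of a cell, a first offset and a second offset, so a tuple of points is a
  -- tuple of each. Regrouping the sums in this way separates the two kinds of offsets, which can
  -- then be counted independently.
  ∑ⁿ-blowup : ∀ {D : Set} k (P : List D) (cs : List A) (as : List B) (bs : List C)
    (w : A → ℕ) (pt : A → B → C → D) →
    (∀ f → ∑ P f ≡ ∑ cs (λ c → w c * ∑ as (λ a → ∑ bs (λ b → f (pt c a b))))) →
    (f : Vec D k → ℕ) →
    ∑ⁿ k P f ≡ ∑ⁿ k cs (λ u → ∏ w u * ∑ⁿ k as (λ v → ∑ⁿ k bs (λ t → f (zip₃ pt u v t))))
  ∑ⁿ-blowup zero P cs as bs w pt H f = sym (+-identityʳ (f []))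
  ∑ⁿ-blowup (suc k) P cs as bs w pt H f = begin
    ∑ P (λ p → ∑ⁿ k P (λ v → f (p ∷ v)))
      ≡⟨ H _ ⟩
    ∑ cs (λ c → w c * ∑ as (λ a → ∑ bs (λ b → ∑ⁿ k P (λ v → f (pt c a b ∷ v)))))
      ≡⟨ ∑-cong cs (λ c → cong (w c *_) (inner c)) ⟩
    ∑ cs (λ c → w c * ∑ⁿ k cs (λ u → ∏ w u * R c u))
      ≡⟨ ∑-cong cs (λ c → sym (∑ⁿ-*ˡ (w c) k cs _)) ⟩
    ∑ cs (λ c → ∑ⁿ k cs (λ u → w c * (∏ w u * R c u)))
      ≡⟨ ∑-cong cs (λ c → ∑ⁿ-cong k cs (λ u → sym (*-assoc (w c) (∏ w u) (R c u)))) ⟩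
    ∑ cs (λ c → ∑ⁿ k cs (λ u → w c * ∏ w u * R c u)) ∎
    where
    R : _ → _ → ℕ
    R c u = ∑ as (λ a → ∑ⁿ k as (λ v → ∑ bs (λ b → ∑ⁿ k bs (λ t →
              f (pt c a b ∷ zip₃ pt u v t)))))
    inner : ∀ c → ∑ as (λ a → ∑ bs (λ b → ∑ⁿ k P (λ v → f (pt c a b ∷ v))))
                ≡ ∑ⁿ k cs (λ u → ∏ w u * R c u)
    inner c = begin
      ∑ as (λ a → ∑ bs (λ b → ∑ⁿ k P (λ v → f (pt c a b ∷ v))))
        ≡⟨ ∑-cong as (λ a → ∑-cong bs (λ b →
             ∑ⁿ-blowup k P cs as bs w pt H (λ v → f (pt c a b ∷ v)))) ⟩
      ∑ as (λ a → ∑ bs (λ b → ∑ⁿ k cs (λ u → ∏ w u * Q a b u)))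
        ≡⟨ ∑-cong as (λ a → ∑-∑ⁿ-swap k bs cs _) ⟩
      ∑ as (λ a → ∑ⁿ k cs (λ u → ∑ bs (λ b → ∏ w u * Q a b u)))
        ≡⟨ ∑-∑ⁿ-swap k as cs _ ⟩
      ∑ⁿ k cs (λ u → ∑ as (λ a → ∑ bs (λ b → ∏ w u * Q a b u)))
        ≡⟨ ∑ⁿ-cong k cs (λ u → trans (∑-cong as (λ a → ∑-*ˡ (∏ w u) bs _)) (∑-*ˡ (∏ w u) as _)) ⟩
      ∑ⁿ k cs (λ u → ∏ w u * ∑ as (λ a → ∑ bs (λ b → Q a b u)))
        ≡⟨ ∑ⁿ-cong k cs (λ u → cong (∏ w u *_) (∑-cong as (λ a → ∑-∑ⁿ-swap k bs as _))) ⟩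
      ∑ⁿ k cs (λ u → ∏ w u * R c u) ∎
      where
      Q : _ → _ → _ → ℕ
      Q a b u = ∑ⁿ k as (λ v → ∑ⁿ k bs (λ t → f (pt c a b ∷ zip₃ pt u v t)))

  -- Brings the summation over one chosen coordinate to the front, so that `∑ⁿ-permute` can peel off
  -- a permutation one value at a time.
  ∑ⁿ-insertAt : ∀ k (xs : List A) (p : Fin (suc k)) (f : Vec A (suc k) → ℕ) →
                ∑ⁿ (suc k) xs f ≡ ∑ xs (λ x → ∑ⁿ k xs (λ v → f (V.insertAt v p x)))
  ∑ⁿ-insertAt k xs zero f = refl
  ∑ⁿ-insertAt (suc k) xs (suc p) f = begin
    ∑ xs (λ y → ∑ⁿ (suc k) xs (λ v → f (y ∷ v)))
      ≡⟨ ∑-cong xs (λ y → ∑ⁿ-insertAt k xs p (λ v → f (y ∷ v))) ⟩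
    ∑ xs (λ y → ∑ xs (λ x → ∑ⁿ k xs (λ v → f (y ∷ V.insertAt v p x))))
      ≡⟨ ∑-swap xs xs _ ⟩
    ∑ xs (λ x → ∑ xs (λ y → ∑ⁿ k xs (λ v → f (y ∷ V.insertAt v p x)))) ∎

  reindex : ∀ {k} → Vec A k → (Fin k → Fin k) → Vec A k
  reindex v u = tabulate (λ t → lookup v (u t))

  -- Induction on k: the sum over coordinate `π ⟨$⟩ʳ zero` is brought to the front, and what remains
  -- is the same sum for `remove zero π`.
  ∑ⁿ-permute : ∀ k (xs : List A) (π : Permutation′ k) (f : Vec A k → ℕ) →
               ∑ⁿ k xs (λ v → f (reindex v (π ⟨$⟩ʳ_))) ≡ ∑ⁿ k xs f
  ∑ⁿ-permute zero xs π f = refl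
  ∑ⁿ-permute (suc k) xs π f = begin
    ∑ⁿ (suc k) xs (λ v → f (reindex v (π ⟨$⟩ʳ_)))
      ≡⟨ ∑ⁿ-insertAt k xs (π ⟨$⟩ʳ zero) (λ v → f (reindex v (π ⟨$⟩ʳ_))) ⟩
    ∑ xs (λ x → ∑ⁿ k xs (λ v → f (reindex (V.insertAt v (π ⟨$⟩ʳ zero) x) (π ⟨$⟩ʳ_))))
      ≡⟨ ∑-cong xs (λ x → ∑ⁿ-cong k xs (λ v → cong f (cong₂ _∷_ (VP.insertAt-lookup v (π ⟨$⟩ʳ zero) x)
           (VP.tabulate-cong (λ t → trans (cong (lookup (V.insertAt v (π ⟨$⟩ʳ zero) x)) (Pm.punchIn-permute π zero t))
              (VP.insertAt-punchIn v (π ⟨$⟩ʳ zero) x (Pm.remove zero π ⟨$⟩ʳ t))))))) ⟩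
    ∑ xs (λ x → ∑ⁿ k xs (λ v → f (x ∷ reindex v (Pm.remove zero π ⟨$⟩ʳ_))))
      ≡⟨ ∑-cong xs (λ x → ∑ⁿ-permute k xs (Pm.remove zero π) (λ v → f (x ∷ v))) ⟩
    ∑ⁿ (suc k) xs f ∎

  ⟦_⟧ : Bool → ℕ
  ⟦ true ⟧ = 1
  ⟦ false ⟧ = 0

  length-filterᵇ : (p : A → Bool) (xs : List A) → length (filterᵇ p xs) ≡ ∑ xs (λ x → ⟦ p x ⟧)
  length-filterᵇ p [] = refl
  length-filterᵇ p (x ∷ xs) with p x
  ... | true = cong suc (length-filterᵇ p xs)
  ... | false = length-filterᵇ p xs

  inc : ∀ {k} → Vec ℕ k → Bool
  inc [] = true
  inc (x ∷ []) = true
  inc (x ∷ y ∷ v) = (x ℕ.<ᵇ y) ∧ inc (y ∷ v)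

  -- Follows the recursion of `subsets`, so that sums over the two can be matched by induction on n.
  fins : ∀ n → List (Fin n)
  fins zero = []
  fins (suc n) = zero ∷ L.map suc (fins n)

  length-fins : ∀ n → length (fins n) ≡ n
  length-fins zero = refl
  length-fins (suc n) = cong suc (trans (length-map suc (fins n)) (length-fins n))
    where open import Data.List.Properties using (length-map)

  incF : ∀ {n k} → Vec (Fin n) k → Bool
  incF v = inc (V.map toℕ v)

  inc-suc : ∀ {n k} (v : Vec (Fin n) k) → incF (V.map suc v) ≡ incF v
  inc-suc [] = refl
  inc-suc (x ∷ []) = refl
  inc-suc (x ∷ y ∷ v) = cong ((toℕ x ℕ.<ᵇ toℕ y) ∧_) (inc-suc (y ∷ v))

  inc-zero∷ : ∀ {n k} (v : Vec (Fin n) k) → incF (zero ∷ V.map suc v) ≡ incF v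
  inc-zero∷ [] = refl
  inc-zero∷ (x ∷ v) = inc-suc (x ∷ v)

  inc-meets-zero : ∀ {n k} (x : Fin (suc n)) (v : Vec (Fin (suc n)) k) (i : Fin k) →
                   lookup v i ≡ zero → incF (x ∷ v) ≡ false
  inc-meets-zero x (zero ∷ v) zero refl = refl
  inc-meets-zero x (y ∷ v) (suc i) e =
    trans (cong ((toℕ x ℕ.<ᵇ toℕ y) ∧_) (inc-meets-zero y v i e)) (∧-zeroʳ _)

  -- Meant for tails of increasing tuples: only the head can be zero, so the tail ranges over a
  -- shifted copy of the smaller set.
  ∑ⁿ-shift : ∀ {n} k (g : Vec (Fin (suc n)) k → ℕ) →
             (∀ v i → lookup v i ≡ zero → g v ≡ 0) →
             ∑ⁿ k (fins (suc n)) g ≡ ∑ⁿ k (fins n) (λ v → g (V.map suc v))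
  ∑ⁿ-shift zero g h = refl
  ∑ⁿ-shift {n} (suc k) g h = cong₂ _+_
    (trans (∑ⁿ-cong k (fins (suc n)) (λ v → h (zero ∷ v) zero refl)) (∑ⁿ-0 k (fins (suc n))))
    (trans (∑-map suc (fins n) _) (∑-cong (fins n) (λ x →
      ∑ⁿ-shift k (λ v → g (suc x ∷ v)) (λ v i e → h (suc x ∷ v) (suc i) e))))

  -- Trading the list of subsets for an indicator on all tuples makes the sums compatible with
  -- blow-ups, where tuples are chosen coordinate by coordinate.
  ∑-subsets : ∀ n k (f : Vec (Fin n) k → ℕ) →
              ∑ (subsets n k) f ≡ ∑ⁿ k (fins n) (λ v → ⟦ incF v ⟧ * f v)
  ∑-subsets n zero f = refl
  ∑-subsets zero (suc k) f = refl
  ∑-subsets (suc n) (suc k) f = begin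
    ∑ (L.map _ (subsets n k) ++ L.map (V.map suc) (subsets n (suc k))) f
      ≡⟨ ∑-++ (L.map _ (subsets n k)) _ f ⟩
    ∑ (L.map _ (subsets n k)) f + ∑ (L.map (V.map suc) (subsets n (suc k))) f
      ≡⟨ cong₂ _+_ (∑-map _ (subsets n k) f) (∑-map _ (subsets n (suc k)) f) ⟩
    ∑ (subsets n k) (λ v → f (zero ∷ V.map suc v)) + ∑ (subsets n (suc k)) (λ v → f (V.map suc v))
      ≡⟨ cong₂ _+_ (∑-subsets n k _) (∑-subsets n (suc k) _) ⟩
    ∑ⁿ k (fins n) (λ v → ⟦ incF v ⟧ * f (zero ∷ V.map suc v)) +
    ∑ⁿ (suc k) (fins n) (λ v → ⟦ incF v ⟧ * f (V.map suc v))
      ≡⟨ cong₂ _+_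
          (∑ⁿ-cong k (fins n) (λ v → cong (λ b → ⟦ b ⟧ * f (zero ∷ V.map suc v)) (sym (inc-zero∷ v))))
          (∑ⁿ-cong (suc k) (fins n) (λ v → cong (λ b → ⟦ b ⟧ * f (V.map suc v)) (sym (inc-suc v)))) ⟩
    ∑ⁿ k (fins n) (λ v → G (zero ∷ V.map suc v)) + ∑ⁿ (suc k) (fins n) (λ v → G (V.map suc v))
      ≡⟨ cong₂ _+_ (sym (∑ⁿ-shift k _ (vanish zero)))
          (sym (trans (∑-map suc (fins n) _)
            (∑-cong (fins n) (λ x → ∑ⁿ-shift k _ (vanish (suc x)))))) ⟩
    ∑ⁿ (suc k) (fins (suc n)) G ∎
    where
    G : Vec (Fin (suc n)) (suc k) → ℕ
    G v = ⟦ incF v ⟧ * f v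
    vanish : ∀ x v i → lookup v i ≡ zero → G (x ∷ v) ≡ 0
    vanish x v i e = cong (λ b → ⟦ b ⟧ * f (x ∷ v)) (inc-meets-zero x v i e)

  <ᵇ-primitive : ∀ a b → (a <ᵇ b) ≡ (a ℕ.<ᵇ b)
  <ᵇ-primitive a b = isYes≗does (a ℕ.<? b)
    where open import Relation.Nullary.Decidable using (isYes≗does)

-- Permutations drawn from point sets, and their pattern counts

module Counting where

  open Sums
  open import Data.Bool using (Bool; true; false; _∧_; T)
  open import Data.Bool.ListAction using (all)
  open import Data.Empty using (⊥-elim)
  open import Data.Fin using (Fin; toℕ; zero; suc)
  open import Data.Fin.Properties using (toℕ-injective; toℕ-cast)
  open import Data.Fin.Permutation as Pm using (_⟨$⟩ʳ_; _⟨$⟩ˡ_)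
  open import Data.List as L using (List; []; _∷_; length; filterᵇ; allFin)
  open import Data.List.Relation.Binary.Permutation.Propositional using (_↭_; ↭⇒↭ₛ; ↭-sym)
  open import Data.List.Relation.Binary.Permutation.Propositional.Properties using (↭-length)
  import Data.List.Relation.Binary.Permutation.Setoid as PS
  import Data.List.Relation.Binary.Permutation.Setoid.Properties as PSP
  import Data.List.Sort as Sort
  open import Data.List.Relation.Unary.Sorted.TotalOrder.Properties using (lookup-mono-≤)
  open import Data.List.Relation.Unary.All as All using (All)
  import Data.List.Relation.Unary.All.Properties as AllP
  open import Data.List.Membership.Propositional.Properties using (∈-allFin)
  open import Data.Nat as ℕ using (ℕ; zero; suc; _+_; _*_; _≤_; _<_; z≤n; s≤s; _^_)
  open import Data.Nat.Properties
  open import Data.Product using (_×_; proj₁; proj₂)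
  open import Data.Unit using (tt)
  open import Data.Vec as V using (Vec; []; _∷_; lookup; tabulate)
  open import Data.Vec.Properties as VP using (lookup-map; lookup∘tabulate)
  open import Function using (_∘_; Inverse)
  open import Relation.Binary.Definitions using (tri<; tri≈; tri>)
  open import Relation.Binary.Bundles using (DecTotalOrder)
  import Relation.Binary.Construct.On as On
  open import Relation.Binary.PropositionalEquality
  open import Relation.Nullary using (¬_)

  private variable
    A : Set

  ≡true⇒T : ∀ {b} → b ≡ true → T b
  ≡true⇒T refl = tt

  T⇒≡true : ∀ {b} → T b → b ≡ true
  T⇒≡true {true} _ = refl

  <ᵇ-true : ∀ {a b} → a < b → (a ℕ.<ᵇ b) ≡ true
  <ᵇ-true a<b = T⇒≡true (<⇒<ᵇ a<b)

  <ᵇ-false : ∀ {a b} → ¬ (a < b) → (a ℕ.<ᵇ b) ≡ false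
  <ᵇ-false {a} {b} h with a ℕ.<ᵇ b in eq
  ... | false = refl
  ... | true = ⊥-elim (h (<ᵇ⇒< a b (≡true⇒T eq)))

  inc⇒lookup-< : ∀ {k} (w : Vec ℕ k) → inc w ≡ true →
                 ∀ {i j} → toℕ i < toℕ j → lookup w i < lookup w j
  inc⇒lookup-< (x ∷ y ∷ w) h {i} {j} i<j with x ℕ.<ᵇ y in eq
  inc⇒lookup-< (x ∷ y ∷ w) h {zero} {suc zero} i<j | true = <ᵇ⇒< x y (≡true⇒T eq)
  inc⇒lookup-< (x ∷ y ∷ w) h {zero} {suc (suc j)} i<j | true =
    <-trans (<ᵇ⇒< x y (≡true⇒T eq)) (inc⇒lookup-< (y ∷ w) h {zero} {suc j} (s≤s z≤n))
  inc⇒lookup-< (x ∷ y ∷ w) h {suc i} {suc j} (s≤s i<j) | true = inc⇒lookup-< (y ∷ w) h i<j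
  inc⇒lookup-< (x ∷ []) h {zero} {zero} ()

  lookup-<⇒inc : ∀ {k} (w : Vec ℕ k) →
                 (∀ {i j} → toℕ i < toℕ j → lookup w i < lookup w j) → inc w ≡ true
  lookup-<⇒inc [] h = refl
  lookup-<⇒inc (x ∷ []) h = refl
  lookup-<⇒inc (x ∷ y ∷ w) h =
    cong₂ _∧_ (<ᵇ-true (h {zero} {suc zero} (s≤s z≤n))) (lookup-<⇒inc (y ∷ w) (λ i<j → h (s≤s i<j)))

  map-lookup-fins : (xs : List A) → L.map (L.lookup xs) (fins (length xs)) ≡ xs
  map-lookup-fins [] = refl
  map-lookup-fins (x ∷ xs) = cong (x ∷_)
    (trans (sym (map-∘ (fins (length xs)))) (map-lookup-fins xs))
    where open import Data.List.Properties using (map-∘)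

  -- A finite multiset of points yields a permutation: list the points by first coordinate and rank
  -- them by the second. Ties are broken arbitrarily, so the order of indices gives only weak
  -- inequalities between coordinates.
  record Ranking (P : List (ℕ × ℕ)) : Set where
    field
      card  : ℕ
      card≡ : card ≡ length P
      rank  : Perm card
      point : Fin card → ℕ × ℕ
      sum   : ∀ k f → ∑ⁿ k (fins card) (λ v → f (V.map point v)) ≡ ∑ⁿ k P f
      ordˣ  : ∀ {x y} → toℕ x < toℕ y → proj₁ (point x) ≤ proj₁ (point y)
      ordʸ  : ∀ {x y} → toℕ (rank ⟨$⟩ʳ x) < toℕ (rank ⟨$⟩ʳ y) → proj₂ (point x) ≤ proj₂ (point y)

  -- Two sorts, by the first coordinate and then of the result by the second. The permutation
  -- follows each point from its place in the first list to its place in the second.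
  ranking : ∀ P → Ranking P
  ranking P = record
    { card = length xs ; card≡ = ↭-length xs↭P ; rank = π ; point = L.lookup xs
    ; sum = λ k f → trans (sym (∑ⁿ-map k (L.lookup xs) (fins (length xs)) f))
                    (trans (cong (λ ys → ∑ⁿ k ys f) (map-lookup-fins xs)) (∑ⁿ-↭ k xs↭P f))
    ; ordˣ = λ x<y → lookup-mono-≤ OX.totalOrder (SX.sort-↗ P) (<⇒≤ x<y)
    ; ordʸ = λ {x} {y} h → subst₂ (λ p q → proj₂ p ≤ proj₂ q) (sym (look x)) (sym (look y))
        (lookup-mono-≤ OY.totalOrder (SY.sort-↗ xs)
          (<⇒≤ (subst₂ _<_ (toℕ-cast len (to x)) (toℕ-cast len (to y)) h))) }
    where
    module OX = DecTotalOrder (On.decTotalOrder ≤-decTotalOrder (proj₁ {A = ℕ} {B = λ _ → ℕ}))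
    module OY = DecTotalOrder (On.decTotalOrder ≤-decTotalOrder (proj₂ {A = ℕ} {B = λ _ → ℕ}))
    module SX = Sort (On.decTotalOrder ≤-decTotalOrder (proj₁ {A = ℕ} {B = λ _ → ℕ}))
    module SY = Sort (On.decTotalOrder ≤-decTotalOrder (proj₂ {A = ℕ} {B = λ _ → ℕ}))
    xs ys : List (ℕ × ℕ)
    xs = SX.sort P
    ys = SY.sort xs
    xs↭P : xs ↭ P
    xs↭P = SX.sort-↭ P
    len : length ys ≡ length xs
    len = ↭-length (SY.sort-↭ xs)
    xs↭ₛys : PS._↭_ (setoid (ℕ × ℕ)) xs ys
    xs↭ₛys = ↭⇒↭ₛ (↭-sym (SY.sort-↭ xs))
    to : Fin (length xs) → Fin (length ys)
    to = Inverse.to (PS.onIndices xs↭ₛys)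
    π : Perm (length xs)
    π = PS.onIndices xs↭ₛys Pm.∘ₚ Pm.cast-id len
    look : ∀ x → L.lookup xs x ≡ L.lookup ys (to x)
    look = PSP.onIndices-lookup (setoid (ℕ × ℕ)) xs↭ₛys

  occ : ∀ {k} → ℕ → Vec ℕ k → ℕ
  occ x [] = 0
  occ x (y ∷ v) = ⟦ x ℕ.≡ᵇ y ⟧ + occ x v

  -- Counts the pairs of equal entries. Its vanishing forces the entries to be distinct, and as a
  -- number it is easy to sum over all tuples.
  coin : ∀ {k} → Vec ℕ k → ℕ
  coin [] = 0
  coin (x ∷ v) = occ x v + coin v

  occ≡0⇒≢ : ∀ {k} x (v : Vec ℕ k) → occ x v ≡ 0 → ∀ i → x ≢ lookup v i
  occ≡0⇒≢ x (y ∷ v) h zero refl rewrite T⇒≡true (≡⇒≡ᵇ x x refl) with () ← h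
  occ≡0⇒≢ x (y ∷ v) h (suc i) = occ≡0⇒≢ x v (m+n≡0⇒n≡0 ⟦ x ℕ.≡ᵇ y ⟧ h) i

  coin≡0⇒≢ : ∀ {k} (v : Vec ℕ k) → coin v ≡ 0 → ∀ i j → i ≢ j → lookup v i ≢ lookup v j
  coin≡0⇒≢ (x ∷ v) h zero zero i≢j = ⊥-elim (i≢j refl)
  coin≡0⇒≢ (x ∷ v) h zero (suc j) i≢j = occ≡0⇒≢ x v (m+n≡0⇒m≡0 (occ x v) h) j
  coin≡0⇒≢ (x ∷ v) h (suc i) zero i≢j = occ≡0⇒≢ x v (m+n≡0⇒m≡0 (occ x v) h) i ∘ sym
  coin≡0⇒≢ (x ∷ v) h (suc i) (suc j) i≢j =
    coin≡0⇒≢ v (m+n≡0⇒n≡0 (occ x v) h) i j (i≢j ∘ cong suc)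

  module _ (xs : List A) (h : A → ℕ) (E : ℕ)
           (ties : ∀ x → ∑ xs (λ y → ⟦ x ℕ.≡ᵇ h y ⟧) ≤ E) where

    -- One of the k + 1 entries has to be among the at most E elements of value x; the other k are
    -- free.
    ∑ⁿ-occ : ∀ k x → ∑ⁿ (suc k) xs (λ v → occ x (V.map h v)) ≤ suc k * (length xs ^ k * E)
    ∑ⁿ-occ k x = begin
      ∑ xs (λ y → ∑ⁿ k xs (λ v → ⟦ x ℕ.≡ᵇ h y ⟧ + occ x (V.map h v)))
        ≡⟨ ∑-cong xs (λ y → trans (∑ⁿ-+ k xs _ _) (cong (_+ rest k) (∑ⁿ-const ⟦ x ℕ.≡ᵇ h y ⟧ k xs))) ⟩
      ∑ xs (λ y → length xs ^ k * ⟦ x ℕ.≡ᵇ h y ⟧ + rest k)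
        ≡⟨ trans (∑-+ xs _ _) (cong₂ _+_ (∑-*ˡ (length xs ^ k) xs _) (∑-const (rest k) xs)) ⟩
      length xs ^ k * ∑ xs (λ y → ⟦ x ℕ.≡ᵇ h y ⟧) + length xs * rest k
        ≤⟨ +-mono-≤ (*-monoʳ-≤ (length xs ^ k) (ties x)) (tail k) ⟩
      length xs ^ k * E + k * (length xs ^ k * E) ∎
      where
      open ≤-Reasoning
      rest : ℕ → ℕ
      rest j = ∑ⁿ j xs (λ v → occ x (V.map h v))
      tail : ∀ k → length xs * rest k ≤ k * (length xs ^ k * E)
      tail zero = ≤-reflexive (*-zeroʳ (length xs))
      tail (suc k) = begin
        length xs * rest (suc k)                        ≤⟨ *-monoʳ-≤ (length xs) (∑ⁿ-occ k x) ⟩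
        length xs * (suc k * (length xs ^ k * E))       ≡⟨ sym (*-assoc (length xs) (suc k) _) ⟩
        length xs * suc k * (length xs ^ k * E)         ≡⟨ cong (_* (length xs ^ k * E)) (*-comm (length xs) (suc k)) ⟩
        suc k * length xs * (length xs ^ k * E)         ≡⟨ *-assoc (suc k) (length xs) _ ⟩
        suc k * (length xs * (length xs ^ k * E))       ≡⟨ cong (suc k *_) (sym (*-assoc (length xs) _ E)) ⟩
        suc k * (length xs ^ suc k * E)                 ∎

    -- The binomial coefficient of k + 2 over 2: the number of pairs of positions in a tuple of
    -- length k + 2.
    coin-coeff : ℕ → ℕ
    coin-coeff zero = 1
    coin-coeff (suc k) = suc (suc k) + coin-coeff k

    ∑ⁿ-coin : ∀ k → ∑ⁿ (suc (suc k)) xs (λ v → coin (V.map h v)) ≤ coin-coeff k * (length xs ^ suc k * E)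
    ∑ⁿ-coin k = begin
      ∑ xs (λ y → ∑ⁿ (suc k) xs (λ v → occ (h y) (V.map h v) + coin (V.map h v)))
        ≡⟨ ∑-cong xs (λ y → ∑ⁿ-+ (suc k) xs (λ v → occ (h y) (V.map h v)) (λ v → coin (V.map h v))) ⟩
      ∑ xs (λ y → ∑ⁿ (suc k) xs (λ v → occ (h y) (V.map h v)) + rest k)
        ≤⟨ ∑-mono xs (λ y → +-monoˡ-≤ (rest k) (∑ⁿ-occ k (h y))) ⟩
      ∑ xs (λ y → suc k * (length xs ^ k * E) + rest k)
        ≡⟨ trans (∑-const _ xs) (*-distribˡ-+ (length xs) _ (rest k)) ⟩
      length xs * (suc k * (length xs ^ k * E)) + length xs * rest k
        ≤⟨ +-mono-≤ (≤-reflexive (lemma (suc k) (length xs) (length xs ^ k) E)) (tail k) ⟩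
      suc k * (length xs ^ suc k * E) + c′ k * (length xs ^ suc k * E)
        ≡⟨ sym (*-distribʳ-+ (length xs ^ suc k * E) (suc k) (c′ k)) ⟩
      (suc k + c′ k) * (length xs ^ suc k * E)
        ≡⟨ cong (_* (length xs ^ suc k * E)) (coeff k) ⟩
      coin-coeff k * (length xs ^ suc k * E) ∎
      where
      open ≤-Reasoning
      rest : ℕ → ℕ
      rest j = ∑ⁿ (suc j) xs (λ v → coin (V.map h v))
      -- `c′ k` is the number of pairs in a tuple of length k + 1; a single entry has none.
      c′ : ℕ → ℕ
      c′ zero = 0
      c′ (suc k) = coin-coeff k
      coeff : ∀ k → suc k + c′ k ≡ coin-coeff k
      coeff zero = refl
      coeff (suc k) = refl
      lemma : ∀ a b c d → b * (a * (c * d)) ≡ a * (b * c * d)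
      lemma a b c d = trans (sym (*-assoc b a (c * d))) (trans (cong (_* (c * d)) (*-comm b a))
                      (trans (*-assoc a b (c * d)) (cong (a *_) (sym (*-assoc b c d)))))
      tail : ∀ k → length xs * rest k ≤ c′ k * (length xs ^ suc k * E)
      tail zero = ≤-reflexive (trans (cong (length xs *_) (∑-0 xs)) (*-zeroʳ (length xs)))
      tail (suc k) = begin
        length xs * rest (suc k)                              ≤⟨ *-monoʳ-≤ (length xs) (∑ⁿ-coin k) ⟩
        length xs * (coin-coeff k * (length xs ^ suc k * E))  ≡⟨ lemma (coin-coeff k) (length xs) _ E ⟩
        coin-coeff k * (length xs ^ suc (suc k) * E)          ∎

  ==ᵇ-correct : ∀ {a b} → (a ≡ true → b ≡ true) → (b ≡ true → a ≡ true) → (a ==ᵇ b) ≡ true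
  ==ᵇ-correct {true} f g = f refl
  ==ᵇ-correct {false} {true} f g = ⊥-elim (case (g refl))
    where case : ¬ (false ≡ true)
          case ()
  ==ᵇ-correct {false} {false} f g = refl

  ==ᵇ⇒≡ : ∀ {a b} → (a ==ᵇ b) ≡ true → a ≡ b
  ==ᵇ⇒≡ {true} h = sym h
  ==ᵇ⇒≡ {false} {false} h = refl

  all-allFin⁺ : ∀ k (p : Fin k → Bool) → (∀ i → p i ≡ true) → all p (allFin k) ≡ true
  all-allFin⁺ k p h = T⇒≡true (AllP.all⁻ p (All.tabulate {xs = allFin k} (λ {i} _ → ≡true⇒T (h i))))

  all-allFin⁻ : ∀ k (p : Fin k → Bool) → all p (allFin k) ≡ true → ∀ i → p i ≡ true
  all-allFin⁻ k p h i = T⇒≡true (All.lookup (AllP.all⁺ p (allFin k) (≡true⇒T h)) (∈-allFin i))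

  <⇒<ᵇ-true : ∀ {a b} → a < b → (a <ᵇ b) ≡ true
  <⇒<ᵇ-true {a} {b} l = trans (<ᵇ-primitive a b) (<ᵇ-true l)

  <ᵇ-true⇒< : ∀ a b → (a <ᵇ b) ≡ true → a < b
  <ᵇ-true⇒< a b e = <ᵇ⇒< a b (≡true⇒T (trans (sym (<ᵇ-primitive a b)) e))

  module _ {k n} (σ : Perm k) (π : Perm n) (v : Vec (Fin n) k) where

    induces⁺ : (∀ i j → toℕ (σ ⟨$⟩ʳ i) < toℕ (σ ⟨$⟩ʳ j) →
                        toℕ (π ⟨$⟩ʳ lookup v i) < toℕ (π ⟨$⟩ʳ lookup v j)) →
               (∀ i j → toℕ (π ⟨$⟩ʳ lookup v i) < toℕ (π ⟨$⟩ʳ lookup v j) →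
                        toℕ (σ ⟨$⟩ʳ i) < toℕ (σ ⟨$⟩ʳ j)) → induces σ π v ≡ true
    induces⁺ f g = all-allFin⁺ k _ (λ i → all-allFin⁺ k _ (λ j → ==ᵇ-correct
      {toℕ (σ ⟨$⟩ʳ i) <ᵇ toℕ (σ ⟨$⟩ʳ j)} {toℕ (π ⟨$⟩ʳ lookup v i) <ᵇ toℕ (π ⟨$⟩ʳ lookup v j)}
      (λ e → <⇒<ᵇ-true (f i j (<ᵇ-true⇒< _ _ e))) (λ e → <⇒<ᵇ-true (g i j (<ᵇ-true⇒< _ _ e)))))

    induces⁻ : induces σ π v ≡ true → ∀ i j → toℕ (σ ⟨$⟩ʳ i) < toℕ (σ ⟨$⟩ʳ j) →
               toℕ (π ⟨$⟩ʳ lookup v i) < toℕ (π ⟨$⟩ʳ lookup v j)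
    induces⁻ h i j l = <ᵇ-true⇒< _ _ (trans
      (sym (==ᵇ⇒≡ {toℕ (σ ⟨$⟩ʳ i) <ᵇ toℕ (σ ⟨$⟩ʳ j)} (all-allFin⁻ k _ (all-allFin⁻ k _ h i) j)))
      (<⇒<ᵇ-true l))

  count : ∀ {k n} → Perm k → Perm n → ℕ
  count {k} {n} σ π = length (filterᵇ (induces σ π) (subsets n k))

  -- The strict version of an occurrence of σ. It sees coordinates instead of ranks, so it can be
  -- summed over the points themselves, where the blow-up structure is visible.
  matches : ∀ {k} → Perm k → Vec (ℕ × ℕ) k → ℕ
  matches σ v = ⟦ inc (V.map proj₁ v) ⟧ * ⟦ inc (reindex (V.map proj₂ v) (σ ⟨$⟩ˡ_)) ⟧

  module Sandwich (P : List (ℕ × ℕ)) {k : ℕ} (σ : Perm k) where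
    open Ranking (ranking P)

    count-∑ⁿ : count σ rank ≡ ∑ⁿ k (fins card) (λ v → ⟦ incF v ⟧ * ⟦ induces σ rank v ⟧)
    count-∑ⁿ = trans (length-filterᵇ (induces σ rank) (subsets card k)) (∑-subsets card k _)

    X Y : Fin card → ℕ
    X x = proj₁ (point x)
    Y x = proj₂ (point x)

    ordˣ′ : ∀ {x y} → X x < X y → toℕ x < toℕ y
    ordˣ′ {x} {y} h with <-cmp (toℕ x) (toℕ y)
    ... | tri< l _ _ = l
    ... | tri≈ _ e _ = ⊥-elim (<-irrefl (cong X (toℕ-injective e)) h)
    ... | tri> _ _ g = ⊥-elim (<⇒≱ h (ordˣ g))

    ordʸ′ : ∀ {x y} → Y x < Y y → toℕ (rank ⟨$⟩ʳ x) < toℕ (rank ⟨$⟩ʳ y)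
    ordʸ′ {x} {y} h with <-cmp (toℕ (rank ⟨$⟩ʳ x)) (toℕ (rank ⟨$⟩ʳ y))
    ... | tri< l _ _ = l
    ... | tri≈ _ e _ = ⊥-elim (<-irrefl (cong Y (inj (toℕ-injective e))) h)
      where
      inj : rank ⟨$⟩ʳ x ≡ rank ⟨$⟩ʳ y → x ≡ y
      inj e = trans (sym (Pm.inverseˡ rank)) (trans (cong (rank ⟨$⟩ˡ_) e) (Pm.inverseˡ rank))
    ... | tri> _ _ g = ⊥-elim (<⇒≱ h (ordʸ g))

    xs ys : Vec (Fin card) k → Vec ℕ k
    xs v = V.map proj₁ (V.map point v)
    ys v = reindex (V.map proj₂ (V.map point v)) (σ ⟨$⟩ˡ_)

    look-y : ∀ (v : Vec (Fin card) k) t →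
             lookup (reindex (V.map proj₂ (V.map point v)) (σ ⟨$⟩ˡ_)) t ≡ Y (lookup v (σ ⟨$⟩ˡ t))
    look-y v t = trans (lookup∘tabulate _ t) (trans (lookup-map (σ ⟨$⟩ˡ t) proj₂ (V.map point v))
                   (cong proj₂ (lookup-map (σ ⟨$⟩ˡ t) point v)))

    look-x : ∀ (v : Vec (Fin card) k) t → lookup (V.map proj₁ (V.map point v)) t ≡ X (lookup v t)
    look-x v t = trans (lookup-map t proj₁ (V.map point v)) (cong proj₁ (lookup-map t point v))

    -- A strict inequality of coordinates decides the order of the ranks, however ties were broken.
    lower : ∀ v → matches σ (V.map point v) ≤ ⟦ incF v ⟧ * ⟦ induces σ rank v ⟧
    lower v with inc (V.map proj₁ (V.map point v)) in ex
               | inc (reindex (V.map proj₂ (V.map point v)) (σ ⟨$⟩ˡ_)) in ey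
    ... | false | _ = z≤n
    ... | true | false = z≤n
    ... | true | true = ≤-reflexive (sym (cong₂ (λ a b → ⟦ a ⟧ * ⟦ b ⟧) isInc isInd))
      where
      isInc : incF v ≡ true
      isInc = lookup-<⇒inc (V.map toℕ v) (λ {i} {j} i<j → subst₂ _<_ (sym (lookup-map i toℕ v)) (sym (lookup-map j toℕ v))
        (ordˣ′ (subst₂ _<_ (look-x v i) (look-x v j) (inc⇒lookup-< (xs v) ex i<j))))
      step : ∀ i j → toℕ (σ ⟨$⟩ʳ i) < toℕ (σ ⟨$⟩ʳ j) →
             toℕ (rank ⟨$⟩ʳ lookup v i) < toℕ (rank ⟨$⟩ʳ lookup v j)
      step i j l = subst₂ (λ a b → toℕ (rank ⟨$⟩ʳ lookup v a) < toℕ (rank ⟨$⟩ʳ lookup v b))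
        (Pm.inverseˡ σ) (Pm.inverseˡ σ)
        (ordʸ′ (subst₂ _<_ (look-y v (σ ⟨$⟩ʳ i)) (look-y v (σ ⟨$⟩ʳ j)) (inc⇒lookup-< (ys v) ey l)))
      back : ∀ i j → toℕ (rank ⟨$⟩ʳ lookup v i) < toℕ (rank ⟨$⟩ʳ lookup v j) →
             toℕ (σ ⟨$⟩ʳ i) < toℕ (σ ⟨$⟩ʳ j)
      back i j l with <-cmp (toℕ (σ ⟨$⟩ʳ i)) (toℕ (σ ⟨$⟩ʳ j))
      ... | tri< m _ _ = m
      ... | tri≈ _ e _ = ⊥-elim (<-irrefl (cong (λ a → toℕ (rank ⟨$⟩ʳ lookup v a)) (inj (toℕ-injective e))) l)
        where
        inj : σ ⟨$⟩ʳ i ≡ σ ⟨$⟩ʳ j → i ≡ j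
        inj e = trans (sym (Pm.inverseˡ σ)) (trans (cong (σ ⟨$⟩ˡ_) e) (Pm.inverseˡ σ))
      ... | tri> _ _ g = ⊥-elim (<-asym l (step j i g))
      isInd : induces σ rank v ≡ true
      isInd = induces⁺ σ rank v step back

    -- Ranks determine the order of the coordinates up to equality. An occurrence that `matches`
    -- misses therefore uses two points with a common coordinate, and `coin` counts it at least
    -- once.
    upper : ∀ v → ⟦ incF v ⟧ * ⟦ induces σ rank v ⟧ ≤
                  matches σ (V.map point v) + (coin (V.map X v) + coin (V.map Y v))
    upper v with incF v in e₁ | induces σ rank v in e₂
    ... | false | _ = z≤n
    ... | true | false = z≤n
    ... | true | true with coin (V.map X v) in ec | coin (V.map Y v) in ed
    ...   | suc c | d = m≤n⇒m≤o+n _ (s≤s z≤n)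
    ...   | zero | suc d = m≤n⇒m≤o+n _ (s≤s z≤n)
    ...   | zero | zero = ≤-reflexive (sym (trans (+-identityʳ _)
              (cong₂ (λ a b → ⟦ a ⟧ * ⟦ b ⟧) isX isY)))
      where
      ne : ∀ (h : Fin card → ℕ) → coin (V.map h v) ≡ 0 → ∀ i j → i ≢ j → h (lookup v i) ≢ h (lookup v j)
      ne h e i j i≢j q = coin≡0⇒≢ (V.map h v) e i j i≢j
        (trans (lookup-map i h v) (trans q (sym (lookup-map j h v))))
      isX : inc (V.map proj₁ (V.map point v)) ≡ true
      isX = lookup-<⇒inc (xs v) (λ {i} {j} i<j → subst₂ _<_ (sym (look-x v i)) (sym (look-x v j))
        (≤∧≢⇒< (ordˣ (subst₂ _<_ (lookup-map i toℕ v) (lookup-map j toℕ v) (inc⇒lookup-< (V.map toℕ v) e₁ i<j)))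
               (ne X ec i j (λ i≡j → <-irrefl (cong toℕ i≡j) i<j))))
      isY : inc (reindex (V.map proj₂ (V.map point v)) (σ ⟨$⟩ˡ_)) ≡ true
      isY = lookup-<⇒inc (ys v) (λ {a} {b} a<b → subst₂ _<_ (sym (look-y v a)) (sym (look-y v b))
        (≤∧≢⇒< (ordʸ (induces⁻ σ rank v e₂ (σ ⟨$⟩ˡ a) (σ ⟨$⟩ˡ b)
                 (subst₂ (λ x y → toℕ x < toℕ y) (sym (Pm.inverseʳ σ)) (sym (Pm.inverseʳ σ)) a<b)))
               (ne Y ed (σ ⟨$⟩ˡ a) (σ ⟨$⟩ˡ b) (λ q → <-irrefl (cong toℕ
                 (trans (sym (Pm.inverseʳ σ)) (trans (cong (σ ⟨$⟩ʳ_) q) (Pm.inverseʳ σ)))) a<b))))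

    count-lower : ∑ⁿ k P (matches σ) ≤ count σ rank
    count-lower = subst₂ _≤_ (sum k (matches σ)) (sym count-∑ⁿ) (∑ⁿ-mono k (fins card) lower)

    count-upper : count σ rank ≤
      ∑ⁿ k P (matches σ) + (∑ⁿ k P (λ v → coin (V.map proj₁ v)) + ∑ⁿ k P (λ v → coin (V.map proj₂ v)))
    count-upper = begin
      count σ rank
        ≡⟨ count-∑ⁿ ⟩
      ∑ⁿ k (fins card) (λ v → ⟦ incF v ⟧ * ⟦ induces σ rank v ⟧)
        ≤⟨ ∑ⁿ-mono k (fins card) upper ⟩
      ∑ⁿ k (fins card) (λ v → matches σ (V.map point v) + (coin (V.map X v) + coin (V.map Y v)))
        ≡⟨ trans (∑ⁿ-+ k (fins card) _ _) (cong₂ _+_ (sum k (matches σ)) (trans (∑ⁿ-+ k (fins card) _ _)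
            (cong₂ _+_ (conv proj₁) (conv proj₂)))) ⟩
      ∑ⁿ k P (matches σ) + (∑ⁿ k P (λ v → coin (V.map proj₁ v)) + ∑ⁿ k P (λ v → coin (V.map proj₂ v))) ∎
      where
      open ≤-Reasoning
      conv : (h : ℕ × ℕ → ℕ) → ∑ⁿ k (fins card) (λ v → coin (V.map (λ x → h (point x)) v)) ≡
                                ∑ⁿ k P (λ v → coin (V.map h v))
      conv h = trans (∑ⁿ-cong k (fins card) (λ v → cong coin (VP.map-∘ h point v)))
                     (sum k (λ v → coin (V.map h v)))

-- Increasing quadruples of coordinates with prescribed cells

module Ties where

  open Sums
  open Counting
  open import Data.Bool using (Bool; true; false; _∧_; if_then_else_)
  open import Data.Bool.Properties using (∧-zeroʳ; ∧-identityʳ)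
  open import Data.Empty using (⊥-elim)
  open import Data.Fin using (Fin; toℕ; zero; suc)
  open import Data.Fin.Properties using (toℕ<n)
  open import Data.List as L using ([]; _∷_; _++_; length)
  open import Data.List.Properties using (length-map; length-++)
  open import Data.Nat as ℕ using (ℕ; zero; suc; _+_; _*_; _≤_; _<_; z≤n)
  open import Data.Nat.Combinatorics using (_C_; nCk+nC[k+1]≡[n+1]C[k+1]; nC1≡n)
  open import Data.Nat.Properties
  open import Data.Nat.Tactic.RingSolver using (solve-∀)
  open import Data.Product using (_×_; _,_)
  open import Data.Unit using (tt)
  open import Data.Vec as V using (Vec; []; _∷_)
  open import Relation.Binary.Definitions using (tri<; tri≈; tri>)
  open import Relation.Binary.PropositionalEquality

  length-subsets : ∀ n k → length (subsets n k) ≡ n C k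
  length-subsets n zero = sym (nC0 n)
    where
    nC0 : ∀ n → n C 0 ≡ 1
    nC0 n = refl
  length-subsets zero (suc k) = refl
  length-subsets (suc n) (suc k) = begin
    length (L.map _ (subsets n k) ++ L.map (V.map suc) (subsets n (suc k)))
      ≡⟨ length-++ (L.map _ (subsets n k)) ⟩
    length (L.map _ (subsets n k)) + length (L.map (V.map suc) (subsets n (suc k)))
      ≡⟨ cong₂ _+_ (trans (length-map _ (subsets n k)) (length-subsets n k))
                   (trans (length-map _ (subsets n (suc k))) (length-subsets n (suc k))) ⟩
    n C k + n C suc k  ≡⟨ nCk+nC[k+1]≡[n+1]C[k+1] n k ⟩
    suc n C suc k      ∎
    where open ≡-Reasoning

  chains : ∀ N k → ∑ⁿ k (fins N) (λ v → ⟦ incF v ⟧) ≡ N C k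
  chains N k = begin
    ∑ⁿ k (fins N) (λ v → ⟦ incF v ⟧)      ≡⟨ ∑ⁿ-cong k (fins N) (λ v → sym (*-identityʳ ⟦ incF v ⟧)) ⟩
    ∑ⁿ k (fins N) (λ v → ⟦ incF v ⟧ * 1)  ≡⟨ sym (∑-subsets N k (λ _ → 1)) ⟩
    ∑ (subsets N k) (λ _ → 1)             ≡⟨ ∑-length (subsets N k) ⟩
    length (subsets N k)                  ≡⟨ length-subsets N k ⟩
    N C k                                 ∎
    where open ≡-Reasoning

  -- Like the next two formulas, the expanded falling factorial with its negative terms moved to the
  -- other side, to stay in ℕ. Pascal's rule gives the induction.
  C2-formula : ∀ N → 2 * (N C 2) + N ≡ N * N
  C2-formula zero = refl
  C2-formula (suc N) = begin
    2 * (suc N C 2) + suc N       ≡⟨ cong (λ c → 2 * c + suc N) (sym (nCk+nC[k+1]≡[n+1]C[k+1] N 1)) ⟩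
    2 * (N C 1 + N C 2) + suc N   ≡⟨ cong (λ c → 2 * (c + N C 2) + suc N) (nC1≡n N) ⟩
    2 * (N + N C 2) + suc N       ≡⟨ solve₁ N (N C 2) ⟩
    (2 * (N C 2) + N) + (N + N + 1) ≡⟨ cong (_+ (N + N + 1)) (C2-formula N) ⟩
    N * N + (N + N + 1)           ≡⟨ solve₂ N ⟩
    suc N * suc N                 ∎
    where
    open ≡-Reasoning
    solve₁ : ∀ n c → 2 * (n + c) + suc n ≡ (2 * c + n) + (n + n + 1)
    solve₁ = solve-∀
    solve₂ : ∀ n → n * n + (n + n + 1) ≡ suc n * suc n
    solve₂ = solve-∀

  C3-formula : ∀ N → 6 * (N C 3) + 3 * (N * N) ≡ N * N * N + 2 * N
  C3-formula zero = refl
  C3-formula (suc N) = begin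
    6 * (suc N C 3) + 3 * (suc N * suc N)
      ≡⟨ cong (λ c → 6 * c + 3 * (suc N * suc N)) (sym (nCk+nC[k+1]≡[n+1]C[k+1] N 2)) ⟩
    6 * (N C 2 + N C 3) + 3 * (suc N * suc N)
      ≡⟨ solve₁ N (N C 2) (N C 3) ⟩
    3 * (2 * (N C 2) + N) + (6 * (N C 3) + 3 * (N * N)) + (3 * N + 3)
      ≡⟨ cong₂ (λ a b → 3 * a + b + (3 * N + 3)) (C2-formula N) (C3-formula N) ⟩
    3 * (N * N) + (N * N * N + 2 * N) + (3 * N + 3)
      ≡⟨ solve₂ N ⟩
    suc N * suc N * suc N + 2 * suc N ∎
    where
    open ≡-Reasoning
    solve₁ : ∀ n c d → 6 * (c + d) + 3 * (suc n * suc n) ≡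
                       3 * (2 * c + n) + (6 * d + 3 * (n * n)) + (3 * n + 3)
    solve₁ = solve-∀
    solve₂ : ∀ n → 3 * (n * n) + (n * n * n + 2 * n) + (3 * n + 3) ≡ suc n * suc n * suc n + 2 * suc n
    solve₂ = solve-∀

  C4-formula : ∀ N → 24 * (N C 4) + (6 * (N * N * N) + 6 * N) ≡ N * N * N * N + 11 * (N * N)
  C4-formula zero = refl
  C4-formula (suc N) = begin
    24 * (suc N C 4) + (6 * (suc N * suc N * suc N) + 6 * suc N)
      ≡⟨ cong (λ c → 24 * c + (6 * (suc N * suc N * suc N) + 6 * suc N)) (sym (nCk+nC[k+1]≡[n+1]C[k+1] N 3)) ⟩
    24 * (N C 3 + N C 4) + (6 * (suc N * suc N * suc N) + 6 * suc N)
      ≡⟨ solve₁ N (N C 3) (N C 4) ⟩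
    4 * (6 * (N C 3) + 3 * (N * N)) + (24 * (N C 4) + (6 * (N * N * N) + 6 * N)) + (6 * (N * N) + 18 * N + 12)
      ≡⟨ cong₂ (λ a b → 4 * a + b + (6 * (N * N) + 18 * N + 12)) (C3-formula N) (C4-formula N) ⟩
    4 * (N * N * N + 2 * N) + (N * N * N * N + 11 * (N * N)) + (6 * (N * N) + 18 * N + 12)
      ≡⟨ solve₂ N ⟩
    suc N * suc N * suc N * suc N + 11 * (suc N * suc N) ∎
    where
    open ≡-Reasoning
    solve₁ : ∀ n c d → 24 * (c + d) + (6 * (suc n * suc n * suc n) + 6 * suc n) ≡
      4 * (6 * c + 3 * (n * n)) + (24 * d + (6 * (n * n * n) + 6 * n)) + (6 * (n * n) + 18 * n + 12)
    solve₁ = solve-∀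
    solve₂ : ∀ n → 4 * (n * n * n + 2 * n) + (n * n * n * n + 11 * (n * n)) + (6 * (n * n) + 18 * n + 12) ≡
      suc n * suc n * suc n * suc n + 11 * (suc n * suc n)
    solve₂ = solve-∀

  C4-upper : ∀ N → 24 * (N C 4) ≤ N * N * N * N
  C4-upper N = +-cancelʳ-≤ (6 * (N * N * N) + 6 * N) _ _
    (≤-trans (≤-reflexive (C4-formula N)) (+-monoʳ-≤ (N * N * N * N) (aux N)))
    where
    aux : ∀ N → 11 * (N * N) ≤ 6 * (N * N * N) + 6 * N
    aux zero = z≤n
    aux (suc zero) = ≤ᵇ⇒≤ 11 12 tt
    aux (suc (suc n)) = ≤-trans (m≤m+n _ _) (≤-reflexive (eq n))
      where
      eq : ∀ n → 11 * (suc (suc n) * suc (suc n)) + (16 + 34 * n + 25 * (n * n) + 6 * (n * n * n))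
                 ≡ 6 * (suc (suc n) * suc (suc n) * suc (suc n)) + 6 * suc (suc n)
      eq = solve-∀

  C4-lower : ∀ N → N * N * N * N ≤ 24 * (N C 4) + 6 * (N * N * N)
  C4-lower N = +-cancelʳ-≤ (6 * N) _ _ (begin
    N * N * N * N + 6 * N                        ≤⟨ +-monoʳ-≤ (N * N * N * N) (aux N) ⟩
    N * N * N * N + 11 * (N * N)                 ≡⟨ sym (C4-formula N) ⟩
    24 * (N C 4) + (6 * (N * N * N) + 6 * N)     ≡⟨ sym (+-assoc (24 * (N C 4)) _ _) ⟩
    24 * (N C 4) + 6 * (N * N * N) + 6 * N       ∎)
    where
    open ≤-Reasoning
    aux : ∀ N → 6 * N ≤ 11 * (N * N)
    aux zero = z≤n
    aux (suc n) = ≤-trans (m≤m+n _ _) (≤-reflexive (eq n))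
      where
      eq : ∀ n → 6 * suc n + (5 + 16 * n + 11 * (n * n)) ≡ 11 * (suc n * suc n)
      eq = solve-∀

  C3-upper : ∀ N → 6 * (N C 3) ≤ N * N * N
  C3-upper N = +-cancelʳ-≤ (3 * (N * N)) _ _
    (≤-trans (≤-reflexive (C3-formula N)) (+-monoʳ-≤ (N * N * N) (aux N)))
    where
    aux : ∀ N → 2 * N ≤ 3 * (N * N)
    aux zero = z≤n
    aux (suc n) = ≤-trans (m≤m+n _ _) (≤-reflexive (eq n))
      where
      eq : ∀ n → 2 * suc n + (1 + 4 * n + 3 * (n * n)) ≡ 3 * (suc n * suc n)
      eq = solve-∀

  C3-lower : ∀ N → N * N * N ≤ 6 * (N C 3) + 3 * (N * N)
  C3-lower N = ≤-trans (m≤m+n _ (2 * N)) (≤-reflexive (sym (C3-formula N)))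

  C2-upper : ∀ N → 2 * (N C 2) ≤ N * N
  C2-upper N = ≤-trans (m≤m+n _ N) (≤-reflexive (C2-formula N))

  C2-lower : ∀ N → N * N ≤ 2 * (N C 2) + N
  C2-lower N = ≤-reflexive (sym (C2-formula N))

  -- The number of orderings of four uniform points compatible with the order of
  -- their cells: 4! divided by the factorials of the sizes of the runs of ties.
  tie : Bool → Bool → Bool → ℕ
  tie false false false = 24
  tie true  false false = 12
  tie false true  false = 12
  tie false false true  = 12
  tie true  false true  = 6
  tie true  true  false = 4
  tie false true  true  = 4
  tie true  true  true  = 1

  -- Divided by 24, the probability that uniform points in the intervals with these four indices
  -- come in increasing order; a descent of indices rules this out.
  kw : Vec ℕ 4 → ℕ
  kw (a ∷ b ∷ c ∷ d ∷ []) =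
    if b ℕ.<ᵇ a then 0 else if c ℕ.<ᵇ b then 0 else if d ℕ.<ᵇ c then 0 else
    tie (a ℕ.≡ᵇ b) (b ℕ.≡ᵇ c) (c ℕ.≡ᵇ d)

  tie≤24 : ∀ a b c → tie a b c ≤ 24
  tie≤24 false false false = ≤ᵇ⇒≤ 24 24 tt
  tie≤24 true  false false = ≤ᵇ⇒≤ 12 24 tt
  tie≤24 false true  false = ≤ᵇ⇒≤ 12 24 tt
  tie≤24 false false true  = ≤ᵇ⇒≤ 12 24 tt
  tie≤24 true  false true  = ≤ᵇ⇒≤ 6 24 tt
  tie≤24 true  true  false = ≤ᵇ⇒≤ 4 24 tt
  tie≤24 false true  true  = ≤ᵇ⇒≤ 4 24 tt
  tie≤24 true  true  true  = ≤ᵇ⇒≤ 1 24 tt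

  kw≤24 : ∀ r → kw r ≤ 24
  kw≤24 (a ∷ b ∷ c ∷ d ∷ []) with b ℕ.<ᵇ a | c ℕ.<ᵇ b | d ℕ.<ᵇ c
  ... | true  | _     | _     = z≤n
  ... | false | true  | _     = z≤n
  ... | false | false | true  = z≤n
  ... | false | false | false = tie≤24 (a ℕ.≡ᵇ b) (b ℕ.≡ᵇ c) (c ℕ.≡ᵇ d)

  module Digits (N : ℕ) where

    -- A coordinate is a two-digit number in base N: the index of the row or column, then the offset
    -- inside it.
    key : ∀ {k} → Vec ℕ k → Vec (Fin N) k → Vec ℕ k
    key = V.zipWith (λ i a → i * N + toℕ a)

    K : Vec ℕ 4 → ℕ
    K r = ∑ⁿ 4 (fins N) (λ a → ⟦ inc (key r a) ⟧)

    data Ord : Set where lt eq gt : Ord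

    lex : Ord → Fin N → Fin N → Bool
    lex lt a b = true
    lex eq a b = toℕ a ℕ.<ᵇ toℕ b
    lex gt a b = false

    key-lt : ∀ {i j} (a b : Fin N) → i < j → i * N + toℕ a < j * N + toℕ b
    key-lt {i} {j} a b i<j = begin-strict
      i * N + toℕ a  <⟨ +-monoʳ-< (i * N) (toℕ<n a) ⟩
      i * N + N      ≡⟨ +-comm (i * N) N ⟩
      suc i * N      ≤⟨ *-monoˡ-≤ N i<j ⟩
      j * N          ≤⟨ m≤m+n (j * N) (toℕ b) ⟩
      j * N + toℕ b  ∎
      where open ≤-Reasoning

    <ᵇ-+ : ∀ m a b → (m + a ℕ.<ᵇ m + b) ≡ (a ℕ.<ᵇ b)
    <ᵇ-+ zero a b = refl
    <ᵇ-+ (suc m) a b = <ᵇ-+ m a b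

    -- The comparisons of consecutive indices determine `K`, which leaves 27 cases: zero if some
    -- step descends, and otherwise a product of binomial coefficients, one for each run of equal
    -- indices.
    L : Ord → Ord → Ord → ℕ
    L o p q = ∑ (fins N) λ a → ∑ (fins N) λ b → ∑ (fins N) λ c → ∑ (fins N) λ d →
              ⟦ lex o a b ∧ (lex p b c ∧ lex q c d) ⟧

    isGt isEq : Ord → Bool
    isGt gt = true
    isGt _  = false
    isEq eq = true
    isEq _  = false

    -- Bundles how the order of two indices settles both the comparison of keys, which `K` uses, and
    -- the two Boolean tests in `kw`.
    record Cmp (i j : ℕ) : Set where
      field
        ord  : Ord
        keys : ∀ a b → (i * N + toℕ a ℕ.<ᵇ j * N + toℕ b) ≡ lex ord a b
        gt?  : (j ℕ.<ᵇ i) ≡ isGt ord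
        tied?  : (i ℕ.≡ᵇ j) ≡ isEq ord

    ≡ᵇ-false : ∀ {a b} → a ≢ b → (a ℕ.≡ᵇ b) ≡ false
    ≡ᵇ-false {a} {b} ne with a ℕ.≡ᵇ b in e
    ... | false = refl
    ... | true = ⊥-elim (ne (≡ᵇ⇒≡ a b (≡true⇒T e)))

    cmp : ∀ i j → Cmp i j
    cmp i j with <-cmp i j
    ... | tri< l ne _ = record
      { ord = lt ; keys = λ a b → <ᵇ-true (key-lt a b l) ; gt? = <ᵇ-false (<-asym l) ; tied? = ≡ᵇ-false ne }
    ... | tri≈ _ refl _ = record
      { ord = eq ; keys = λ a b → <ᵇ-+ (i * N) (toℕ a) (toℕ b)
      ; gt? = <ᵇ-false (<-irrefl {i} refl) ; tied? = T⇒≡true (≡⇒≡ᵇ i i refl) }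
    ... | tri> _ ne g = record
      { ord = gt ; keys = λ a b → <ᵇ-false (<-asym (key-lt b a g)) ; gt? = <ᵇ-true g ; tied? = ≡ᵇ-false ne }

    kwO : Ord → Ord → Ord → ℕ
    kwO o p q = if isGt o then 0 else if isGt p then 0 else if isGt q then 0 else
                tie (isEq o) (isEq p) (isEq q)

    K-ord : ∀ {i j k l} (o : Cmp i j) (p : Cmp j k) (q : Cmp k l) →
            K (i ∷ j ∷ k ∷ l ∷ []) ≡ L (Cmp.ord o) (Cmp.ord p) (Cmp.ord q)
    K-ord o p q = ∑-cong (fins N) λ a → ∑-cong (fins N) λ b → ∑-cong (fins N) λ c → ∑-cong (fins N) λ d → cong ⟦_⟧
      (cong₂ _∧_ (Cmp.keys o a b) (cong₂ _∧_ (Cmp.keys p b c)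
        (trans (∧-identityʳ _) (Cmp.keys q c d))))

    kw-ord : ∀ {i j k l} (o : Cmp i j) (p : Cmp j k) (q : Cmp k l) →
             kw (i ∷ j ∷ k ∷ l ∷ []) ≡ kwO (Cmp.ord o) (Cmp.ord p) (Cmp.ord q)
    kw-ord o p q rewrite Cmp.gt? o | Cmp.gt? p | Cmp.gt? q | Cmp.tied? o | Cmp.tied? p | Cmp.tied? q = refl

    ∑-N : ∀ c → ∑ (fins N) (λ _ → c) ≡ N * c
    ∑-N c = trans (∑-const c (fins N)) (cong (_* c) (length-fins N))

    lessᵇ : Fin N → Fin N → ℕ
    lessᵇ a b = ⟦ toℕ a ℕ.<ᵇ toℕ b ⟧

    pairs : ∑ (fins N) (λ a → ∑ (fins N) (lessᵇ a)) ≡ N C 2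
    pairs = trans (∑-cong (fins N) λ a → ∑-cong (fins N) λ b → cong ⟦_⟧ (sym (∧-identityʳ _))) (chains N 2)

    triples : ∑ (fins N) (λ a → ∑ (fins N) λ b → ∑ (fins N) λ c → ⟦ (toℕ a ℕ.<ᵇ toℕ b) ∧ (toℕ b ℕ.<ᵇ toℕ c) ⟧) ≡ N C 3
    triples = trans (∑-cong (fins N) λ a → ∑-cong (fins N) λ b → ∑-cong (fins N) λ c →
      cong (λ t → ⟦ (toℕ a ℕ.<ᵇ toℕ b) ∧ t ⟧) (sym (∧-identityʳ _))) (chains N 3)

    ⟦∧⟧ : ∀ x y → ⟦ x ∧ y ⟧ ≡ ⟦ x ⟧ * ⟦ y ⟧
    ⟦∧⟧ true y = sym (+-identityʳ _)
    ⟦∧⟧ false y = refl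

    L-lll : L lt lt lt ≡ N * (N * (N * (N * 1)))
    L-lll = trans (∑-cong (fins N) λ a → trans (∑-cong (fins N) λ b → trans (∑-cong (fins N) λ c → ∑-N 1) (∑-N _)) (∑-N _)) (∑-N _)

    L-ell : L eq lt lt ≡ N * (N * (N C 2))
    L-ell = begin
      L eq lt lt
        ≡⟨ (∑-cong (fins N) λ a → ∑-cong (fins N) λ b → trans (∑-cong (fins N) λ c → trans (∑-cong (fins N) λ d → cong ⟦_⟧ (∧-identityʳ _)) (∑-N _)) (∑-N _)) ⟩
      ∑ (fins N) (λ a → ∑ (fins N) λ b → N * (N * lessᵇ a b))
        ≡⟨ (∑-cong (fins N) λ a → trans (∑-*ˡ N (fins N) _) (cong (N *_) (∑-*ˡ N (fins N) _))) ⟩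
      ∑ (fins N) (λ a → N * (N * ∑ (fins N) (lessᵇ a)))
        ≡⟨ trans (∑-*ˡ N (fins N) _) (cong (N *_) (∑-*ˡ N (fins N) _)) ⟩
      N * (N * ∑ (fins N) (λ a → ∑ (fins N) (lessᵇ a)))  ≡⟨ cong (λ t → N * (N * t)) pairs ⟩
      N * (N * (N C 2)) ∎
      where open ≡-Reasoning

    L-lel : L lt eq lt ≡ N * (N * (N C 2))
    L-lel = begin
      L lt eq lt
        ≡⟨ (∑-cong (fins N) λ a → ∑-cong (fins N) λ b → trans (∑-cong (fins N) λ c → trans (∑-cong (fins N) λ d → cong ⟦_⟧ (∧-identityʳ _)) (∑-N _)) (∑-*ˡ N (fins N) _)) ⟩
      ∑ (fins N) (λ a → ∑ (fins N) λ b → N * ∑ (fins N) (lessᵇ b))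
        ≡⟨ trans (∑-N _) (cong (N *_) (∑-*ˡ N (fins N) _)) ⟩
      N * (N * ∑ (fins N) (λ a → ∑ (fins N) (lessᵇ a)))  ≡⟨ cong (λ t → N * (N * t)) pairs ⟩
      N * (N * (N C 2)) ∎
      where open ≡-Reasoning

    L-lle : L lt lt eq ≡ N * (N * (N C 2))
    L-lle = trans (trans (∑-cong (fins N) λ a → ∑-N _) (∑-N _)) (cong (λ t → N * (N * t)) pairs)

    L-ele : L eq lt eq ≡ (N C 2) * (N C 2)
    L-ele = begin
      L eq lt eq
        ≡⟨ (∑-cong (fins N) λ a → ∑-cong (fins N) λ b → ∑-cong (fins N) λ c → trans (∑-cong (fins N) λ d → ⟦∧⟧ (toℕ a ℕ.<ᵇ toℕ b) _) (∑-*ˡ (lessᵇ a b) (fins N) _)) ⟩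
      ∑ (fins N) (λ a → ∑ (fins N) λ b → ∑ (fins N) λ c → lessᵇ a b * ∑ (fins N) (lessᵇ c))
        ≡⟨ (∑-cong (fins N) λ a → ∑-cong (fins N) λ b → trans (∑-*ˡ (lessᵇ a b) (fins N) _) (trans (cong (lessᵇ a b *_) pairs) (*-comm (lessᵇ a b) _))) ⟩
      ∑ (fins N) (λ a → ∑ (fins N) λ b → (N C 2) * lessᵇ a b)
        ≡⟨ trans (∑-cong (fins N) λ a → ∑-*ˡ (N C 2) (fins N) _) (∑-*ˡ (N C 2) (fins N) _) ⟩
      (N C 2) * ∑ (fins N) (λ a → ∑ (fins N) (lessᵇ a))  ≡⟨ cong ((N C 2) *_) pairs ⟩
      (N C 2) * (N C 2) ∎
      where open ≡-Reasoning

    L-eel : L eq eq lt ≡ N * (N C 3)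
    L-eel = begin
      L eq eq lt
        ≡⟨ (∑-cong (fins N) λ a → ∑-cong (fins N) λ b → trans (∑-cong (fins N) λ c → trans (∑-cong (fins N) λ d → cong (λ t → ⟦ (toℕ a ℕ.<ᵇ toℕ b) ∧ t ⟧) (∧-identityʳ _)) (∑-N _)) (∑-*ˡ N (fins N) _)) ⟩
      ∑ (fins N) (λ a → ∑ (fins N) λ b → N * ∑ (fins N) λ c → ⟦ (toℕ a ℕ.<ᵇ toℕ b) ∧ (toℕ b ℕ.<ᵇ toℕ c) ⟧)
        ≡⟨ trans (∑-cong (fins N) λ a → ∑-*ˡ N (fins N) _) (∑-*ˡ N (fins N) _) ⟩
      N * ∑ (fins N) (λ a → ∑ (fins N) λ b → ∑ (fins N) λ c → ⟦ (toℕ a ℕ.<ᵇ toℕ b) ∧ (toℕ b ℕ.<ᵇ toℕ c) ⟧)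
        ≡⟨ cong (N *_) triples ⟩
      N * (N C 3) ∎
      where open ≡-Reasoning

    L-lee : L lt eq eq ≡ N * (N C 3)
    L-lee = trans (∑-N _) (cong (N *_) triples)

    L-eee : L eq eq eq ≡ N C 4
    L-eee = trans (∑-cong (fins N) λ a → ∑-cong (fins N) λ b → ∑-cong (fins N) λ c → ∑-cong (fins N) λ d →
      cong (λ t → ⟦ (toℕ a ℕ.<ᵇ toℕ b) ∧ ((toℕ b ℕ.<ᵇ toℕ c) ∧ t) ⟧) (sym (∧-identityʳ _))) (chains N 4)

    L-g : ∀ p q → L gt p q ≡ 0
    L-g p q = trans (∑-cong (fins N) λ a → trans (∑-cong (fins N) λ b → trans (∑-cong (fins N) λ c → ∑-0 (fins N)) (∑-0 (fins N))) (∑-0 (fins N))) (∑-0 (fins N))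

    L-xg : ∀ o q → L o gt q ≡ 0
    L-xg o q = trans (∑-cong (fins N) λ a → trans (∑-cong (fins N) λ b → trans (∑-cong (fins N) λ c → trans (∑-cong (fins N) λ d →
      cong ⟦_⟧ (∧-zeroʳ _)) (∑-0 (fins N))) (∑-0 (fins N))) (∑-0 (fins N))) (∑-0 (fins N))

    L-xxg : ∀ o p → L o p gt ≡ 0
    L-xxg o p = trans (∑-cong (fins N) λ a → trans (∑-cong (fins N) λ b → trans (∑-cong (fins N) λ c → trans (∑-cong (fins N) λ d →
      cong ⟦_⟧ (trans (cong (lex o a b ∧_) (∧-zeroʳ _)) (∧-zeroʳ _))) (∑-0 (fins N))) (∑-0 (fins N))) (∑-0 (fins N))) (∑-0 (fins N))

    N³ N⁴ : ℕ
    N³ = N * N * N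
    N⁴ = N * N * N * N

    -- The deviation is one-sided because coinciding offsets can only lose quadruples. The constant
    -- 12 is large enough for every pattern of ties.
    Bounds : ℕ → ℕ → Set
    Bounds x k = (24 * x ≤ k * N⁴) × (k * N⁴ ≤ 24 * x + 12 * N³)

    bounds-0 : ∀ {x} → x ≡ 0 → Bounds x 0
    bounds-0 refl = z≤n , z≤n

    bounds-lll : Bounds (N * (N * (N * (N * 1)))) 24
    bounds-lll = ≤-reflexive (e N) , ≤-trans (≤-reflexive (sym (e N))) (m≤m+n _ _)
      where
      e : ∀ n → 24 * (n * (n * (n * (n * 1)))) ≡ 24 * (n * n * n * n)
      e = solve-∀

    bounds-2 : Bounds (N * (N * (N C 2))) 12
    bounds-2 =
      ≤-trans (≤-reflexive (e₁ N (N C 2))) (≤-trans (*-monoʳ-≤ (12 * (N * N)) (C2-upper N)) (≤-reflexive (e₂ N))) ,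
      ≤-trans (≤-reflexive (sym (e₂ N))) (≤-trans (*-monoʳ-≤ (12 * (N * N)) (C2-lower N)) (≤-reflexive (e₃ N (N C 2))))
      where
      e₁ : ∀ n c → 24 * (n * (n * c)) ≡ 12 * (n * n) * (2 * c)
      e₁ = solve-∀
      e₂ : ∀ n → 12 * (n * n) * (n * n) ≡ 12 * (n * n * n * n)
      e₂ = solve-∀
      e₃ : ∀ n c → 12 * (n * n) * (2 * c + n) ≡ 24 * (n * (n * c)) + 12 * (n * n * n)
      e₃ = solve-∀

    bounds-22 : Bounds ((N C 2) * (N C 2)) 6
    bounds-22 =
      ≤-trans (≤-reflexive (e₁ (N C 2))) (≤-trans (*-monoʳ-≤ 6 (*-mono-≤ (C2-upper N) (C2-upper N))) (≤-reflexive (e₂ N))) ,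
      (begin
        6 * (N * N * N * N)                               ≡⟨ sym (e₂ N) ⟩
        6 * ((N * N) * (N * N))                           ≤⟨ *-monoʳ-≤ 6 (*-monoˡ-≤ (N * N) (C2-lower N)) ⟩
        6 * ((2 * (N C 2) + N) * (N * N))                 ≡⟨ e₃ (N C 2) N ⟩
        6 * (2 * (N C 2) * (N * N)) + 6 * (N * N * N)     ≤⟨ +-monoˡ-≤ _ (*-monoʳ-≤ 6 (*-monoʳ-≤ (2 * (N C 2)) (C2-lower N))) ⟩
        6 * (2 * (N C 2) * (2 * (N C 2) + N)) + 6 * (N * N * N) ≡⟨ e₄ (N C 2) N ⟩
        24 * ((N C 2) * (N C 2)) + 6 * (2 * (N C 2) * N) + 6 * (N * N * N)
          ≤⟨ +-monoˡ-≤ (6 * (N * N * N)) (+-monoʳ-≤ (24 * ((N C 2) * (N C 2))) (*-monoʳ-≤ 6 (*-monoˡ-≤ N (C2-upper N)))) ⟩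
        24 * ((N C 2) * (N C 2)) + 6 * (N * N * N) + 6 * (N * N * N) ≡⟨ e₅ (24 * ((N C 2) * (N C 2))) (N * N * N) ⟩
        24 * ((N C 2) * (N C 2)) + 12 * (N * N * N)       ∎)
      where
      open ≤-Reasoning
      e₁ : ∀ c → 24 * (c * c) ≡ 6 * ((2 * c) * (2 * c))
      e₁ = solve-∀
      e₂ : ∀ n → 6 * ((n * n) * (n * n)) ≡ 6 * (n * n * n * n)
      e₂ = solve-∀
      e₃ : ∀ c n → 6 * ((2 * c + n) * (n * n)) ≡ 6 * (2 * c * (n * n)) + 6 * (n * n * n)
      e₃ = solve-∀
      e₄ : ∀ c n → 6 * (2 * c * (2 * c + n)) + 6 * (n * n * n) ≡ 24 * (c * c) + 6 * (2 * c * n) + 6 * (n * n * n)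
      e₄ = solve-∀
      e₅ : ∀ x y → x + 6 * y + 6 * y ≡ x + 12 * y
      e₅ = solve-∀

    bounds-3 : Bounds (N * (N C 3)) 4
    bounds-3 =
      ≤-trans (≤-reflexive (e₁ N (N C 3))) (≤-trans (*-monoʳ-≤ (4 * N) (C3-upper N)) (≤-reflexive (e₂ N))) ,
      ≤-trans (≤-reflexive (sym (e₂ N))) (≤-trans (*-monoʳ-≤ (4 * N) (C3-lower N)) (≤-reflexive (e₃ N (N C 3))))
      where
      e₁ : ∀ n c → 24 * (n * c) ≡ 4 * n * (6 * c)
      e₁ = solve-∀
      e₂ : ∀ n → 4 * n * (n * n * n) ≡ 4 * (n * n * n * n)
      e₂ = solve-∀
      e₃ : ∀ n c → 4 * n * (6 * c + 3 * (n * n)) ≡ 24 * (n * c) + 12 * (n * n * n)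
      e₃ = solve-∀

    bounds-4 : Bounds (N C 4) 1
    bounds-4 =
      ≤-trans (C4-upper N) (≤-reflexive (sym (*-identityˡ _))) ,
      ≤-trans (≤-reflexive (*-identityˡ _)) (≤-trans (C4-lower N)
        (+-monoʳ-≤ (24 * (N C 4)) (*-monoˡ-≤ (N * N * N) (≤ᵇ⇒≤ 6 12 tt))))

    L-bounds : ∀ o p q → Bounds (L o p q) (kwO o p q)
    L-bounds gt p q = bounds-0 (L-g p q)
    L-bounds lt gt q = bounds-0 (L-xg lt q)
    L-bounds eq gt q = bounds-0 (L-xg eq q)
    L-bounds lt lt gt = bounds-0 (L-xxg lt lt)
    L-bounds lt eq gt = bounds-0 (L-xxg lt eq)
    L-bounds eq lt gt = bounds-0 (L-xxg eq lt)
    L-bounds eq eq gt = bounds-0 (L-xxg eq eq)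
    L-bounds lt lt lt = subst (λ x → Bounds x 24) (sym L-lll) bounds-lll
    L-bounds eq lt lt = subst (λ x → Bounds x 12) (sym L-ell) bounds-2
    L-bounds lt eq lt = subst (λ x → Bounds x 12) (sym L-lel) bounds-2
    L-bounds lt lt eq = subst (λ x → Bounds x 12) (sym L-lle) bounds-2
    L-bounds eq lt eq = subst (λ x → Bounds x 6) (sym L-ele) bounds-22
    L-bounds eq eq lt = subst (λ x → Bounds x 4) (sym L-eel) bounds-3
    L-bounds lt eq eq = subst (λ x → Bounds x 4) (sym L-lee) bounds-3
    L-bounds eq eq eq = subst (λ x → Bounds x 1) (sym L-eee) bounds-4

    K-bounds : ∀ r → Bounds (K r) (kw r)
    K-bounds (i ∷ j ∷ k ∷ l ∷ []) =
      subst₂ Bounds (sym (K-ord (cmp i j) (cmp j k) (cmp k l))) (sym (kw-ord (cmp i j) (cmp j k) (cmp k l)))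
        (L-bounds (Cmp.ord (cmp i j)) (Cmp.ord (cmp j k)) (Cmp.ord (cmp k l)))

-- Blow-ups of weighted templates

module Templates where

  open Sums
  open Counting
  open Ties
  open import Data.Fin using (Fin; toℕ; zero; suc)
  open import Data.Fin.Permutation as Pm using (_⟨$⟩ˡ_)
  open import Data.List as L using (List; []; _∷_; length; concatMap; replicate)
  open import Data.List.Properties using (length-replicate)
  open import Data.Nat as ℕ using (ℕ; zero; suc; _+_; _*_; _≤_; z≤n; _^_)
  open import Data.Nat.Properties
  open import Data.Nat.Tactic.RingSolver using (solve-∀)
  open import Data.Product using (_×_; _,_; proj₁; proj₂)
  open import Data.Unit using (tt)
  open import Data.Vec as V using (Vec; []; _∷_; lookup)
  open import Data.Vec.Properties using (lookup∘tabulate; lookup-zipWith)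
  open import Relation.Binary.PropositionalEquality

  ∑ⁿ-∏ : ∀ {A : Set} k (xs : List A) (w : A → ℕ) → ∑ⁿ k xs (∏ w) ≡ ∑ xs w ^ k
  ∑ⁿ-∏ zero xs w = refl
  ∑ⁿ-∏ (suc k) xs w = begin
    ∑ xs (λ x → ∑ⁿ k xs (λ v → w x * ∏ w v))
      ≡⟨ ∑-cong xs (λ x → trans (∑ⁿ-*ˡ (w x) k xs (∏ w)) (trans (cong (w x *_) (∑ⁿ-∏ k xs w)) (*-comm (w x) _))) ⟩
    ∑ xs (λ x → ∑ xs w ^ k * w x)  ≡⟨ ∑-*ˡ (∑ xs w ^ k) xs w ⟩
    ∑ xs w ^ k * ∑ xs w            ≡⟨ *-comm (∑ xs w ^ k) _ ⟩
    ∑ xs w ^ suc k                 ∎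
    where open ≡-Reasoning

  ∑ⁿ-product : ∀ {A B : Set} k l (xs : List A) (ys : List B) (f : Vec A k → ℕ) (g : Vec B l → ℕ) →
               ∑ⁿ k xs (λ u → ∑ⁿ l ys (λ v → f u * g v)) ≡ ∑ⁿ k xs f * ∑ⁿ l ys g
  ∑ⁿ-product k l xs ys f g = begin
    ∑ⁿ k xs (λ u → ∑ⁿ l ys (λ v → f u * g v))
      ≡⟨ ∑ⁿ-cong k xs (λ u → trans (∑ⁿ-*ˡ (f u) l ys g) (*-comm (f u) _)) ⟩
    ∑ⁿ k xs (λ u → ∑ⁿ l ys g * f u)  ≡⟨ ∑ⁿ-*ˡ (∑ⁿ l ys g) k xs f ⟩
    ∑ⁿ l ys g * ∑ⁿ k xs f            ≡⟨ *-comm (∑ⁿ l ys g) _ ⟩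
    ∑ⁿ k xs f * ∑ⁿ l ys g            ∎
    where open ≡-Reasoning

  at-most-once : ∀ n x m → ∑ (fins n) (λ a → ⟦ x ℕ.≡ᵇ (m + toℕ a) ⟧) ≤ 1
  at-most-once n zero zero = go n
    where
    go : ∀ n → ∑ (fins n) (λ a → ⟦ 0 ℕ.≡ᵇ toℕ a ⟧) ≤ 1
    go zero = z≤n
    go (suc n) = ≤-reflexive (cong suc (trans (∑-map suc (fins n) _) (∑-0 (fins n))))
  at-most-once n zero (suc m) = ≤-trans (≤-reflexive (∑-0 (fins n))) z≤n
  at-most-once zero (suc x) zero = z≤n
  at-most-once (suc n) (suc x) zero = ≤-trans (≤-reflexive (∑-map suc (fins n) _)) (at-most-once n x zero)
  at-most-once n (suc x) (suc m) = at-most-once n x m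

  -- 24 and 12 are kept opaque so that conversion checking never unfolds multiples of them.
  abstract
    c₂₄ d₁₂ : ℕ
    c₂₄ = 24
    d₁₂ = 12

    c₂₄≡ : c₂₄ ≡ 24
    c₂₄≡ = refl

    d₁₂≡ : d₁₂ ≡ 12
    d₁₂≡ = refl

  -- The estimates for the two coordinates are multiplied. Each main term is at most c m, so each of
  -- the two mixed error terms is at most c d m n.
  product-bounds : ∀ c d m n {x y k l} → (c * x ≤ k * m) × (k * m ≤ c * x + d * n) →
    (c * y ≤ l * m) × (l * m ≤ c * y + d * n) → k ≤ c → l ≤ c →
    (c * c * (x * y) ≤ m * m * (k * l)) × (m * m * (k * l) ≤ c * c * (x * y) + c * (d + d) * (m * n))
  product-bounds c d m n {x} {y} {k} {l} (p , q) (p′ , q′) k≤ l≤ =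
    (begin
      c * c * (x * y)      ≡⟨ e₁ c x y ⟩
      (c * x) * (c * y)    ≤⟨ *-mono-≤ p p′ ⟩
      (k * m) * (l * m)    ≡⟨ e₂ k l m ⟩
      m * m * (k * l)      ∎) ,
    (begin
      m * m * (k * l)                                      ≡⟨ sym (e₂ k l m) ⟩
      (k * m) * (l * m)                                    ≤⟨ *-monoˡ-≤ (l * m) q ⟩
      (c * x + d * n) * (l * m)                            ≡⟨ *-distribʳ-+ (l * m) (c * x) (d * n) ⟩
      c * x * (l * m) + d * n * (l * m)                    ≤⟨ +-mono-≤ (*-monoʳ-≤ (c * x) q′)
                                                                (*-monoʳ-≤ (d * n) (*-monoˡ-≤ m l≤)) ⟩
      c * x * (c * y + d * n) + d * n * (c * m)            ≡⟨ cong (_+ d * n * (c * m)) (*-distribˡ-+ (c * x) (c * y) (d * n)) ⟩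
      c * x * (c * y) + c * x * (d * n) + d * n * (c * m)
        ≤⟨ +-monoˡ-≤ (d * n * (c * m)) (+-monoʳ-≤ (c * x * (c * y)) (*-monoˡ-≤ (d * n)
             (≤-trans p (*-monoˡ-≤ m k≤)))) ⟩
      c * x * (c * y) + c * m * (d * n) + d * n * (c * m)  ≡⟨ e₃ c d x y m n ⟩
      c * c * (x * y) + c * (d + d) * (m * n)              ∎)
    where
    open ≤-Reasoning
    e₁ : ∀ c x y → c * c * (x * y) ≡ (c * x) * (c * y)
    e₁ = solve-∀
    e₂ : ∀ k l m → (k * m) * (l * m) ≡ m * m * (k * l)
    e₂ = solve-∀
    e₃ : ∀ c d x y m n → c * x * (c * y) + c * m * (d * n) + d * n * (c * m) ≡ c * c * (x * y) + c * (d + d) * (m * n)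
    e₃ = solve-∀

  module Template {A : Set} (row col : A → ℕ) (cs : List A) where

    -- Divided by 24 squared, the probability that uniform points in the cells u are increasing in
    -- the first coordinate and form σ. The coordinates are independent, hence a product; the
    -- inverse of σ lists the cells by second coordinate.
    κ : Perm 4 → Vec A 4 → ℕ
    κ σ u = kw (V.map row u) * kw (reindex (V.map col u) (σ ⟨$⟩ˡ_))

    Φ : Perm 4 → (A → ℕ) → ℕ
    Φ σ w = ∑ⁿ 4 cs (λ u → ∏ w u * κ σ u)

    module _ (w : A → ℕ) (N : ℕ) where
      open Digits N

      s : ℕ
      s = ∑ cs w

      pt : A → Fin N → Fin N → ℕ × ℕ
      pt c a b = row c * N + toℕ a , col c * N + toℕ b

      grid : A → List (ℕ × ℕ)
      grid c = concatMap (λ a → L.map (pt c a) (fins N)) (fins N)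

      -- A cell of weight m is m coinciding copies of an N by N grid. The copies create ties, but a
      -- given coordinate is still shared by at most N s of the N² s points.
      points : List (ℕ × ℕ)
      points = concatMap (λ c → concatMap (λ _ → grid c) (replicate (w c) tt)) cs

      ∑-points : ∀ f → ∑ points f ≡ ∑ cs (λ c → w c * ∑ (fins N) (λ a → ∑ (fins N) (λ b → f (pt c a b))))
      ∑-points f = trans (∑-concatMap _ cs f) (∑-cong cs (λ c → begin
        ∑ (concatMap (λ _ → grid c) (replicate (w c) tt)) f
          ≡⟨ ∑-concatMap _ (replicate (w c) tt) f ⟩
        ∑ (replicate (w c) tt) (λ _ → ∑ (grid c) f)
          ≡⟨ trans (∑-const _ (replicate (w c) tt)) (cong (_* ∑ (grid c) f) (length-replicate (w c))) ⟩
        w c * ∑ (grid c) f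
          ≡⟨ cong (w c *_) (trans (∑-concatMap _ (fins N) f) (∑-cong (fins N) (λ a → ∑-map (pt c a) (fins N) f))) ⟩
        w c * ∑ (fins N) (λ a → ∑ (fins N) (λ b → f (pt c a b))) ∎))
        where open ≡-Reasoning

      length-points : length points ≡ N * N * s
      length-points = begin
        length points                                                  ≡⟨ sym (∑-length points) ⟩
        ∑ points (λ _ → 1)                                             ≡⟨ ∑-points _ ⟩
        ∑ cs (λ c → w c * ∑ (fins N) (λ a → ∑ (fins N) (λ b → 1)))
          ≡⟨ ∑-cong cs (λ c → trans (cong (w c *_) (trans (∑-cong (fins N) (λ a → ∑-N 1)) (∑-N (N * 1)))) (e (w c) N)) ⟩
        ∑ cs (λ c → N * N * w c)                                       ≡⟨ ∑-*ˡ (N * N) cs w ⟩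
        N * N * s                                                      ∎
        where
        open ≡-Reasoning
        e : ∀ x n → x * (n * (n * 1)) ≡ n * n * x
        e = solve-∀

      tiesˣ : ∀ x → ∑ points (λ p → ⟦ x ℕ.≡ᵇ proj₁ p ⟧) ≤ N * s
      tiesˣ x = begin
        ∑ points (λ p → ⟦ x ℕ.≡ᵇ proj₁ p ⟧)
          ≡⟨ ∑-points _ ⟩
        ∑ cs (λ c → w c * ∑ (fins N) (λ a → ∑ (fins N) (λ b → ⟦ x ℕ.≡ᵇ (row c * N + toℕ a) ⟧)))
          ≡⟨ ∑-cong cs (λ c → cong (w c *_) (trans (∑-cong (fins N) (λ a → ∑-N _)) (∑-*ˡ N (fins N) _))) ⟩
        ∑ cs (λ c → w c * (N * ∑ (fins N) (λ a → ⟦ x ℕ.≡ᵇ (row c * N + toℕ a) ⟧)))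
          ≤⟨ ∑-mono cs (λ c → *-monoʳ-≤ (w c) (*-monoʳ-≤ N (at-most-once N x (row c * N)))) ⟩
        ∑ cs (λ c → w c * (N * 1))
          ≡⟨ trans (∑-cong cs (λ c → e (w c) N)) (∑-*ˡ N cs w) ⟩
        N * s ∎
        where
        open ≤-Reasoning
        e : ∀ x n → x * (n * 1) ≡ n * x
        e = solve-∀

      tiesʸ : ∀ y → ∑ points (λ p → ⟦ y ℕ.≡ᵇ proj₂ p ⟧) ≤ N * s
      tiesʸ y = begin
        ∑ points (λ p → ⟦ y ℕ.≡ᵇ proj₂ p ⟧)
          ≡⟨ ∑-points _ ⟩
        ∑ cs (λ c → w c * ∑ (fins N) (λ a → ∑ (fins N) (λ b → ⟦ y ℕ.≡ᵇ (col c * N + toℕ b) ⟧)))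
          ≡⟨ ∑-cong cs (λ c → cong (w c *_) (∑-N _)) ⟩
        ∑ cs (λ c → w c * (N * ∑ (fins N) (λ a → ⟦ y ℕ.≡ᵇ (col c * N + toℕ a) ⟧)))
          ≤⟨ ∑-mono cs (λ c → *-monoʳ-≤ (w c) (*-monoʳ-≤ N (at-most-once N y (col c * N)))) ⟩
        ∑ cs (λ c → w c * (N * 1))
          ≡⟨ trans (∑-cong cs (λ c → e (w c) N)) (∑-*ˡ N cs w) ⟩
        N * s ∎
        where
        open ≤-Reasoning
        e : ∀ x n → x * (n * 1) ≡ n * x
        e = solve-∀

      map-proj₁ : ∀ {k} (u : Vec A k) a b → V.map proj₁ (zip₃ pt u a b) ≡ key (V.map row u) a
      map-proj₁ [] [] [] = refl
      map-proj₁ (c ∷ u) (a ∷ v) (b ∷ t) = cong (_ ∷_) (map-proj₁ u v t)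

      map-proj₂ : ∀ {k} (u : Vec A k) a b → V.map proj₂ (zip₃ pt u a b) ≡ key (V.map col u) b
      map-proj₂ [] [] [] = refl
      map-proj₂ (c ∷ u) (a ∷ v) (b ∷ t) = cong (_ ∷_) (map-proj₂ u v t)

      reindex-key : ∀ {k} (r : Vec ℕ k) (b : Vec (Fin N) k) g →
                    reindex (key r b) g ≡ key (reindex r g) (reindex b g)
      reindex-key r b g = lookup-ext (λ t → begin
        lookup (reindex (key r b) g) t                      ≡⟨ lookup∘tabulate _ t ⟩
        lookup (key r b) (g t)                              ≡⟨ lookup-zipWith _ (g t) r b ⟩
        lookup r (g t) * N + toℕ (lookup b (g t))
          ≡⟨ cong₂ (λ i a → i * N + toℕ a) (sym (lookup∘tabulate _ t)) (sym (lookup∘tabulate _ t)) ⟩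
        lookup (reindex r g) t * N + toℕ (lookup (reindex b g) t) ≡⟨ sym (lookup-zipWith _ t (reindex r g) (reindex b g)) ⟩
        lookup (key (reindex r g) (reindex b g)) t          ∎)
        where
        open ≡-Reasoning
        lookup-ext : ∀ {k} {u v : Vec ℕ k} → (∀ t → lookup u t ≡ lookup v t) → u ≡ v
        lookup-ext {u = []} {[]} h = refl
        lookup-ext {u = x ∷ u} {y ∷ v} h = cong₂ _∷_ (h zero) (lookup-ext (λ t → h (suc t)))

      -- For fixed cells the offsets in the two coordinates are independent. The second ones appear
      -- permuted by σ, which does not change a sum over all tuples of offsets.
      matches-sum : ∀ σ → ∑ⁿ 4 points (matches σ) ≡
                    ∑ⁿ 4 cs (λ u → ∏ w u * (K (V.map row u) * K (reindex (V.map col u) (σ ⟨$⟩ˡ_))))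
      matches-sum σ = trans (∑ⁿ-blowup 4 points cs (fins N) (fins N) w pt ∑-points (matches σ))
        (∑ⁿ-cong 4 cs (λ u → cong (∏ w u *_) (begin
          ∑ⁿ 4 (fins N) (λ a → ∑ⁿ 4 (fins N) (λ b → matches σ (zip₃ pt u a b)))
            ≡⟨ ∑ⁿ-cong 4 (fins N) (λ a → ∑ⁿ-cong 4 (fins N) (λ b → cong₂ (λ x y → ⟦ inc x ⟧ * ⟦ inc y ⟧)
                 (map-proj₁ u a b) (trans (cong (λ y → reindex y (σ ⟨$⟩ˡ_)) (map-proj₂ u a b))
                                          (reindex-key (V.map col u) b (σ ⟨$⟩ˡ_))))) ⟩
          ∑ⁿ 4 (fins N) (λ a → ∑ⁿ 4 (fins N) (λ b → f u a * g u (reindex b (σ ⟨$⟩ˡ_))))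
            ≡⟨ ∑ⁿ-product 4 4 (fins N) (fins N) (f u) (λ b → g u (reindex b (σ ⟨$⟩ˡ_))) ⟩
          K (V.map row u) * ∑ⁿ 4 (fins N) (λ b → g u (reindex b (σ ⟨$⟩ˡ_)))
            ≡⟨ cong (K (V.map row u) *_) (∑ⁿ-permute 4 (fins N) (Pm.flip σ) (g u)) ⟩
          K (V.map row u) * K (reindex (V.map col u) (σ ⟨$⟩ˡ_)) ∎)))
        where
        open ≡-Reasoning
        f g : Vec A 4 → Vec (Fin N) 4 → ℕ
        f u a = ⟦ inc (key (V.map row u) a) ⟧
        g u b = ⟦ inc (key (reindex (V.map col u) (σ ⟨$⟩ˡ_)) b) ⟧

      N⁷ N⁸ s⁴ : ℕ
      N⁷ = N * N * N * N * (N * N * N)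
      N⁸ = N * N * N * N * (N * N * N * N)
      s⁴ = s * s * s * s

      K-bounds′ : ∀ r → (c₂₄ * K r ≤ kw r * N⁴) × (kw r * N⁴ ≤ c₂₄ * K r + d₁₂ * N³)
      K-bounds′ r = subst₂ (λ x y → (x * K r ≤ kw r * N⁴) × (kw r * N⁴ ≤ x * K r + y * N³))
                      (sym c₂₄≡) (sym d₁₂≡) (K-bounds r)

      kw≤c : ∀ r → kw r ≤ c₂₄
      kw≤c r = subst (kw r ≤_) (sym c₂₄≡) (kw≤24 r)

      π : Perm (Ranking.card (ranking points))
      π = Ranking.rank (ranking points)

      module _ (σ : Perm 4) where
        open Sandwich points σ using (count-lower; count-upper)

        G : ℕ
        G = ∑ⁿ 4 points (matches σ)

        R : Vec A 4 → ℕ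
        R u = K (V.map row u) * K (reindex (V.map col u) (σ ⟨$⟩ˡ_))

        tuple-bounds : ∀ u → (c₂₄ * c₂₄ * R u ≤ N⁸ * κ σ u) × (N⁸ * κ σ u ≤ c₂₄ * c₂₄ * R u + c₂₄ * (d₁₂ + d₁₂) * N⁷)
        tuple-bounds u = product-bounds c₂₄ d₁₂ N⁴ N³
          (K-bounds′ (V.map row u)) (K-bounds′ (reindex (V.map col u) (σ ⟨$⟩ˡ_)))
          (kw≤c (V.map row u)) (kw≤c (reindex (V.map col u) (σ ⟨$⟩ˡ_)))

        G-upper : c₂₄ * c₂₄ * G ≤ N⁸ * Φ σ w
        G-upper = begin
          c₂₄ * c₂₄ * G  ≡⟨ trans (cong (c₂₄ * c₂₄ *_) (matches-sum σ)) (sym (∑ⁿ-*ˡ (c₂₄ * c₂₄) 4 cs (λ u → ∏ w u * R u))) ⟩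
          ∑ⁿ 4 cs (λ u → c₂₄ * c₂₄ * (∏ w u * R u))
            ≤⟨ ∑ⁿ-mono 4 cs (λ u → ≤-trans (≤-reflexive (e (c₂₄ * c₂₄) (∏ w u) (R u)))
                 (≤-trans (*-monoʳ-≤ (∏ w u) (proj₁ (tuple-bounds u))) (≤-reflexive (sym (e N⁸ (∏ w u) (κ σ u)))))) ⟩
          ∑ⁿ 4 cs (λ u → N⁸ * (∏ w u * κ σ u))  ≡⟨ ∑ⁿ-*ˡ N⁸ 4 cs (λ u → ∏ w u * κ σ u) ⟩
          N⁸ * Φ σ w ∎
          where
          open ≤-Reasoning
          e : ∀ a b c₂₄ → a * (b * c₂₄) ≡ b * (a * c₂₄)
          e = solve-∀

        -- The unit in which errors are measured: smaller than the main scale s⁴ N⁸ by a factor N.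
        T : ℕ
        T = s⁴ * N⁷

        G-lower : N⁸ * Φ σ w ≤ c₂₄ * c₂₄ * G + c₂₄ * (d₁₂ + d₁₂) * T
        G-lower = begin
          N⁸ * Φ σ w  ≡⟨ sym (∑ⁿ-*ˡ N⁸ 4 cs (λ u → ∏ w u * κ σ u)) ⟩
          ∑ⁿ 4 cs (λ u → N⁸ * (∏ w u * κ σ u))
            ≤⟨ ∑ⁿ-mono 4 cs (λ u → ≤-trans (≤-reflexive (e N⁸ (∏ w u) (κ σ u)))
                 (≤-trans (*-monoʳ-≤ (∏ w u) (proj₂ (tuple-bounds u)))
                          (≤-reflexive (e′ (∏ w u) (c₂₄ * c₂₄) (R u) (c₂₄ * (d₁₂ + d₁₂)) N⁷)))) ⟩
          ∑ⁿ 4 cs (λ u → c₂₄ * c₂₄ * (∏ w u * R u) + c₂₄ * (d₁₂ + d₁₂) * N⁷ * ∏ w u)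
            ≡⟨ ∑ⁿ-+ 4 cs (λ u → c₂₄ * c₂₄ * (∏ w u * R u)) (λ u → c₂₄ * (d₁₂ + d₁₂) * N⁷ * ∏ w u) ⟩
          ∑ⁿ 4 cs (λ u → c₂₄ * c₂₄ * (∏ w u * R u)) + ∑ⁿ 4 cs (λ u → c₂₄ * (d₁₂ + d₁₂) * N⁷ * ∏ w u)
            ≡⟨ cong₂ _+_ (trans (∑ⁿ-*ˡ (c₂₄ * c₂₄) 4 cs (λ u → ∏ w u * R u)) (cong (c₂₄ * c₂₄ *_) (sym (matches-sum σ))))
                 (trans (∑ⁿ-*ˡ (c₂₄ * (d₁₂ + d₁₂) * N⁷) 4 cs (∏ w)) (trans (cong (c₂₄ * (d₁₂ + d₁₂) * N⁷ *_) (∑ⁿ-∏ 4 cs w))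
                   (e″ (c₂₄ * (d₁₂ + d₁₂)) N⁷ s))) ⟩
          c₂₄ * c₂₄ * G + c₂₄ * (d₁₂ + d₁₂) * T ∎
          where
          open ≤-Reasoning
          e : ∀ a b c₂₄ → a * (b * c₂₄) ≡ b * (a * c₂₄)
          e = solve-∀
          e′ : ∀ p a g b n → p * (a * g + b * n) ≡ a * (p * g) + b * n * p
          e′ = solve-∀
          e″ : ∀ b n s → b * n * (s * (s * (s * (s * 1)))) ≡ b * (s * s * s * s * n)
          e″ = solve-∀

        count-above : N⁸ * Φ σ w ≤ c₂₄ * c₂₄ * count σ π + c₂₄ * (d₁₂ + d₁₂) * T
        count-above = ≤-trans G-lower (+-monoˡ-≤ (c₂₄ * (d₁₂ + d₁₂) * T) (*-monoʳ-≤ (c₂₄ * c₂₄) count-lower))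

        count-below : c₂₄ * c₂₄ * count σ π ≤ N⁸ * Φ σ w + c₂₄ * c₂₄ * 12 * T
        count-below = begin
          c₂₄ * c₂₄ * count σ π                                 ≤⟨ *-monoʳ-≤ (c₂₄ * c₂₄) count-upper ⟩
          c₂₄ * c₂₄ * (G + (cx + cy))                           ≤⟨ *-monoʳ-≤ (c₂₄ * c₂₄) (+-monoʳ-≤ G (+-mono-≤
                                                                 (∑ⁿ-coin points proj₁ (N * s) tiesˣ 2)
                                                                 (∑ⁿ-coin points proj₂ (N * s) tiesʸ 2))) ⟩
          -- Each 6 is the number of pairs among four points, one for either coordinate.
          c₂₄ * c₂₄ * (G + (6 * (length points ^ 3 * (N * s)) + 6 * (length points ^ 3 * (N * s))))
            ≡⟨ cong (λ m → c₂₄ * c₂₄ * (G + (6 * (m ^ 3 * (N * s)) + 6 * (m ^ 3 * (N * s))))) length-points ⟩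
          c₂₄ * c₂₄ * (G + (6 * ((N * N * s) ^ 3 * (N * s)) + 6 * ((N * N * s) ^ 3 * (N * s))))
            ≡⟨ e (c₂₄ * c₂₄) G N s ⟩
          c₂₄ * c₂₄ * G + c₂₄ * c₂₄ * 12 * T                        ≤⟨ +-monoˡ-≤ (c₂₄ * c₂₄ * 12 * T) G-upper ⟩
          N⁸ * Φ σ w + c₂₄ * c₂₄ * 12 * T                       ∎
          where
          open ≤-Reasoning
          cx = ∑ⁿ 4 points (λ v → coin (V.map proj₁ v))
          cy = ∑ⁿ 4 points (λ v → coin (V.map proj₂ v))
          e : ∀ c₂₄ g n s → c₂₄ * (g + (6 * ((n * n * s) * ((n * n * s) * ((n * n * s) * 1)) * (n * s))
                                   + 6 * ((n * n * s) * ((n * n * s) * ((n * n * s) * 1)) * (n * s))))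
                        ≡ c₂₄ * g + c₂₄ * 12 * (s * s * s * s * (n * n * n * n * (n * n * n)))
          e = solve-∀

      card-points : Ranking.card (ranking points) ≡ N * N * s
      card-points = trans (Ranking.card≡ (ranking points)) length-points

-- Quadrilinear forms over the integers and a Taylor estimate

module QuadrilinearForms where

  open Sums
  open import Data.Integer as ℤ using (ℤ; +_; ∣_∣; 0ℤ; 1ℤ)
  import Data.Integer.Properties as ℤP
  open import Data.Integer.Tactic.RingSolver using (solve-∀)
  import Data.Nat.Tactic.RingSolver as ℕS
  open import Data.List using (List; []; _∷_)
  open import Data.Nat as ℕ using (ℕ; _≤_; z≤n)
  open import Data.Nat.Properties as ℕP using (≤-trans; ≤-reflexive)
  open import Relation.Binary.PropositionalEquality

  private variable
    A B : Set

  infixl 7 _·_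
  _·_ : ℤ → (A → ℤ) → A → ℤ
  (p · a) x = p ℤ.* a x

  infixl 6 _⊕_ _⊖_
  _⊕_ _⊖_ : (A → ℤ) → (A → ℤ) → A → ℤ
  (a ⊕ b) x = a x ℤ.+ b x
  (a ⊖ b) x = a x ℤ.- b x

  ∑ᶻ : List A → (A → ℤ) → ℤ
  ∑ᶻ [] f = 0ℤ
  ∑ᶻ (x ∷ xs) f = f x ℤ.+ ∑ᶻ xs f

  ∑ᶻ-cong : (xs : List A) {f g : A → ℤ} → (∀ x → f x ≡ g x) → ∑ᶻ xs f ≡ ∑ᶻ xs g
  ∑ᶻ-cong [] h = refl
  ∑ᶻ-cong (x ∷ xs) h = cong₂ ℤ._+_ (h x) (∑ᶻ-cong xs h)

  ∑ᶻ-lin : (xs : List A) (p : ℤ) (f g : A → ℤ) →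
           ∑ᶻ xs (λ x → p ℤ.* f x ℤ.+ g x) ≡ p ℤ.* ∑ᶻ xs f ℤ.+ ∑ᶻ xs g
  ∑ᶻ-lin [] p f g = e p
    where
    e : ∀ p → 0ℤ ≡ p ℤ.* 0ℤ ℤ.+ 0ℤ
    e = solve-∀
  ∑ᶻ-lin (x ∷ xs) p f g = trans (cong (λ t → p ℤ.* f x ℤ.+ g x ℤ.+ t) (∑ᶻ-lin xs p f g))
                                (e p (f x) (g x) (∑ᶻ xs f) (∑ᶻ xs g))
    where
    e : ∀ p a b c d → p ℤ.* a ℤ.+ b ℤ.+ (p ℤ.* c ℤ.+ d) ≡ p ℤ.* (a ℤ.+ c) ℤ.+ (b ℤ.+ d)
    e = solve-∀

  ∑ᶻ-*ˡ : (xs : List A) (p : ℤ) (f : A → ℤ) → ∑ᶻ xs (λ x → p ℤ.* f x) ≡ p ℤ.* ∑ᶻ xs f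
  ∑ᶻ-*ˡ [] p f = sym (ℤP.*-zeroʳ p)
  ∑ᶻ-*ˡ (x ∷ xs) p f = trans (cong (λ t → p ℤ.* f x ℤ.+ t) (∑ᶻ-*ˡ xs p f)) (sym (ℤP.*-distribˡ-+ p (f x) (∑ᶻ xs f)))

  ∣∑ᶻ∣ : (xs : List A) (f : A → ℤ) → ∣ ∑ᶻ xs f ∣ ≤ ∑ xs (λ x → ∣ f x ∣)
  ∣∑ᶻ∣ [] f = z≤n
  ∣∑ᶻ∣ (x ∷ xs) f = ≤-trans (ℤP.∣i+j∣≤∣i∣+∣j∣ (f x) (∑ᶻ xs f)) (ℕP.+-monoʳ-≤ ∣ f x ∣ (∣∑ᶻ∣ xs f))

  ∑ᶻ-pos : (xs : List A) (f : A → ℕ) → ∑ᶻ xs (λ x → + f x) ≡ + ∑ xs f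
  ∑ᶻ-pos [] f = refl
  ∑ᶻ-pos (x ∷ xs) f = cong (λ t → + f x ℤ.+ t) (∑ᶻ-pos xs f)

  module Forms {A : Set} (cs : List A) where

    ∑⁴ : (A → A → A → A → ℤ) → ℤ
    ∑⁴ f = ∑ᶻ cs λ x → ∑ᶻ cs λ y → ∑ᶻ cs λ u → ∑ᶻ cs λ v → f x y u v

    ∑⁴-cong : ∀ {f g} → (∀ x y u v → f x y u v ≡ g x y u v) → ∑⁴ f ≡ ∑⁴ g
    ∑⁴-cong h = ∑ᶻ-cong cs λ x → ∑ᶻ-cong cs λ y → ∑ᶻ-cong cs λ u → ∑ᶻ-cong cs λ v → h x y u v

    ∑⁴-lin : ∀ p f g → ∑⁴ (λ x y u v → p ℤ.* f x y u v ℤ.+ g x y u v) ≡ p ℤ.* ∑⁴ f ℤ.+ ∑⁴ g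
    ∑⁴-lin p f g = trans (∑ᶻ-cong cs λ x → trans (∑ᶻ-cong cs λ y → trans (∑ᶻ-cong cs λ u →
      ∑ᶻ-lin cs p (f x y u) (g x y u)) (∑ᶻ-lin cs p _ _)) (∑ᶻ-lin cs p _ _)) (∑ᶻ-lin cs p _ _)

    ∑⁴-*ˡ : ∀ p f → ∑⁴ (λ x y u v → p ℤ.* f x y u v) ≡ p ℤ.* ∑⁴ f
    ∑⁴-*ˡ p f = trans (∑ᶻ-cong cs λ x → trans (∑ᶻ-cong cs λ y → trans (∑ᶻ-cong cs λ u →
      ∑ᶻ-*ˡ cs p (f x y u)) (∑ᶻ-*ˡ cs p _)) (∑ᶻ-*ˡ cs p _)) (∑ᶻ-*ˡ cs p _)

    ‖_‖ : (A → ℤ) → ℕ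
    ‖ a ‖ = ∑ cs (λ x → ∣ a x ∣)

    ‖‖-cong : ∀ {a b} → (∀ x → a x ≡ b x) → ‖ a ‖ ≡ ‖ b ‖
    ‖‖-cong h = ∑-cong cs (λ x → cong ∣_∣ (h x))

    ‖⊕‖ : ∀ a b → ‖ a ⊕ b ‖ ≤ ‖ a ‖ ℕ.+ ‖ b ‖
    ‖⊕‖ a b = ≤-trans (∑-mono cs (λ x → ℤP.∣i+j∣≤∣i∣+∣j∣ (a x) (b x))) (≤-reflexive (∑-+ cs _ _))

    ‖·‖ : ∀ p a → ‖ p · a ‖ ≡ ∣ p ∣ ℕ.* ‖ a ‖
    ‖·‖ p a = trans (∑-cong cs (λ x → ℤP.∣i*j∣≡∣i∣*∣j∣ p (a x))) (∑-*ˡ ∣ p ∣ cs _)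

    module Form (k : A → A → A → A → ℤ) (K : ℕ) (k≤K : ∀ x y u v → ∣ k x y u v ∣ ≤ K) where

      abstract
        -- The coefficients are not assumed symmetric, since the slots are the positions of a
        -- pattern. The form is sealed: later arguments use multilinearity and the norm bound, and
        -- `M-def` opens it where its sums have to be evaluated.
        M : (a b c d : A → ℤ) → ℤ
        M a b c d = ∑⁴ λ x y u v → k x y u v ℤ.* (a x ℤ.* (b y ℤ.* (c u ℤ.* d v)))

        M-def : ∀ a b c d → M a b c d ≡ ∑⁴ (λ x y u v → k x y u v ℤ.* (a x ℤ.* (b y ℤ.* (c u ℤ.* d v))))
        M-def a b c d = refl

        M-lin₁ : ∀ p a a′ b c d → M (p · a ⊕ a′) b c d ≡ p ℤ.* M a b c d ℤ.+ M a′ b c d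
        M-lin₁ p a a′ b c d = trans (∑⁴-cong λ x y u v → e p (k x y u v) (a x) (a′ x) (b y) (c u) (d v))
          (∑⁴-lin p (λ x y u v → k x y u v ℤ.* (a x ℤ.* (b y ℤ.* (c u ℤ.* d v)))) (λ x y u v → k x y u v ℤ.* (a′ x ℤ.* (b y ℤ.* (c u ℤ.* d v)))))
          where
          e : ∀ p k a a′ b c d → k ℤ.* ((p ℤ.* a ℤ.+ a′) ℤ.* (b ℤ.* (c ℤ.* d))) ≡
              p ℤ.* (k ℤ.* (a ℤ.* (b ℤ.* (c ℤ.* d)))) ℤ.+ k ℤ.* (a′ ℤ.* (b ℤ.* (c ℤ.* d)))
          e = solve-∀

        M-lin₂ : ∀ p a b b′ c d → M a (p · b ⊕ b′) c d ≡ p ℤ.* M a b c d ℤ.+ M a b′ c d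
        M-lin₂ p a b b′ c d = trans (∑⁴-cong λ x y u v → e p (k x y u v) (a x) (b y) (b′ y) (c u) (d v))
          (∑⁴-lin p (λ x y u v → k x y u v ℤ.* (a x ℤ.* (b y ℤ.* (c u ℤ.* d v)))) (λ x y u v → k x y u v ℤ.* (a x ℤ.* (b′ y ℤ.* (c u ℤ.* d v)))))
          where
          e : ∀ p k a b b′ c d → k ℤ.* (a ℤ.* ((p ℤ.* b ℤ.+ b′) ℤ.* (c ℤ.* d))) ≡
              p ℤ.* (k ℤ.* (a ℤ.* (b ℤ.* (c ℤ.* d)))) ℤ.+ k ℤ.* (a ℤ.* (b′ ℤ.* (c ℤ.* d)))
          e = solve-∀

        M-lin₃ : ∀ p a b c c′ d → M a b (p · c ⊕ c′) d ≡ p ℤ.* M a b c d ℤ.+ M a b c′ d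
        M-lin₃ p a b c c′ d = trans (∑⁴-cong λ x y u v → e p (k x y u v) (a x) (b y) (c u) (c′ u) (d v))
          (∑⁴-lin p (λ x y u v → k x y u v ℤ.* (a x ℤ.* (b y ℤ.* (c u ℤ.* d v)))) (λ x y u v → k x y u v ℤ.* (a x ℤ.* (b y ℤ.* (c′ u ℤ.* d v)))))
          where
          e : ∀ p k a b c c′ d → k ℤ.* (a ℤ.* (b ℤ.* ((p ℤ.* c ℤ.+ c′) ℤ.* d))) ≡
              p ℤ.* (k ℤ.* (a ℤ.* (b ℤ.* (c ℤ.* d)))) ℤ.+ k ℤ.* (a ℤ.* (b ℤ.* (c′ ℤ.* d)))
          e = solve-∀

        M-lin₄ : ∀ p a b c d d′ → M a b c (p · d ⊕ d′) ≡ p ℤ.* M a b c d ℤ.+ M a b c d′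
        M-lin₄ p a b c d d′ = trans (∑⁴-cong λ x y u v → e p (k x y u v) (a x) (b y) (c u) (d v) (d′ v))
          (∑⁴-lin p (λ x y u v → k x y u v ℤ.* (a x ℤ.* (b y ℤ.* (c u ℤ.* d v)))) (λ x y u v → k x y u v ℤ.* (a x ℤ.* (b y ℤ.* (c u ℤ.* d′ v)))))
          where
          e : ∀ p k a b c d d′ → k ℤ.* (a ℤ.* (b ℤ.* (c ℤ.* (p ℤ.* d ℤ.+ d′)))) ≡
              p ℤ.* (k ℤ.* (a ℤ.* (b ℤ.* (c ℤ.* d)))) ℤ.+ k ℤ.* (a ℤ.* (b ℤ.* (c ℤ.* d′)))
          e = solve-∀

        M-scale : ∀ p q r s a b c d → M (p · a) (q · b) (r · c) (s · d) ≡ p ℤ.* q ℤ.* r ℤ.* s ℤ.* M a b c d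
        M-scale p q r s a b c d = trans (∑⁴-cong λ x y u v → e p q r s (k x y u v) (a x) (b y) (c u) (d v)) (∑⁴-*ˡ (p ℤ.* q ℤ.* r ℤ.* s) (λ x y u v → k x y u v ℤ.* (a x ℤ.* (b y ℤ.* (c u ℤ.* d v)))))
          where
          e : ∀ p q r s k a b c d → k ℤ.* (p ℤ.* a ℤ.* (q ℤ.* b ℤ.* (r ℤ.* c ℤ.* (s ℤ.* d)))) ≡
              p ℤ.* q ℤ.* r ℤ.* s ℤ.* (k ℤ.* (a ℤ.* (b ℤ.* (c ℤ.* d))))
          e = solve-∀

        M-cong : ∀ {a a′ b b′ c c′ d d′} → (∀ x → a x ≡ a′ x) → (∀ x → b x ≡ b′ x) →
                 (∀ x → c x ≡ c′ x) → (∀ x → d x ≡ d′ x) → M a b c d ≡ M a′ b′ c′ d′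
        M-cong f g h i = ∑⁴-cong λ x y u v → cong₂ (λ p q → k x y u v ℤ.* (p ℤ.* q)) (f x)
          (cong₂ ℤ._*_ (g y) (cong₂ ℤ._*_ (h u) (i v)))

        M-bound : ∀ a b c d → ∣ M a b c d ∣ ≤ K ℕ.* (‖ a ‖ ℕ.* (‖ b ‖ ℕ.* (‖ c ‖ ℕ.* ‖ d ‖)))
        M-bound a b c d = begin
          ∣ M a b c d ∣
            ≤⟨ ≤-trans (∣∑ᶻ∣ cs _) (∑-mono cs λ x → ≤-trans (∣∑ᶻ∣ cs _) (∑-mono cs λ y →
                 ≤-trans (∣∑ᶻ∣ cs _) (∑-mono cs λ u → ≤-trans (∣∑ᶻ∣ cs _) (∑-mono cs λ v → bd x y u v)))) ⟩
          (∑ cs λ x → ∑ cs λ y → ∑ cs λ u → ∑ cs λ v → K ℕ.* (∣ a x ∣ ℕ.* (∣ b y ∣ ℕ.* (∣ c u ∣ ℕ.* ∣ d v ∣))))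
            ≡⟨ (∑-cong cs λ x → ∑-cong cs λ y → ∑-cong cs λ u → trans (∑-*ˡ K cs _) (cong (K ℕ.*_)
                 (trans (∑-*ˡ ∣ a x ∣ cs _) (cong (∣ a x ∣ ℕ.*_) (trans (∑-*ˡ ∣ b y ∣ cs _) (cong (∣ b y ∣ ℕ.*_) (∑-*ˡ ∣ c u ∣ cs _))))))) ⟩
          (∑ cs λ x → ∑ cs λ y → ∑ cs λ u → K ℕ.* (∣ a x ∣ ℕ.* (∣ b y ∣ ℕ.* (∣ c u ∣ ℕ.* ‖ d ‖))))
            ≡⟨ (∑-cong cs λ x → ∑-cong cs λ y → trans (∑-*ˡ K cs _) (cong (K ℕ.*_)
                 (trans (∑-*ˡ ∣ a x ∣ cs _) (cong (∣ a x ∣ ℕ.*_) (trans (∑-*ˡ ∣ b y ∣ cs _) (cong (∣ b y ∣ ℕ.*_) (∑-*ʳ (λ u → ∣ c u ∣) ‖ d ‖))))))) ⟩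
          (∑ cs λ x → ∑ cs λ y → K ℕ.* (∣ a x ∣ ℕ.* (∣ b y ∣ ℕ.* (‖ c ‖ ℕ.* ‖ d ‖))))
            ≡⟨ (∑-cong cs λ x → trans (∑-*ˡ K cs _) (cong (K ℕ.*_)
                 (trans (∑-*ˡ ∣ a x ∣ cs _) (cong (∣ a x ∣ ℕ.*_) (∑-*ʳ (λ y → ∣ b y ∣) (‖ c ‖ ℕ.* ‖ d ‖)))))) ⟩
          (∑ cs λ x → K ℕ.* (∣ a x ∣ ℕ.* (‖ b ‖ ℕ.* (‖ c ‖ ℕ.* ‖ d ‖))))
            ≡⟨ trans (∑-*ˡ K cs _) (cong (K ℕ.*_) (∑-*ʳ (λ x → ∣ a x ∣) _)) ⟩
          K ℕ.* (‖ a ‖ ℕ.* (‖ b ‖ ℕ.* (‖ c ‖ ℕ.* ‖ d ‖))) ∎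
          where
          open ℕP.≤-Reasoning
          ∑-*ʳ : ∀ (f : A → ℕ) m → ∑ cs (λ x → f x ℕ.* m) ≡ ∑ cs f ℕ.* m
          ∑-*ʳ f m = trans (∑-cong cs λ x → ℕP.*-comm (f x) m) (trans (∑-*ˡ m cs f) (ℕP.*-comm m _))
          abs : ∀ i j → ∣ i ℤ.* j ∣ ≡ ∣ i ∣ ℕ.* ∣ j ∣
          abs = ℤP.∣i*j∣≡∣i∣*∣j∣
          bd : ∀ x y u v → ∣ k x y u v ℤ.* (a x ℤ.* (b y ℤ.* (c u ℤ.* d v))) ∣ ≤
                           K ℕ.* (∣ a x ∣ ℕ.* (∣ b y ∣ ℕ.* (∣ c u ∣ ℕ.* ∣ d v ∣)))
          bd x y u v = ≤-trans (≤-reflexive (trans (abs (k x y u v) _) (cong (∣ k x y u v ∣ ℕ.*_)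
            (trans (abs (a x) _) (cong (∣ a x ∣ ℕ.*_) (trans (abs (b y) _) (cong (∣ b y ∣ ℕ.*_) (abs (c u) (d v)))))))))
            (ℕP.*-monoˡ-≤ _ (k≤K x y u v))

      F : (A → ℤ) → ℤ
      F a = M a a a a

      -- The derivative of `F` at o in direction δ, with one term for each slot.
      D : (A → ℤ) → (A → ℤ) → ℤ
      D o δ = M δ o o o ℤ.+ M o δ o o ℤ.+ M o o δ o ℤ.+ M o o o δ

      D-lin : ∀ o p δ ε → D o (p · δ ⊕ ε) ≡ p ℤ.* D o δ ℤ.+ D o ε
      D-lin o p δ ε = trans (cong₂ ℤ._+_ (cong₂ ℤ._+_ (cong₂ ℤ._+_ (M-lin₁ p δ ε o o o) (M-lin₂ p o δ ε o o))
        (M-lin₃ p o o δ ε o)) (M-lin₄ p o o o δ ε)) (e p _ _ _ _ _ _ _ _)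
        where
        e : ∀ p a a′ b b′ c c′ d d′ →
            p ℤ.* a ℤ.+ a′ ℤ.+ (p ℤ.* b ℤ.+ b′) ℤ.+ (p ℤ.* c ℤ.+ c′) ℤ.+ (p ℤ.* d ℤ.+ d′) ≡
            p ℤ.* (a ℤ.+ b ℤ.+ c ℤ.+ d) ℤ.+ (a′ ℤ.+ b′ ℤ.+ c′ ℤ.+ d′)
        e = solve-∀

      D-cong : ∀ {o o′ δ δ′} → (∀ x → o x ≡ o′ x) → (∀ x → δ x ≡ δ′ x) → D o δ ≡ D o′ δ′
      D-cong f g = cong₂ ℤ._+_ (cong₂ ℤ._+_ (cong₂ ℤ._+_ (M-cong g f f f) (M-cong f g f f)) (M-cong f f g f)) (M-cong f f f g)

      -- Follows from linearity alone: the zero vector is -1 times itself plus itself.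
      D-0 : ∀ o → D o (λ _ → 0ℤ) ≡ 0ℤ
      D-0 o = trans (D-cong {o} {o} {λ _ → 0ℤ} {(ℤ.- 1ℤ) · (λ _ → 0ℤ) ⊕ (λ _ → 0ℤ)} (λ _ → refl) (λ _ → refl))
                    (trans (D-lin o (ℤ.- 1ℤ) (λ _ → 0ℤ) (λ _ → 0ℤ)) (e (D o (λ _ → 0ℤ))))
        where
        e : ∀ x → ℤ.- 1ℤ ℤ.* x ℤ.+ x ≡ 0ℤ
        e = solve-∀

      D-∑ : ∀ {B : Set} o (ks : List B) (s : B → ℤ) (d : B → A → ℤ) →
            D o (λ x → ∑ᶻ ks (λ j → s j ℤ.* d j x)) ≡ ∑ᶻ ks (λ j → s j ℤ.* D o (d j))
      D-∑ o [] s d = D-0 o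
      D-∑ o (j ∷ ks) s d = trans (D-lin o (s j) (d j) (λ x → ∑ᶻ ks (λ j → s j ℤ.* d j x)))
                                 (cong (λ t → s j ℤ.* D o (d j) ℤ.+ t) (D-∑ o ks s d))

      F-scale : ∀ p a → F (p · a) ≡ p ℤ.* p ℤ.* p ℤ.* p ℤ.* F a
      F-scale p a = M-scale p p p p a a a a

      D-scale : ∀ p o δ → D (p · o) δ ≡ p ℤ.* p ℤ.* p ℤ.* D o δ
      D-scale p o δ = trans (D-cong {p · o} {p · o} {δ} {1ℤ · δ} (λ _ → refl) (λ x → sym (ℤP.*-identityˡ (δ x))))
        (trans (cong₂ ℤ._+_ (cong₂ ℤ._+_ (cong₂ ℤ._+_ (M-scale 1ℤ p p p δ o o o) (M-scale p 1ℤ p p o δ o o))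
                 (M-scale p p 1ℤ p o o δ o)) (M-scale p p p 1ℤ o o o δ)) (e p _ _ _ _))
        where
        e : ∀ p a b c d → 1ℤ ℤ.* p ℤ.* p ℤ.* p ℤ.* a ℤ.+ p ℤ.* 1ℤ ℤ.* p ℤ.* p ℤ.* b ℤ.+
            p ℤ.* p ℤ.* 1ℤ ℤ.* p ℤ.* c ℤ.+ p ℤ.* p ℤ.* p ℤ.* 1ℤ ℤ.* d ≡ p ℤ.* p ℤ.* p ℤ.* (a ℤ.+ b ℤ.+ c ℤ.+ d)
        e = solve-∀

      -- Taylor's theorem with explicit constant: F x - F y is within
      -- 12 K η S² ‖x - y‖ of its linearisation at o.
      module Taylor (x y o : A → ℤ) (S η : ℕ)
        (hx : ‖ x ‖ ≤ S) (hy : ‖ y ‖ ≤ S) (ho : ‖ o ‖ ≤ S) (ηx : ‖ x ⊖ o ‖ ≤ η) (ηy : ‖ y ⊖ o ‖ ≤ η) where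

        δ : A → ℤ
        δ = x ⊖ y

        private
          neg : ∀ (a b : A → ℤ) c → ((ℤ.- 1ℤ) · b ⊕ a) c ≡ (a ⊖ b) c
          neg a b c = e (a c) (b c)
            where
            e : ∀ s t → ℤ.- 1ℤ ℤ.* t ℤ.+ s ≡ s ℤ.- t
            e = solve-∀
          move : ∀ t u {s} → s ≡ ℤ.- 1ℤ ℤ.* t ℤ.+ u → u ℤ.- t ≡ s
          move t u refl = e t u
            where
            e : ∀ t u → u ℤ.- t ≡ ℤ.- 1ℤ ℤ.* t ℤ.+ u
            e = solve-∀

        sub₁ : ∀ a a′ b c d → M a b c d ℤ.- M a′ b c d ≡ M (a ⊖ a′) b c d
        sub₁ a a′ b c d = move (M a′ b c d) (M a b c d) (trans (M-cong (λ z → sym (neg a a′ z)) (λ _ → refl) (λ _ → refl) (λ _ → refl)) (M-lin₁ (ℤ.- 1ℤ) a′ a b c d))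
        sub₂ : ∀ a b b′ c d → M a b c d ℤ.- M a b′ c d ≡ M a (b ⊖ b′) c d
        sub₂ a b b′ c d = move (M a b′ c d) (M a b c d) (trans (M-cong (λ _ → refl) (λ z → sym (neg b b′ z)) (λ _ → refl) (λ _ → refl)) (M-lin₂ (ℤ.- 1ℤ) a b′ b c d))
        sub₃ : ∀ a b c c′ d → M a b c d ℤ.- M a b c′ d ≡ M a b (c ⊖ c′) d
        sub₃ a b c c′ d = move (M a b c′ d) (M a b c d) (trans (M-cong (λ _ → refl) (λ _ → refl) (λ z → sym (neg c c′ z)) (λ _ → refl)) (M-lin₃ (ℤ.- 1ℤ) a b c′ c d))
        sub₄ : ∀ a b c d d′ → M a b c d ℤ.- M a b c d′ ≡ M a b c (d ⊖ d′)
        sub₄ a b c d d′ = move (M a b c d′) (M a b c d) (trans (M-cong (λ _ → refl) (λ _ → refl) (λ _ → refl) (λ z → sym (neg d d′ z))) (M-lin₄ (ℤ.- 1ℤ) a b c d′ d))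

        -- The cost of replacing one argument by o when another is δ: the replaced argument
        -- contributes η, and the two that remain contribute S each.
        C : ℕ
        C = K ℕ.* (‖ δ ‖ ℕ.* (η ℕ.* (S ℕ.* S)))

        bound : ∀ {i} a b c d e f g → i ≡ M a b c d →
                K ℕ.* (‖ a ‖ ℕ.* (‖ b ‖ ℕ.* (‖ c ‖ ℕ.* ‖ d ‖))) ≡ K ℕ.* (‖ δ ‖ ℕ.* (e ℕ.* (f ℕ.* g))) →
                e ≤ η → f ≤ S → g ≤ S → ∣ i ∣ ≤ C
        bound a b c d e f g refl eq p q r = ≤-trans (M-bound a b c d) (≤-trans (≤-reflexive eq)
          (ℕP.*-monoʳ-≤ K (ℕP.*-monoʳ-≤ (‖ δ ‖) (ℕP.*-mono-≤ p (ℕP.*-mono-≤ q r)))))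

        three : ∀ s t u v → ∣ s ℤ.- t ∣ ≤ C → ∣ t ℤ.- u ∣ ≤ C → ∣ u ℤ.- v ∣ ≤ C → ∣ s ℤ.- v ∣ ≤ C ℕ.+ C ℕ.+ C
        three s t u v p q r = subst (λ i → ∣ i ∣ ≤ C ℕ.+ C ℕ.+ C) (tele s t u v)
          (≤-trans (ℤP.∣i+j∣≤∣i∣+∣j∣ (s ℤ.- t ℤ.+ (t ℤ.- u)) (u ℤ.- v))
            (ℕP.+-mono-≤ (≤-trans (ℤP.∣i+j∣≤∣i∣+∣j∣ (s ℤ.- t) (t ℤ.- u)) (ℕP.+-mono-≤ p q)) r))
          where
          tele : ∀ s t u v → (s ℤ.- t) ℤ.+ (t ℤ.- u) ℤ.+ (u ℤ.- v) ≡ s ℤ.- v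
          tele = solve-∀

        r₁₃ : ∀ k a b c d → k ℕ.* (a ℕ.* (b ℕ.* (c ℕ.* d))) ≡ k ℕ.* (a ℕ.* (c ℕ.* (b ℕ.* d)))
        r₁₃ = ℕS.solve-∀
        r₁₄ : ∀ k a b c d → k ℕ.* (a ℕ.* (b ℕ.* (c ℕ.* d))) ≡ k ℕ.* (a ℕ.* (d ℕ.* (b ℕ.* c)))
        r₁₄ = ℕS.solve-∀
        r₂₁ : ∀ k a b c d → k ℕ.* (a ℕ.* (b ℕ.* (c ℕ.* d))) ≡ k ℕ.* (b ℕ.* (a ℕ.* (c ℕ.* d)))
        r₂₁ = ℕS.solve-∀
        r₂₃ : ∀ k a b c d → k ℕ.* (a ℕ.* (b ℕ.* (c ℕ.* d))) ≡ k ℕ.* (b ℕ.* (c ℕ.* (a ℕ.* d)))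
        r₂₃ = ℕS.solve-∀
        r₂₄ : ∀ k a b c d → k ℕ.* (a ℕ.* (b ℕ.* (c ℕ.* d))) ≡ k ℕ.* (b ℕ.* (d ℕ.* (a ℕ.* c)))
        r₂₄ = ℕS.solve-∀
        r₃₁ : ∀ k a b c d → k ℕ.* (a ℕ.* (b ℕ.* (c ℕ.* d))) ≡ k ℕ.* (c ℕ.* (a ℕ.* (b ℕ.* d)))
        r₃₁ = ℕS.solve-∀
        r₃₂ : ∀ k a b c d → k ℕ.* (a ℕ.* (b ℕ.* (c ℕ.* d))) ≡ k ℕ.* (c ℕ.* (b ℕ.* (a ℕ.* d)))
        r₃₂ = ℕS.solve-∀
        r₃₄ : ∀ k a b c d → k ℕ.* (a ℕ.* (b ℕ.* (c ℕ.* d))) ≡ k ℕ.* (c ℕ.* (d ℕ.* (a ℕ.* b)))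
        r₃₄ = ℕS.solve-∀
        r₄₁ : ∀ k a b c d → k ℕ.* (a ℕ.* (b ℕ.* (c ℕ.* d))) ≡ k ℕ.* (d ℕ.* (a ℕ.* (b ℕ.* c)))
        r₄₁ = ℕS.solve-∀
        r₄₂ : ∀ k a b c d → k ℕ.* (a ℕ.* (b ℕ.* (c ℕ.* d))) ≡ k ℕ.* (d ℕ.* (b ℕ.* (a ℕ.* c)))
        r₄₂ = ℕS.solve-∀
        r₄₃ : ∀ k a b c d → k ℕ.* (a ℕ.* (b ℕ.* (c ℕ.* d))) ≡ k ℕ.* (d ℕ.* (c ℕ.* (a ℕ.* b)))
        r₄₃ = ℕS.solve-∀

        -- in each of the four positions of δ, replace the remaining arguments by o one at a time
        part₁ : ∣ M δ x x x ℤ.- M δ o o o ∣ ≤ C ℕ.+ C ℕ.+ C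
        part₁ = three (M δ x x x) (M δ o x x) (M δ o o x) (M δ o o o)
          (bound δ (x ⊖ o) x x (‖ x ⊖ o ‖) (‖ x ‖) (‖ x ‖) (sub₂ δ x o x x) refl ηx hx hx)
          (bound δ o (x ⊖ o) x (‖ x ⊖ o ‖) (‖ o ‖) (‖ x ‖) (sub₃ δ o x o x) (r₁₃ K (‖ δ ‖) (‖ o ‖) (‖ x ⊖ o ‖) (‖ x ‖)) ηx ho hx)
          (bound δ o o (x ⊖ o) (‖ x ⊖ o ‖) (‖ o ‖) (‖ o ‖) (sub₄ δ o o x o) (r₁₄ K (‖ δ ‖) (‖ o ‖) (‖ o ‖) (‖ x ⊖ o ‖)) ηx ho ho)

        part₂ : ∣ M y δ x x ℤ.- M o δ o o ∣ ≤ C ℕ.+ C ℕ.+ C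
        part₂ = three (M y δ x x) (M o δ x x) (M o δ o x) (M o δ o o)
          (bound (y ⊖ o) δ x x (‖ y ⊖ o ‖) (‖ x ‖) (‖ x ‖) (sub₁ y o δ x x) (r₂₁ K (‖ y ⊖ o ‖) (‖ δ ‖) (‖ x ‖) (‖ x ‖)) ηy hx hx)
          (bound o δ (x ⊖ o) x (‖ x ⊖ o ‖) (‖ o ‖) (‖ x ‖) (sub₃ o δ x o x) (r₂₃ K (‖ o ‖) (‖ δ ‖) (‖ x ⊖ o ‖) (‖ x ‖)) ηx ho hx)
          (bound o δ o (x ⊖ o) (‖ x ⊖ o ‖) (‖ o ‖) (‖ o ‖) (sub₄ o δ o x o) (r₂₄ K (‖ o ‖) (‖ δ ‖) (‖ o ‖) (‖ x ⊖ o ‖)) ηx ho ho)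

        part₃ : ∣ M y y δ x ℤ.- M o o δ o ∣ ≤ C ℕ.+ C ℕ.+ C
        part₃ = three (M y y δ x) (M o y δ x) (M o o δ x) (M o o δ o)
          (bound (y ⊖ o) y δ x (‖ y ⊖ o ‖) (‖ y ‖) (‖ x ‖) (sub₁ y o y δ x) (r₃₁ K (‖ y ⊖ o ‖) (‖ y ‖) (‖ δ ‖) (‖ x ‖)) ηy hy hx)
          (bound o (y ⊖ o) δ x (‖ y ⊖ o ‖) (‖ o ‖) (‖ x ‖) (sub₂ o y o δ x) (r₃₂ K (‖ o ‖) (‖ y ⊖ o ‖) (‖ δ ‖) (‖ x ‖)) ηy ho hx)
          (bound o o δ (x ⊖ o) (‖ x ⊖ o ‖) (‖ o ‖) (‖ o ‖) (sub₄ o o δ x o) (r₃₄ K (‖ o ‖) (‖ o ‖) (‖ δ ‖) (‖ x ⊖ o ‖)) ηx ho ho)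

        part₄ : ∣ M y y y δ ℤ.- M o o o δ ∣ ≤ C ℕ.+ C ℕ.+ C
        part₄ = three (M y y y δ) (M o y y δ) (M o o y δ) (M o o o δ)
          (bound (y ⊖ o) y y δ (‖ y ⊖ o ‖) (‖ y ‖) (‖ y ‖) (sub₁ y o y y δ) (r₄₁ K (‖ y ⊖ o ‖) (‖ y ‖) (‖ y ‖) (‖ δ ‖)) ηy hy hy)
          (bound o (y ⊖ o) y δ (‖ y ⊖ o ‖) (‖ o ‖) (‖ y ‖) (sub₂ o y o y δ) (r₄₂ K (‖ o ‖) (‖ y ⊖ o ‖) (‖ y ‖) (‖ δ ‖)) ηy ho hy)
          (bound o o (y ⊖ o) δ (‖ y ⊖ o ‖) (‖ o ‖) (‖ o ‖) (sub₃ o o y o δ) (r₄₃ K (‖ o ‖) (‖ o ‖) (‖ y ⊖ o ‖) (‖ δ ‖)) ηy ho ho)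

        -- Telescoping, one slot at a time: the slots to the left of δ already hold y, those to its
        -- right still hold x.
        diff : F x ℤ.- F y ≡ M δ x x x ℤ.+ M y δ x x ℤ.+ M y y δ x ℤ.+ M y y y δ
        diff = trans (sym (tele₄ (M x x x x) (M y x x x) (M y y x x) (M y y y x) (M y y y y)))
          (cong₂ ℤ._+_ (cong₂ ℤ._+_ (cong₂ ℤ._+_ (sub₁ x y x x x) (sub₂ y x y x x)) (sub₃ y y x y x)) (sub₄ y y y x y))
          where
          tele₄ : ∀ s t u v w → (s ℤ.- t) ℤ.+ (t ℤ.- u) ℤ.+ (u ℤ.- v) ℤ.+ (v ℤ.- w) ≡ s ℤ.- w
          tele₄ = solve-∀

        taylor : ∣ F x ℤ.- F y ℤ.- D o δ ∣ ≤ 12 ℕ.* C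
        taylor = begin
          ∣ F x ℤ.- F y ℤ.- D o δ ∣
            ≡⟨ cong ∣_∣ (trans (cong (λ t → t ℤ.- D o δ) diff) (regroup (M δ x x x) (M y δ x x) (M y y δ x) (M y y y δ) (M δ o o o) (M o δ o o) (M o o δ o) (M o o o δ))) ⟩
          ∣ i₁ ℤ.+ i₂ ℤ.+ i₃ ℤ.+ i₄ ∣
            ≤⟨ ≤-trans (ℤP.∣i+j∣≤∣i∣+∣j∣ (i₁ ℤ.+ i₂ ℤ.+ i₃) i₄) (ℕP.+-mono-≤ (≤-trans (ℤP.∣i+j∣≤∣i∣+∣j∣ (i₁ ℤ.+ i₂) i₃)
                 (ℕP.+-mono-≤ (≤-trans (ℤP.∣i+j∣≤∣i∣+∣j∣ i₁ i₂) (ℕP.+-mono-≤ part₁ part₂)) part₃)) part₄) ⟩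
          -- Four positions of δ with three replacements each: the origin of the 12.
          (C ℕ.+ C ℕ.+ C) ℕ.+ (C ℕ.+ C ℕ.+ C) ℕ.+ (C ℕ.+ C ℕ.+ C) ℕ.+ (C ℕ.+ C ℕ.+ C)  ≡⟨ twelve C ⟩
          12 ℕ.* C ∎
          where
          open ℕP.≤-Reasoning
          i₁ = M δ x x x ℤ.- M δ o o o
          i₂ = M y δ x x ℤ.- M o δ o o
          i₃ = M y y δ x ℤ.- M o o δ o
          i₄ = M y y y δ ℤ.- M o o o δ
          twelve : ∀ c → (c ℕ.+ c ℕ.+ c) ℕ.+ (c ℕ.+ c ℕ.+ c) ℕ.+ (c ℕ.+ c ℕ.+ c) ℕ.+ (c ℕ.+ c ℕ.+ c) ≡ 12 ℕ.* c
          twelve = ℕS.solve-∀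
          regroup : ∀ a b c d a′ b′ c′ d′ → a ℤ.+ b ℤ.+ c ℤ.+ d ℤ.- (a′ ℤ.+ b′ ℤ.+ c′ ℤ.+ d′) ≡
                    (a ℤ.- a′) ℤ.+ (b ℤ.- b′) ℤ.+ (c ℤ.- c′) ℤ.+ (d ℤ.- d′)
          regroup = solve-∀

-- Newton's method without division

module Iteration where

  open Sums
  open QuadrilinearForms
  open import Data.Fin as F using (Fin; zero; suc)
  open import Data.Integer as ℤ using (ℤ; +_; ∣_∣; 0ℤ; 1ℤ)
  import Data.Integer.Properties as ℤP
  open import Data.Integer.Tactic.RingSolver using (solve-∀)
  import Data.Nat.Tactic.RingSolver as ℕS
  open import Data.List as L using (List; []; _∷_)
  open import Data.Nat as ℕ using (ℕ; zero; suc; _≤_; z≤n; _^_)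
  open import Data.Nat.Properties as ℕP using (≤-trans; ≤-refl; ≤-reflexive)
  open import Data.Product using (_,_)
  open import Relation.Binary.PropositionalEquality

  kron : ∀ {r} → Fin r → Fin r → ℤ
  kron zero zero = 1ℤ
  kron zero (suc _) = 0ℤ
  kron (suc _) zero = 0ℤ
  kron (suc i) (suc j) = kron i j

  ∑ᶻ-map : ∀ {A B : Set} (h : A → B) (xs : List A) (f : B → ℤ) → ∑ᶻ (L.map h xs) f ≡ ∑ᶻ xs (λ x → f (h x))
  ∑ᶻ-map h [] f = refl
  ∑ᶻ-map h (x ∷ xs) f = cong (λ t → f (h x) ℤ.+ t) (∑ᶻ-map h xs f)

  ∑ᶻ-0 : ∀ {A : Set} (xs : List A) → ∑ᶻ xs (λ _ → 0ℤ) ≡ 0ℤ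
  ∑ᶻ-0 [] = refl
  ∑ᶻ-0 (x ∷ xs) = trans (ℤP.+-identityˡ _) (∑ᶻ-0 xs)

  ∑ᶻ-kron : ∀ {r} (s : Fin r → ℤ) i → ∑ᶻ (fins r) (λ k → s k ℤ.* kron i k) ≡ s i
  ∑ᶻ-kron {suc r} s zero = trans (cong₂ ℤ._+_ (ℤP.*-identityʳ (s zero))
    (trans (∑ᶻ-map suc (fins r) _) (trans (∑ᶻ-cong (fins r) (λ k → ℤP.*-zeroʳ (s (suc k)))) (∑ᶻ-0 (fins r)))))
    (ℤP.+-identityʳ (s zero))
  ∑ᶻ-kron {suc r} s (suc i) = trans (cong₂ ℤ._+_ (ℤP.*-zeroʳ (s zero))
    (trans (∑ᶻ-map suc (fins r) _) (∑ᶻ-kron (λ k → s (suc k)) i))) (ℤP.+-identityˡ (s (suc i)))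

  -- The factor p plays the role of a denominator: the coefficients are bounded by β / p, stated
  -- without division.
  ∣∑*∣ : ∀ {B : Set} (ks : List B) (s t : B → ℤ) p β → (∀ k → p ℕ.* ∣ s k ∣ ≤ β) →
         p ℕ.* ∣ ∑ᶻ ks (λ k → s k ℤ.* t k) ∣ ≤ β ℕ.* ∑ ks (λ k → ∣ t k ∣)
  ∣∑*∣ ks s t p β h = begin
    p ℕ.* ∣ ∑ᶻ ks (λ k → s k ℤ.* t k) ∣     ≤⟨ ℕP.*-monoʳ-≤ p (∣∑ᶻ∣ ks _) ⟩
    p ℕ.* ∑ ks (λ k → ∣ s k ℤ.* t k ∣)      ≡⟨ sym (∑-*ˡ p ks _) ⟩
    ∑ ks (λ k → p ℕ.* ∣ s k ℤ.* t k ∣)      ≤⟨ ∑-mono ks (λ k → ≤-trans (≤-reflexive (trans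
         (cong (p ℕ.*_) (ℤP.∣i*j∣≡∣i∣*∣j∣ (s k) (t k))) (sym (ℕP.*-assoc p _ _)))) (ℕP.*-monoˡ-≤ ∣ t k ∣ (h k))) ⟩
    ∑ ks (λ k → β ℕ.* ∣ t k ∣)              ≡⟨ ∑-*ˡ β ks _ ⟩
    β ℕ.* ∑ ks (λ k → ∣ t k ∣)              ∎
    where open ℕP.≤-Reasoning

  -- Newton's method with a fixed approximate Jacobian.  To stay within ℤ, the iterate
  -- z + e + Σ (u k / q) d k is represented by its multiple W by the common denominator q.
  module Newton {A : Set} (cs : List A) {r : ℕ} (K : ℕ)
    (k : Fin r → A → A → A → A → ℤ) (k≤K : ∀ i x y u v → ∣ k i x y u v ∣ ≤ K)
    (z e : A → ℤ) (d : Fin r → A → ℤ) (L S η : ℕ)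
    where

    open Forms cs
    module Fm (i : Fin r) = Form (k i) K (k≤K i)

    -- The Taylor error at scale 1, when both the increment and the distance to the base point are
    -- at most η.
    E : ℕ
    E = 12 ℕ.* (K ℕ.* (η ℕ.* (η ℕ.* (S ℕ.* S))))

    W : ℕ → (Fin r → ℤ) → A → ℤ
    W q u c = + q ℤ.* (z c ℤ.+ e c) ℤ.+ ∑ᶻ (fins r) (λ j → u j ℤ.* d j c)

    module _ (η-ok : ‖ e ‖ ℕ.+ ∑ (fins r) (λ j → ‖ d j ‖) ≤ η) (S-ok : ‖ z ‖ ℕ.+ η ≤ S) where

      comb : (Fin r → ℤ) → A → ℤ
      comb s c = ∑ᶻ (fins r) (λ j → s j ℤ.* d j c)

      ‖comb‖ : ∀ s p β → (∀ j → p ℕ.* ∣ s j ∣ ≤ β) → p ℕ.* ‖ comb s ‖ ≤ β ℕ.* ∑ (fins r) (λ j → ‖ d j ‖)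
      ‖comb‖ s p β h = begin
        p ℕ.* ∑ cs (λ c → ∣ comb s c ∣)                     ≡⟨ sym (∑-*ˡ p cs _) ⟩
        ∑ cs (λ c → p ℕ.* ∣ comb s c ∣)                     ≤⟨ ∑-mono cs (λ c → ∣∑*∣ (fins r) s (λ j → d j c) p β h) ⟩
        ∑ cs (λ c → β ℕ.* ∑ (fins r) (λ j → ∣ d j c ∣))     ≡⟨ ∑-*ˡ β cs _ ⟩
        β ℕ.* ∑ cs (λ c → ∑ (fins r) (λ j → ∣ d j c ∣))     ≡⟨ cong (β ℕ.*_) (∑-swap cs (fins r) _) ⟩
        β ℕ.* ∑ (fins r) (λ j → ‖ d j ‖)                    ∎
        where open ℕP.≤-Reasoning

      d≤η : ∑ (fins r) (λ j → ‖ d j ‖) ≤ η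
      d≤η = ≤-trans (ℕP.m≤n+m _ ‖ e ‖) η-ok

      z≤S : ‖ z ‖ ≤ S
      z≤S = ≤-trans (ℕP.m≤m+n ‖ z ‖ η) S-ok

      W⊖ : ∀ q u c → (W q u ⊖ (+ q · z)) c ≡ ((+ q · e) ⊕ comb u) c
      W⊖ q u c = lemma (+ q) (z c) (e c) (comb u c)
        where
        lemma : ∀ q z e s → q ℤ.* (z ℤ.+ e) ℤ.+ s ℤ.- q ℤ.* z ≡ q ℤ.* e ℤ.+ s
        lemma = solve-∀

      near : ∀ q u → (∀ j → ∣ u j ∣ ≤ q) → ‖ W q u ⊖ (+ q · z) ‖ ≤ q ℕ.* η
      near q u h = begin
        ‖ W q u ⊖ (+ q · z) ‖        ≡⟨ ‖‖-cong (W⊖ q u) ⟩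
        ‖ (+ q · e) ⊕ comb u ‖       ≤⟨ ‖⊕‖ (+ q · e) (comb u) ⟩
        ‖ + q · e ‖ ℕ.+ ‖ comb u ‖   ≤⟨ ℕP.+-mono-≤ (≤-reflexive (‖·‖ (+ q) e))
               (subst (_≤ q ℕ.* ∑ (fins r) (λ j → ‖ d j ‖)) (ℕP.*-identityˡ _)
                 (‖comb‖ u 1 q (λ j → subst (_≤ q) (sym (ℕP.*-identityˡ _)) (h j)))) ⟩
        q ℕ.* ‖ e ‖ ℕ.+ q ℕ.* ∑ (fins r) (λ j → ‖ d j ‖)  ≡⟨ sym (ℕP.*-distribˡ-+ q _ _) ⟩
        q ℕ.* (‖ e ‖ ℕ.+ ∑ (fins r) (λ j → ‖ d j ‖))      ≤⟨ ℕP.*-monoʳ-≤ q η-ok ⟩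
        q ℕ.* η                      ∎
        where open ℕP.≤-Reasoning

      total : ∀ q u → (∀ j → ∣ u j ∣ ≤ q) → ‖ W q u ‖ ≤ q ℕ.* S
      total q u h = begin
        ‖ W q u ‖                                        ≡⟨ ‖‖-cong (λ c → lemma (W q u c) ((+ q · z) c)) ⟩
        ‖ (+ q · z) ⊕ (W q u ⊖ (+ q · z)) ‖              ≤⟨ ‖⊕‖ (+ q · z) (W q u ⊖ (+ q · z)) ⟩
        ‖ + q · z ‖ ℕ.+ ‖ W q u ⊖ (+ q · z) ‖            ≤⟨ ℕP.+-mono-≤ (≤-reflexive (‖·‖ (+ q) z)) (near q u h) ⟩
        q ℕ.* ‖ z ‖ ℕ.+ q ℕ.* η                          ≡⟨ sym (ℕP.*-distribˡ-+ q _ _) ⟩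
        q ℕ.* (‖ z ‖ ℕ.+ η)                              ≤⟨ ℕP.*-monoʳ-≤ q S-ok ⟩
        q ℕ.* S                                          ∎
        where
        open ℕP.≤-Reasoning
        lemma : ∀ w o → w ≡ o ℤ.+ (w ℤ.- o)
        lemma = solve-∀

      z-total : ∀ q → ‖ + q · z ‖ ≤ q ℕ.* S
      z-total q = ≤-trans (≤-reflexive (‖·‖ (+ q) z)) (ℕP.*-monoʳ-≤ q z≤S)

      -- The value of any form f at an iterate, from its value and derivatives at z.
      module Value (f : A → A → A → A → ℤ) (f≤K : ∀ x y u v → ∣ f x y u v ∣ ≤ K) where
        open Form f K f≤K using (F; D; D-lin; D-cong; D-scale; F-scale; D-∑; module Taylor)

        value : ∀ q u → (∀ j → ∣ u j ∣ ≤ q) →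
          ∣ F (W q u) ℤ.- + q ℤ.* + q ℤ.* + q ℤ.* (+ q ℤ.* (F z ℤ.+ D z e) ℤ.+ ∑ᶻ (fins r) (λ j → u j ℤ.* D z (d j))) ∣
          ≤ q ℕ.* q ℕ.* q ℕ.* q ℕ.* E
        value q u h = begin
          ∣ F (W q u) ℤ.- + q ℤ.* + q ℤ.* + q ℤ.* (+ q ℤ.* (F z ℤ.+ D z e) ℤ.+ Jsum) ∣
            ≡⟨ cong ∣_∣ (sym (trans (cong₂ (λ s t → F (W q u) ℤ.- s ℤ.- t) (F-scale (+ q) z) lin)
                 (regroup (F (W q u)) (+ q) (F z) (D z e) Jsum))) ⟩
          ∣ F (W q u) ℤ.- F (+ q · z) ℤ.- D (+ q · z) T.δ ∣
            ≤⟨ T.taylor ⟩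
          12 ℕ.* (K ℕ.* (‖ T.δ ‖ ℕ.* (q ℕ.* η ℕ.* (q ℕ.* S ℕ.* (q ℕ.* S)))))
            ≤⟨ ℕP.*-monoʳ-≤ 12 (ℕP.*-monoʳ-≤ K (ℕP.*-monoˡ-≤ _ (near q u h))) ⟩
          12 ℕ.* (K ℕ.* (q ℕ.* η ℕ.* (q ℕ.* η ℕ.* (q ℕ.* S ℕ.* (q ℕ.* S)))))
            ≡⟨ reorder q K η S ⟩
          q ℕ.* q ℕ.* q ℕ.* q ℕ.* E ∎
          where
          open ℕP.≤-Reasoning
          Jsum = ∑ᶻ (fins r) (λ j → u j ℤ.* D z (d j))
          module T = Taylor (W q u) (+ q · z) (+ q · z) (q ℕ.* S) (q ℕ.* η)
            (total q u h) (z-total q) (z-total q) (near q u h)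
            (≤-trans (≤-reflexive (trans (‖‖-cong (λ c → ℤP.+-inverseʳ ((+ q · z) c))) (∑-0 cs))) z≤n)
          lin : D (+ q · z) T.δ ≡ + q ℤ.* + q ℤ.* + q ℤ.* (+ q ℤ.* D z e ℤ.+ Jsum)
          lin = trans (D-scale (+ q) z T.δ) (cong (+ q ℤ.* + q ℤ.* + q ℤ.*_)
            (trans (D-cong {z} {z} {T.δ} {(+ q · e) ⊕ comb u} (λ _ → refl) (W⊖ q u))
            (trans (D-lin z (+ q) e (comb u)) (cong (λ t → + q ℤ.* D z e ℤ.+ t) (D-∑ z (fins r) u d)))))
          regroup : ∀ w q f g j → w ℤ.- q ℤ.* q ℤ.* q ℤ.* q ℤ.* f ℤ.- q ℤ.* q ℤ.* q ℤ.* (q ℤ.* g ℤ.+ j) ≡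
                    w ℤ.- q ℤ.* q ℤ.* q ℤ.* (q ℤ.* (f ℤ.+ g) ℤ.+ j)
          regroup = solve-∀
          reorder : ∀ q k η s → 12 ℕ.* (k ℕ.* (q ℕ.* η ℕ.* (q ℕ.* η ℕ.* (q ℕ.* s ℕ.* (q ℕ.* s))))) ≡
                    q ℕ.* q ℕ.* q ℕ.* q ℕ.* (12 ℕ.* (k ℕ.* (η ℕ.* (η ℕ.* (s ℕ.* s)))))
          reorder = ℕS.solve-∀

        -- Relative to q⁴, the directions change the linear part by at most the sum of the
        -- `∣ D z (d j) ∣`, and the remainder is at most `E`. The hypothesis leaves a margin of 1
        -- beyond both.
        away : 1 ℕ.+ ∑ (fins r) (λ j → ∣ D z (d j) ∣) ℕ.+ E ≤ ∣ F z ℤ.+ D z e ∣ →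
               ∀ q u → (∀ j → ∣ u j ∣ ≤ q) → q ℕ.* q ℕ.* q ℕ.* q ≤ ∣ F (W q u) ∣
        away far q u h = ℕP.+-cancelʳ-≤ (q⁴ ℕ.* (Σd ℕ.+ E)) _ _ (begin
          q⁴ ℕ.+ q⁴ ℕ.* (Σd ℕ.+ E)              ≡⟨ e₁ q⁴ Σd E ⟩
          q⁴ ℕ.* (1 ℕ.+ Σd ℕ.+ E)               ≤⟨ ℕP.*-monoʳ-≤ q⁴ far ⟩
          q⁴ ℕ.* ∣ a ∣                          ≡⟨ abs₄ a ⟩
          ∣ q³ ℤ.* (+ q ℤ.* a) ∣                ≡⟨ cong ∣_∣ (e₂ (F (W q u)) q³ (+ q) a Jsum) ⟩
          ∣ F (W q u) ℤ.+ (ℤ.- (F (W q u) ℤ.- q³ ℤ.* (+ q ℤ.* a ℤ.+ Jsum)) ℤ.+ ℤ.- (q³ ℤ.* Jsum)) ∣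
            ≤⟨ ≤-trans (ℤP.∣i+j∣≤∣i∣+∣j∣ (F (W q u)) _) (ℕP.+-monoʳ-≤ ∣ F (W q u) ∣ (≤-trans (ℤP.∣i+j∣≤∣i∣+∣j∣ (ℤ.- err) (ℤ.- (q³ ℤ.* Jsum)))
                 (ℕP.+-mono-≤ (≤-trans (≤-reflexive (ℤP.∣-i∣≡∣i∣ err)) (value q u h))
                              (≤-trans (≤-reflexive (trans (ℤP.∣-i∣≡∣i∣ (q³ ℤ.* Jsum)) (abs₃ Jsum)))
                                 (ℕP.*-monoʳ-≤ (q ℕ.* q ℕ.* q) Jb))))) ⟩
          ∣ F (W q u) ∣ ℕ.+ (q⁴ ℕ.* E ℕ.+ q ℕ.* q ℕ.* q ℕ.* (q ℕ.* Σd))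
            ≡⟨ cong (∣ F (W q u) ∣ ℕ.+_) (e₃ q E Σd) ⟩
          ∣ F (W q u) ∣ ℕ.+ q⁴ ℕ.* (Σd ℕ.+ E) ∎)
          where
          open ℕP.≤-Reasoning
          q⁴ = q ℕ.* q ℕ.* q ℕ.* q
          q³ = + q ℤ.* + q ℤ.* + q
          Σd = ∑ (fins r) (λ j → ∣ D z (d j) ∣)
          a = F z ℤ.+ D z e
          Jsum = ∑ᶻ (fins r) (λ j → u j ℤ.* D z (d j))
          err = F (W q u) ℤ.- q³ ℤ.* (+ q ℤ.* a ℤ.+ Jsum)
          abs : ∀ i j → ∣ i ℤ.* j ∣ ≡ ∣ i ∣ ℕ.* ∣ j ∣
          abs = ℤP.∣i*j∣≡∣i∣*∣j∣
          abs₃ : ∀ j → ∣ q³ ℤ.* j ∣ ≡ q ℕ.* q ℕ.* q ℕ.* ∣ j ∣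
          abs₃ j = trans (abs q³ j) (cong (ℕ._* ∣ j ∣) (trans (abs (+ q ℤ.* + q) (+ q)) (cong (ℕ._* q) (abs (+ q) (+ q)))))
          abs₄ : ∀ j → q⁴ ℕ.* ∣ j ∣ ≡ ∣ q³ ℤ.* (+ q ℤ.* j) ∣
          abs₄ j = sym (trans (abs₃ (+ q ℤ.* j)) (trans (cong (q ℕ.* q ℕ.* q ℕ.*_) (abs (+ q) j)) (sym (ℕP.*-assoc (q ℕ.* q ℕ.* q) q ∣ j ∣))))
          Jb : ∣ Jsum ∣ ≤ q ℕ.* Σd
          Jb = subst (_≤ q ℕ.* Σd) (ℕP.*-identityˡ ∣ Jsum ∣)
                 (∣∑*∣ (fins r) u (λ j → D z (d j)) 1 q (λ j → subst (_≤ q) (sym (ℕP.*-identityˡ _)) (h j)))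
          e₁ : ∀ q s E → q ℕ.+ q ℕ.* (s ℕ.+ E) ≡ q ℕ.* (1 ℕ.+ s ℕ.+ E)
          e₁ = ℕS.solve-∀
          e₂ : ∀ f c q a j → c ℤ.* (q ℤ.* a) ≡ f ℤ.+ (ℤ.- (f ℤ.- c ℤ.* (q ℤ.* a ℤ.+ j)) ℤ.+ ℤ.- (c ℤ.* j))
          e₂ = solve-∀
          e₃ : ∀ q E s → q ℕ.* q ℕ.* q ℕ.* q ℕ.* E ℕ.+ q ℕ.* q ℕ.* q ℕ.* (q ℕ.* s) ≡ q ℕ.* q ℕ.* q ℕ.* q ℕ.* (s ℕ.+ E)
          e₃ = ℕS.solve-∀

      -- In terms of the true coefficients u j / q: they are at most 1 - 2^(-n) in absolute value,
      -- and the defects of the equations are at most L / 2^(n+1). The first bound keeps every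
      -- iterate in the region for which η and S were chosen.
      record State (n : ℕ) : Set where
        field
          q   : ℕ
          u   : Fin r → ℤ
          q>0 : 1 ≤ q
          u≤  : ∀ j → 2 ^ n ℕ.* ∣ u j ∣ ℕ.+ q ≤ 2 ^ n ℕ.* q
          F≤  : ∀ i → 2 ^ suc n ℕ.* ∣ Fm.F i (W q u) ∣ ≤ L ℕ.* (q ℕ.* q ℕ.* q ℕ.* q)

        u≤q : ∀ j → ∣ u j ∣ ≤ q
        u≤q j = ℕP.*-cancelˡ-≤ (2 ^ n) ⦃ ℕP.m^n≢0 2 n ⦄ (≤-trans (ℕP.m≤m+n _ q) (u≤ j))

      module _ (L>0 : 1 ≤ L)
        (start : ∀ i → 2 ℕ.* (∣ Fm.F i z ℤ.+ Fm.D i z e ∣ ℕ.+ E) ≤ L)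
        (jacobian : ∀ i → 2 ℕ.* (∑ (fins r) (λ j → ∣ Fm.D i z (d j) ℤ.- + L ℤ.* kron i j ∣) ℕ.+ E) ≤ L) where

        initial : State 0
        initial = record
          { q = 1 ; u = λ _ → 0ℤ ; q>0 = ≤-refl ; u≤ = λ _ → ≤-refl
          ; F≤ = λ i → ≤-trans (ℕP.*-monoʳ-≤ 2 (bd i)) (≤-trans (start i) (≤-reflexive (sym (ℕP.*-identityʳ L)))) }
          where
          bd : ∀ i → ∣ Fm.F i (W 1 (λ _ → 0ℤ)) ∣ ≤ ∣ Fm.F i z ℤ.+ Fm.D i z e ∣ ℕ.+ E
          bd i = begin
            ∣ f ∣                     ≡⟨ cong ∣_∣ (split f a) ⟩
            ∣ a ℤ.+ (f ℤ.- a) ∣       ≤⟨ ℤP.∣i+j∣≤∣i∣+∣j∣ a (f ℤ.- a) ⟩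
            ∣ a ∣ ℕ.+ ∣ f ℤ.- a ∣     ≤⟨ ℕP.+-monoʳ-≤ ∣ a ∣ (≤-trans (≤-reflexive (cong (λ t → ∣ f ℤ.- t ∣) (sym simp)))
                                          (≤-trans (Value.value (k i) (k≤K i) 1 (λ _ → 0ℤ) (λ _ → z≤n)) (≤-reflexive (ℕP.*-identityˡ E)))) ⟩
            ∣ a ∣ ℕ.+ E               ∎
            where
            open ℕP.≤-Reasoning
            f = Fm.F i (W 1 (λ _ → 0ℤ))
            a = Fm.F i z ℤ.+ Fm.D i z e
            split : ∀ f a → f ≡ a ℤ.+ (f ℤ.- a)
            split = solve-∀
            simp : + 1 ℤ.* + 1 ℤ.* + 1 ℤ.* (+ 1 ℤ.* a ℤ.+ ∑ᶻ (fins r) (λ j → 0ℤ ℤ.* Fm.D i z (d j))) ≡ a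
            simp = trans (cong (λ t → + 1 ℤ.* + 1 ℤ.* + 1 ℤ.* (+ 1 ℤ.* a ℤ.+ t))
                     (trans (∑ᶻ-cong (fins r) (λ j → ℤP.*-zeroˡ (Fm.D i z (d j)))) (∑ᶻ-0 (fins r)))) (one a)
              where
              one : ∀ a → + 1 ℤ.* + 1 ℤ.* + 1 ℤ.* (+ 1 ℤ.* a ℤ.+ 0ℤ) ≡ a
              one = solve-∀

        -- The coefficient u j / q changes by the defect of equation j divided by -L, which is a
        -- Newton step with L times the identity as Jacobian. The step is at most 2^(-n-1), just
        -- what the bound on the coefficients allows, and `jacobian` halves the bound on the
        -- defects.
        next : ∀ {n} → State n → State (suc n)
        next {n} st = record { q = q′ ; u = u′ ; q>0 = ℕP.*-mono-≤ q>0 m>0 ; u≤ = u′≤ ; F≤ = F′≤ }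
          where
          open State st
          m q′ q⁴ : ℕ
          -- The defect is f j / q⁴, so the step is f j / (q⁴ L); its denominator is q m.
          m = q ℕ.* q ℕ.* q ℕ.* L
          q′ = q ℕ.* m
          q⁴ = q ℕ.* q ℕ.* q ℕ.* q
          m>0 : 1 ≤ m
          m>0 = ℕP.*-mono-≤ (ℕP.*-mono-≤ (ℕP.*-mono-≤ q>0 q>0) q>0) L>0
          f : Fin r → ℤ
          f j = Fm.F j (W q u)
          u′ : Fin r → ℤ
          u′ j = + m ℤ.* u j ℤ.- f j
          Lq⁴ : L ℕ.* q⁴ ≡ q′
          Lq⁴ = eq L q
            where
            eq : ∀ l q → l ℕ.* (q ℕ.* q ℕ.* q ℕ.* q) ≡ q ℕ.* (q ℕ.* q ℕ.* q ℕ.* l)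
            eq = ℕS.solve-∀
          u′≤ : ∀ j → 2 ^ suc n ℕ.* ∣ u′ j ∣ ℕ.+ q′ ≤ 2 ^ suc n ℕ.* q′
          u′≤ j = begin
            2 ^ suc n ℕ.* ∣ u′ j ∣ ℕ.+ q′
              ≤⟨ ℕP.+-monoˡ-≤ q′ (ℕP.*-monoʳ-≤ (2 ^ suc n) (≤-trans (ℤP.∣i-j∣≤∣i∣+∣j∣ (+ m ℤ.* u j) (f j))
                   (≤-reflexive (cong (ℕ._+ ∣ f j ∣) (ℤP.∣i*j∣≡∣i∣*∣j∣ (+ m) (u j)))))) ⟩
            2 ^ suc n ℕ.* (m ℕ.* ∣ u j ∣ ℕ.+ ∣ f j ∣) ℕ.+ q′
              ≡⟨ cong (ℕ._+ q′) (ℕP.*-distribˡ-+ (2 ^ suc n) _ _) ⟩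
            2 ^ suc n ℕ.* (m ℕ.* ∣ u j ∣) ℕ.+ 2 ^ suc n ℕ.* ∣ f j ∣ ℕ.+ q′
              ≤⟨ ℕP.+-monoˡ-≤ q′ (ℕP.+-monoʳ-≤ (2 ^ suc n ℕ.* (m ℕ.* ∣ u j ∣)) (≤-trans (F≤ j) (≤-reflexive Lq⁴))) ⟩
            2 ^ suc n ℕ.* (m ℕ.* ∣ u j ∣) ℕ.+ q′ ℕ.+ q′  ≡⟨ e₁ (2 ^ n) m (∣ u j ∣) q ⟩
            2 ℕ.* m ℕ.* (2 ^ n ℕ.* ∣ u j ∣ ℕ.+ q)        ≤⟨ ℕP.*-monoʳ-≤ (2 ℕ.* m) (u≤ j) ⟩
            2 ℕ.* m ℕ.* (2 ^ n ℕ.* q)                    ≡⟨ e₂ (2 ^ n) m q ⟩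
            2 ^ suc n ℕ.* q′                             ∎
            where
            open ℕP.≤-Reasoning
            e₁ : ∀ t m u q → 2 ℕ.* t ℕ.* (m ℕ.* u) ℕ.+ q ℕ.* m ℕ.+ q ℕ.* m ≡ 2 ℕ.* m ℕ.* (t ℕ.* u ℕ.+ q)
            e₁ = ℕS.solve-∀
            e₂ : ∀ t m q → 2 ℕ.* m ℕ.* (t ℕ.* q) ≡ 2 ℕ.* t ℕ.* (q ℕ.* m)
            e₂ = ℕS.solve-∀
          u′≤q′ : ∀ j → ∣ u′ j ∣ ≤ q′
          u′≤q′ j = ℕP.*-cancelˡ-≤ (2 ^ suc n) ⦃ ℕP.m^n≢0 2 (suc n) ⦄ (≤-trans (ℕP.m≤m+n _ q′) (u′≤ j))
          -- New iterate, old iterate rescaled to the new denominator, and base point at the same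
          -- scale.
          W′ y o : A → ℤ
          W′ = W q′ u′
          y = + m · W q u
          o = + q′ · z
          pos-q′ : + q′ ≡ + m ℤ.* + q
          pos-q′ = trans (cong +_ (ℕP.*-comm q m)) (ℤP.pos-* m q)
          y⊖o : ∀ c → (y ⊖ o) c ≡ (+ m · (W q u ⊖ (+ q · z))) c
          y⊖o c = trans (cong (λ t → + m ℤ.* W q u c ℤ.- t ℤ.* z c) pos-q′) (lemma (+ m) (+ q) (W q u c) (z c))
            where
            lemma : ∀ m q w z → m ℤ.* w ℤ.- m ℤ.* q ℤ.* z ≡ m ℤ.* (w ℤ.- q ℤ.* z)
            lemma = solve-∀
          y-total : ‖ y ‖ ≤ q′ ℕ.* S
          y-total = ≤-trans (≤-reflexive (‖·‖ (+ m) (W q u))) (≤-trans (ℕP.*-monoʳ-≤ m (total q u u≤q)) (≤-reflexive (eq m q S)))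
            where
            eq : ∀ m q s → m ℕ.* (q ℕ.* s) ≡ q ℕ.* m ℕ.* s
            eq = ℕS.solve-∀
          y-near : ‖ y ⊖ o ‖ ≤ q′ ℕ.* η
          y-near = ≤-trans (≤-reflexive (trans (‖‖-cong y⊖o) (‖·‖ (+ m) (W q u ⊖ (+ q · z)))))
            (≤-trans (ℕP.*-monoʳ-≤ m (near q u u≤q)) (≤-reflexive (eq m q η)))
            where
            eq : ∀ m q s → m ℕ.* (q ℕ.* s) ≡ q ℕ.* m ℕ.* s
            eq = ℕS.solve-∀
          δ≡ : ∀ c → (W′ ⊖ y) c ≡ ∑ᶻ (fins r) (λ j → (ℤ.- f j) ℤ.* d j c)
          δ≡ c = trans (cong₂ (λ s t → s ℤ.* (z c ℤ.+ e c) ℤ.+ t ℤ.- + m ℤ.* W q u c) pos-q′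
                   (trans (∑ᶻ-cong (fins r) (λ j → dist (+ m) (u j) (f j) (d j c))) (∑ᶻ-lin (fins r) (+ m) _ _)))
                   (lemma (+ m) (+ q) (z c ℤ.+ e c) (comb u c) _)
            where
            dist : ∀ m u f d → (m ℤ.* u ℤ.- f) ℤ.* d ≡ m ℤ.* (u ℤ.* d) ℤ.+ (ℤ.- f) ℤ.* d
            dist = solve-∀
            lemma : ∀ m q x s t → m ℤ.* q ℤ.* x ℤ.+ (m ℤ.* s ℤ.+ t) ℤ.- m ℤ.* (q ℤ.* x ℤ.+ s) ≡ t
            lemma = solve-∀
          β : ℕ
          β = L ℕ.* q⁴
          f≤β : ∀ j → 2 ^ suc n ℕ.* ∣ ℤ.- f j ∣ ≤ β
          f≤β j = subst (λ t → 2 ^ suc n ℕ.* t ≤ β) (sym (ℤP.∣-i∣≡∣i∣ (f j))) (F≤ j)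
          δ-total : 2 ^ suc n ℕ.* ‖ W′ ⊖ y ‖ ≤ β ℕ.* η
          δ-total = ≤-trans (≤-reflexive (cong (2 ^ suc n ℕ.*_) (‖‖-cong δ≡)))
                     (≤-trans (‖comb‖ (λ j → ℤ.- f j) (2 ^ suc n) β f≤β) (ℕP.*-monoʳ-≤ β d≤η))
          F′≤ : ∀ i → 2 ^ suc (suc n) ℕ.* ∣ Fm.F i W′ ∣ ≤ L ℕ.* (q′ ℕ.* q′ ℕ.* q′ ℕ.* q′)
          F′≤ i = begin
            2 ^ suc (suc n) ℕ.* ∣ Fm.F i W′ ∣
              ≡⟨ trans (cong (λ t → 2 ^ suc (suc n) ℕ.* ∣ t ∣) decomposition) (ℕP.*-assoc 2 (2 ^ suc n) _) ⟩
            2 ℕ.* (2 ^ suc n ℕ.* ∣ err ℤ.+ q′³ ℤ.* R ∣)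
              ≤⟨ ℕP.*-monoʳ-≤ 2 (≤-trans (ℕP.*-monoʳ-≤ (2 ^ suc n) (ℤP.∣i+j∣≤∣i∣+∣j∣ err (q′³ ℤ.* R)))
                   (≤-reflexive (ℕP.*-distribˡ-+ (2 ^ suc n) ∣ err ∣ _))) ⟩
            2 ℕ.* (2 ^ suc n ℕ.* ∣ err ∣ ℕ.+ 2 ^ suc n ℕ.* ∣ q′³ ℤ.* R ∣)
              ≤⟨ ℕP.*-monoʳ-≤ 2 (ℕP.+-mono-≤ err≤ R≤) ⟩
            2 ℕ.* (n³ ℕ.* (β ℕ.* E) ℕ.+ n³ ℕ.* (β ℕ.* ΣJ))   ≡⟨ e₁ n³ β E ΣJ ⟩
            n³ ℕ.* β ℕ.* (2 ℕ.* (ΣJ ℕ.+ E))                   ≤⟨ ℕP.*-monoʳ-≤ (n³ ℕ.* β) (jacobian i) ⟩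
            n³ ℕ.* β ℕ.* L                                     ≡⟨ e₂ q L ⟩
            L ℕ.* (q′ ℕ.* q′ ℕ.* q′ ℕ.* q′)                    ∎
            where
            open ℕP.≤-Reasoning
            module T = Fm.Taylor i W′ y o (q′ ℕ.* S) (q′ ℕ.* η)
              (total q′ u′ u′≤q′) y-total (z-total q′) (near q′ u′ u′≤q′) y-near
            n³ = q′ ℕ.* q′ ℕ.* q′
            q′³ = + q′ ℤ.* + q′ ℤ.* + q′
            err = Fm.F i W′ ℤ.- Fm.F i y ℤ.- Fm.D i o (W′ ⊖ y)
            Jd : Fin r → ℤ
            Jd j = Fm.D i z (d j) ℤ.- + L ℤ.* kron i j
            ΣJ = ∑ (fins r) (λ j → ∣ Jd j ∣)
            -- What survives of the linear terms: the part L times the identity of the Jacobian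
            -- cancels the value at the old iterate.
            R = ∑ᶻ (fins r) (λ j → (ℤ.- f j) ℤ.* Jd j)
            Dδ : Fm.D i o (W′ ⊖ y) ≡ q′³ ℤ.* ∑ᶻ (fins r) (λ j → (ℤ.- f j) ℤ.* Fm.D i z (d j))
            Dδ = trans (Fm.D-scale i (+ q′) z (W′ ⊖ y)) (cong (q′³ ℤ.*_)
                   (trans (Fm.D-cong i {z} {z} {W′ ⊖ y} (λ _ → refl) δ≡) (Fm.D-∑ i z (fins r) (λ j → ℤ.- f j) d)))
            R≡ : R ≡ ∑ᶻ (fins r) (λ j → (ℤ.- f j) ℤ.* Fm.D i z (d j)) ℤ.+ + L ℤ.* f i
            R≡ = trans (∑ᶻ-cong (fins r) (λ j → dist (f j) (Fm.D i z (d j)) (+ L) (kron i j)))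
                   (trans (∑ᶻ-lin (fins r) (+ L) (λ j → f j ℤ.* kron i j) _)
                     (trans (cong (λ t → + L ℤ.* t ℤ.+ ∑ᶻ (fins r) (λ j → (ℤ.- f j) ℤ.* Fm.D i z (d j))) (∑ᶻ-kron f i)) (ℤP.+-comm (+ L ℤ.* f i) _)))
              where
              dist : ∀ f d l k → (ℤ.- f) ℤ.* (d ℤ.- l ℤ.* k) ≡ l ℤ.* (f ℤ.* k) ℤ.+ (ℤ.- f) ℤ.* d
              dist = solve-∀
            -- Both sides are q¹² L⁴. The identity makes the quartic scaling of `F` at y fit the
            -- cubic scaling of the derivative, so that the cancellation in R is exact.
            m⁴ : + m ℤ.* + m ℤ.* + m ℤ.* + m ≡ q′³ ℤ.* + L
            m⁴ = trans (cong (λ t → + m ℤ.* + m ℤ.* + m ℤ.* t) pos-m)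
                   (trans (eq (+ m) (+ q) (+ L)) (cong (λ t → t ℤ.* t ℤ.* t ℤ.* + L) (sym pos-q′)))
              where
              pos-m : + m ≡ + q ℤ.* + q ℤ.* + q ℤ.* + L
              pos-m = trans (ℤP.pos-* (q ℕ.* q ℕ.* q) L) (cong (ℤ._* + L) (trans (ℤP.pos-* (q ℕ.* q) q) (cong (ℤ._* + q) (ℤP.pos-* q q))))
              eq : ∀ m q l → m ℤ.* m ℤ.* m ℤ.* (q ℤ.* q ℤ.* q ℤ.* l) ≡ m ℤ.* q ℤ.* (m ℤ.* q) ℤ.* (m ℤ.* q) ℤ.* l
              eq = solve-∀
            decomposition : Fm.F i W′ ≡ err ℤ.+ q′³ ℤ.* R
            decomposition = trans (e₃ (Fm.F i W′) (Fm.F i y) (Fm.D i o (W′ ⊖ y)))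
              (cong (λ t → err ℤ.+ t) (trans (cong₂ ℤ._+_ (trans (Fm.F-scale i (+ m) (W q u)) (cong (ℤ._* f i) m⁴)) Dδ)
                (trans (e₄ q′³ (+ L) (f i) _) (cong (q′³ ℤ.*_) (sym R≡)))))
              where
              e₃ : ∀ a b c → a ≡ a ℤ.- b ℤ.- c ℤ.+ (b ℤ.+ c)
              e₃ = solve-∀
              e₄ : ∀ c l f s → c ℤ.* l ℤ.* f ℤ.+ c ℤ.* s ≡ c ℤ.* (s ℤ.+ l ℤ.* f)
              e₄ = solve-∀
            err≤ : 2 ^ suc n ℕ.* ∣ err ∣ ≤ n³ ℕ.* (β ℕ.* E)
            err≤ = begin
              2 ^ suc n ℕ.* ∣ err ∣
                ≤⟨ ℕP.*-monoʳ-≤ (2 ^ suc n) T.taylor ⟩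
              2 ^ suc n ℕ.* (12 ℕ.* (K ℕ.* (‖ W′ ⊖ y ‖ ℕ.* (q′ ℕ.* η ℕ.* (q′ ℕ.* S ℕ.* (q′ ℕ.* S))))))
                ≡⟨ e₅ (2 ^ suc n) (‖ W′ ⊖ y ‖) K q′ η S ⟩
              2 ^ suc n ℕ.* ‖ W′ ⊖ y ‖ ℕ.* (12 ℕ.* (K ℕ.* (q′ ℕ.* η ℕ.* (q′ ℕ.* S ℕ.* (q′ ℕ.* S)))))
                ≤⟨ ℕP.*-monoˡ-≤ _ δ-total ⟩
              β ℕ.* η ℕ.* (12 ℕ.* (K ℕ.* (q′ ℕ.* η ℕ.* (q′ ℕ.* S ℕ.* (q′ ℕ.* S)))))
                ≡⟨ e₆ β K q′ η S ⟩
              n³ ℕ.* (β ℕ.* E) ∎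
              where
              e₅ : ∀ t w k q η s → t ℕ.* (12 ℕ.* (k ℕ.* (w ℕ.* (q ℕ.* η ℕ.* (q ℕ.* s ℕ.* (q ℕ.* s)))))) ≡
                   t ℕ.* w ℕ.* (12 ℕ.* (k ℕ.* (q ℕ.* η ℕ.* (q ℕ.* s ℕ.* (q ℕ.* s)))))
              e₅ = ℕS.solve-∀
              e₆ : ∀ b k q η s → b ℕ.* η ℕ.* (12 ℕ.* (k ℕ.* (q ℕ.* η ℕ.* (q ℕ.* s ℕ.* (q ℕ.* s))))) ≡
                   q ℕ.* q ℕ.* q ℕ.* (b ℕ.* (12 ℕ.* (k ℕ.* (η ℕ.* (η ℕ.* (s ℕ.* s))))))
              e₆ = ℕS.solve-∀
            R≤ : 2 ^ suc n ℕ.* ∣ q′³ ℤ.* R ∣ ≤ n³ ℕ.* (β ℕ.* ΣJ)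
            R≤ = begin
              2 ^ suc n ℕ.* ∣ q′³ ℤ.* R ∣         ≡⟨ cong (2 ^ suc n ℕ.*_) (trans (abs q′³ R) (cong (ℕ._* ∣ R ∣)
                   (trans (abs (+ q′ ℤ.* + q′) (+ q′)) (cong (ℕ._* q′) (abs (+ q′) (+ q′)))))) ⟩
              2 ^ suc n ℕ.* (n³ ℕ.* ∣ R ∣)        ≡⟨ e₇ (2 ^ suc n) n³ (∣ R ∣) ⟩
              n³ ℕ.* (2 ^ suc n ℕ.* ∣ R ∣)        ≤⟨ ℕP.*-monoʳ-≤ n³ (∣∑*∣ (fins r) (λ j → ℤ.- f j) Jd (2 ^ suc n) β f≤β) ⟩
              n³ ℕ.* (β ℕ.* ΣJ)                   ∎
              where
              abs : ∀ i j → ∣ i ℤ.* j ∣ ≡ ∣ i ∣ ℕ.* ∣ j ∣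
              abs = ℤP.∣i*j∣≡∣i∣*∣j∣
              e₇ : ∀ t n r → t ℕ.* (n ℕ.* r) ≡ n ℕ.* (t ℕ.* r)
              e₇ = ℕS.solve-∀
            e₁ : ∀ n b x s → 2 ℕ.* (n ℕ.* (b ℕ.* x) ℕ.+ n ℕ.* (b ℕ.* s)) ≡ n ℕ.* b ℕ.* (2 ℕ.* (s ℕ.+ x))
            e₁ = ℕS.solve-∀
            e₂ : ∀ q l → q ℕ.* (q ℕ.* q ℕ.* q ℕ.* l) ℕ.* (q ℕ.* (q ℕ.* q ℕ.* q ℕ.* l)) ℕ.* (q ℕ.* (q ℕ.* q ℕ.* q ℕ.* l)) ℕ.*
                 (l ℕ.* (q ℕ.* q ℕ.* q ℕ.* q)) ℕ.* l ≡
                 l ℕ.* (q ℕ.* (q ℕ.* q ℕ.* q ℕ.* l) ℕ.* (q ℕ.* (q ℕ.* q ℕ.* q ℕ.* l)) ℕ.* (q ℕ.* (q ℕ.* q ℕ.* q ℕ.* l)) ℕ.* (q ℕ.* (q ℕ.* q ℕ.* q ℕ.* l)))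
            e₂ = ℕS.solve-∀

        states : ∀ n → State n
        states zero = initial
        states (suc n) = next (states n)

-- From Newton iterates to a sequence that is not quasirandom

module Refutation where

  open Sums
  open Counting
  open Ties
  open Templates
  open QuadrilinearForms
  open Iteration
  open import Data.Empty using (⊥-elim; ⊥)
  open import Data.Fin as F using (Fin; toℕ; zero; suc)
  open import Data.Fin.Permutation using (_⟨$⟩ʳ_; _⟨$⟩ˡ_)
  open import Data.Integer as ℤ using (ℤ; +_; -[1+_]; ∣_∣; 1ℤ; +≤+)
  import Data.Integer.Properties as ℤP
  open import Data.Integer.Tactic.RingSolver using (solve-∀)
  import Data.Nat.Tactic.RingSolver as ℕS
  open import Data.List as L using (List; []; _∷_)
  open import Data.List.Membership.Propositional using (_∈_)
  open import Data.List.Relation.Unary.All as All using (All; []; _∷_)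
  open import Data.Nat as ℕ using (ℕ; zero; suc; _≤_; _<_; z≤n; s≤s; _^_)
  open import Data.Nat.Combinatorics using (_C_)
  open import Data.Nat.Properties as ℕP using (≤-trans; ≤-refl; ≤-reflexive)
  open import Data.Product using (_,_; proj₁; proj₂; ∃)
  open import Data.Rational as ℚ using (ℚ; mkℚ; 0ℚ; toℚᵘ)
  import Data.Rational.Properties as ℚP
  open import Data.Rational.Unnormalised as ℚᵘ using (ℚᵘ; mkℚᵘ; *<*; _≃_)
  import Data.Rational.Unnormalised.Properties as ℚᵘP
  open import Data.Sum using (inj₁; inj₂)
  open import Data.Vec as V using ([]; _∷_)
  open import Relation.Binary.PropositionalEquality
  open import Relation.Nullary using (¬_)

  dist≤ : ∀ {x y z} → x ≤ y ℕ.+ z → y ≤ x ℕ.+ z → ℕ.∣ x - y ∣ ≤ z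
  dist≤ {x} {y} {z} p q with ℕP.≤-total x y
  ... | inj₁ x≤y = subst (_≤ z) (sym (ℕP.m≤n⇒∣m-n∣≡n∸m x≤y)) (ℕP.m≤n+o⇒m∸n≤o y x q)
  ... | inj₂ y≤x = subst (_≤ z) (sym (trans (ℕP.∣-∣-comm x y) (ℕP.m≤n⇒∣m-n∣≡n∸m y≤x))) (ℕP.m≤n+o⇒m∸n≤o x y p)

  ∣⊖∣ : ∀ x y → ∣ + x ℤ.- + y ∣ ≡ ℕ.∣ x - y ∣
  ∣⊖∣ x y = trans (cong ∣_∣ (ℤP.m-n≡m⊖n x y)) (go x y)
    where
    go : ∀ x y → ∣ x ℤ.⊖ y ∣ ≡ ℕ.∣ x - y ∣
    go x y with ℕP.≤-total x y
    ... | inj₁ x≤y = trans (ℤP.∣⊖∣-≤ x≤y) (sym (ℕP.m≤n⇒∣m-n∣≡n∸m x≤y))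
    ... | inj₂ y≤x = trans (ℤP.∣m⊖n∣≡∣n⊖m∣ x y) (trans (ℤP.∣⊖∣-≤ y≤x)
                       (trans (sym (ℕP.m≤n⇒∣m-n∣≡n∸m y≤x)) (ℕP.∣-∣-comm y x)))

  -- Unnormalised rationals subtract by cross-multiplication, so that no greatest common divisor
  -- enters the estimates.
  deviation : ∀ a b → toℚᵘ ℚ.∣ frac a (suc b) ℚ.- frac 1 24 ∣ ≃ mkℚᵘ (+ ℕ.∣ 24 ℕ.* a - suc b ∣) (ℕ.pred (suc b ℕ.* 24))
  deviation a b = ℚᵘP.≃-trans (ℚP.toℚᵘ-homo-∣-∣ (frac a (suc b) ℚ.- frac 1 24))
    (ℚᵘP.≃-trans (ℚᵘP.∣-∣-cong (ℚᵘP.≃-trans (ℚP.toℚᵘ-homo-+ (frac a (suc b)) (ℚ.- frac 1 24))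
      (ℚᵘP.+-cong (ℚP.toℚᵘ-fromℚᵘ (mkℚᵘ (+ a) b)) (ℚᵘP.≃-trans (ℚP.toℚᵘ-homo‿- (frac 1 24)) (ℚᵘP.-‿cong (ℚP.toℚᵘ-fromℚᵘ (mkℚᵘ (+ 1) 23)))))))
      (ℚᵘP.≃-reflexive (cong (λ n → mkℚᵘ (+ n) (ℕ.pred (suc b ℕ.* 24))) num)))
    where
    num : ∣ + a ℤ.* + 24 ℤ.+ -[1+ 0 ] ℤ.* + suc b ∣ ≡ ℕ.∣ 24 ℕ.* a - suc b ∣
    num = trans (cong₂ (λ s t → ∣ s ℤ.+ t ∣) (trans (ℤP.*-comm (+ a) (+ 24)) (sym (ℤP.pos-* 24 a))) (ℤP.-1*i≡-i (+ suc b)))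
                (∣⊖∣ (24 ℕ.* a) (suc b))

  -- A positive ε is at least 1 over its denominator, so any n from B times that denominator on is
  -- large enough.
  close : ∀ a b n B ε → 0ℚ ℚ.< ε → suc n ℕ.* ℕ.∣ 24 ℕ.* a - suc b ∣ ≤ B ℕ.* suc b →
          B ℕ.* ℚ.denominatorℕ ε ≤ n → ℚ.∣ frac a (suc b) ℚ.- frac 1 24 ∣ ℚ.< ε
  close a b n B ε@(mkℚ (+ suc m) d-1 _) 0<ε h big = ℚP.toℚᵘ-cancel-<
    (ℚᵘP.<-respˡ-≃ (ℚᵘP.≃-sym (deviation a b)) (*<* (subst₂ ℤ._<_ (ℤP.pos-* x (suc d-1)) (ℤP.pos-* (suc m) (suc b ℕ.* 24)) (ℤ.+<+ key))))
    where
    x = ℕ.∣ 24 ℕ.* a - suc b ∣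
    key : x ℕ.* suc d-1 < suc m ℕ.* (suc b ℕ.* 24)
    key = ℕP.*-cancelˡ-< (suc n) _ _ (begin-strict
      suc n ℕ.* (x ℕ.* suc d-1)       ≡⟨ sym (ℕP.*-assoc (suc n) x (suc d-1)) ⟩
      suc n ℕ.* x ℕ.* suc d-1         ≤⟨ ℕP.*-monoˡ-≤ (suc d-1) h ⟩
      B ℕ.* suc b ℕ.* suc d-1         ≡⟨ e B (suc b) (suc d-1) ⟩
      B ℕ.* suc d-1 ℕ.* suc b         ≤⟨ ℕP.*-monoˡ-≤ (suc b) big ⟩
      n ℕ.* suc b                     <⟨ ℕP.*-monoˡ-< (suc b) (ℕP.n<1+n n) ⟩
      suc n ℕ.* suc b                 ≤⟨ ℕP.*-monoʳ-≤ (suc n) (≤-trans (ℕP.m≤m*n (suc b) 24) (ℕP.m≤n*m (suc b ℕ.* 24) (suc m))) ⟩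
      suc n ℕ.* (suc m ℕ.* (suc b ℕ.* 24)) ∎)
      where
      open ℕP.≤-Reasoning
      e : ∀ x y z → x ℕ.* y ℕ.* z ≡ x ℕ.* z ℕ.* y
      e = ℕS.solve-∀
  close a b n B (mkℚ (+ 0) d-1 _) (ℚ.*<* (ℤ.+<+ ())) h big
  close a b n B (mkℚ -[1+ _ ] d-1 _) (ℚ.*<* ()) h big

  unit : ℕ → ℚ
  unit E = frac 1 (suc E)

  unit>0 : ∀ E → 0ℚ ℚ.< unit E
  unit>0 E = ℚP.positive⁻¹ (unit E) ⦃ ℚP.normalize-pos 1 (suc E) ⦄

  close⁻ : ∀ a b E → ℚ.∣ frac a (suc b) ℚ.- frac 1 24 ∣ ℚ.< unit E → suc E ℕ.* ℕ.∣ 24 ℕ.* a - suc b ∣ < 24 ℕ.* suc b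
  close⁻ a b E h = subst₂ _<_ (ℕP.*-comm _ (suc E)) (trans (ℕP.*-identityˡ _) (ℕP.*-comm (suc b) 24)) (ℤP.drop‿+<+ (subst₂ ℤ._<_
    (sym (ℤP.pos-* ℕ.∣ 24 ℕ.* a - suc b ∣ (suc E))) (sym (ℤP.pos-* 1 (suc b ℕ.* 24))) (ℚᵘP.drop-*<* lt)))
    where
    lt : mkℚᵘ (+ ℕ.∣ 24 ℕ.* a - suc b ∣) (ℕ.pred (suc b ℕ.* 24)) ℚᵘ.< mkℚᵘ (+ 1) E
    lt = ℚᵘP.<-respʳ-≃ (ℚP.toℚᵘ-fromℚᵘ (mkℚᵘ (+ 1) E)) (ℚᵘP.<-respˡ-≃ (deviation a b) (ℚP.toℚᵘ-mono-< h))

  ∑ᶻ-congᴬ : ∀ {A : Set} {P : A → Set} {xs : List A} → All P xs → {f g : A → ℤ} → (∀ x → P x → f x ≡ g x) → ∑ᶻ xs f ≡ ∑ᶻ xs g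
  ∑ᶻ-congᴬ [] h = refl
  ∑ᶻ-congᴬ (p ∷ ps) h = cong₂ ℤ._+_ (h _ p) (∑ᶻ-congᴬ ps h)

  -- Only the counting bounds matter here, so the permutations are kept opaque.
  module Limits (M : ℕ → ℕ) (π : ∀ n → Perm (M n)) (c : ℕ) (c≡ : c ≡ 24) (M≥ : ∀ n → n ≤ M n)
    (C>0 : ∀ n → ∃ λ b → M n C 4 ≡ suc b) where

    sequence : PermSeq
    sequence = record { size = M ; perm = π }

    sizes : SizesToInfinity sequence
    sizes m = m , λ i m≤i → ≤-trans m≤i (M≥ i)

    tends : ∀ (σ : Perm 4) B → (∀ n → suc n ℕ.* ℕ.∣ c ℕ.* count σ (π n) - M n C 4 ∣ ≤ B ℕ.* (M n C 4)) → DensityTendsToRandom sequence σ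
    tends σ B h ε 0<ε = B ℕ.* ℚ.denominatorℕ ε , λ n big → go n (count σ (π n)) (M n C 4) (C>0 n) (h n) big
      where
      go : ∀ n a t → (∃ λ b → t ≡ suc b) → suc n ℕ.* ℕ.∣ c ℕ.* a - t ∣ ≤ B ℕ.* t → B ℕ.* ℚ.denominatorℕ ε ≤ n →
           ℚ.∣ frac a t ℚ.- frac 1 24 ∣ ℚ.< ε
      go n a _ (b , refl) hn big = close a b n B ε 0<ε (subst (λ x → suc n ℕ.* ℕ.∣ x ℕ.* a - suc b ∣ ≤ B ℕ.* suc b) c≡ hn) big

    not-tends : ∀ (σ : Perm 4) s m → (∀ n → m ≤ n → M n C 4 ≤ s ℕ.* ℕ.∣ c ℕ.* count σ (π n) - M n C 4 ∣) → ¬ DensityTendsToRandom sequence σ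
    not-tends σ s m h t = go (count σ (π n)) (M n C 4) (C>0 n) (h n (ℕP.m≤n+m m n₀)) (proj₂ (t (unit E) (unit>0 E)) n (ℕP.m≤m+n n₀ m))
      where
      -- The hypothesis keeps the density at distance at least 1/(24 s) from 1/24; the tolerance
      -- 1/(24 s + 1) is smaller.
      E = 24 ℕ.* s
      n₀ = proj₁ (t (unit E) (unit>0 E))
      n = n₀ ℕ.+ m
      finish : ∀ k b x → k ≡ 24 → suc b ≤ s ℕ.* x → suc (k ℕ.* s) ℕ.* x < k ℕ.* suc b → ⊥
      finish k b x _ p q = ℕP.<-irrefl refl (begin-strict
        k ℕ.* s ℕ.* x          ≤⟨ ℕP.*-monoˡ-≤ x (ℕP.n≤1+n (k ℕ.* s)) ⟩
        suc (k ℕ.* s) ℕ.* x    <⟨ q ⟩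
        k ℕ.* suc b            ≤⟨ ℕP.*-monoʳ-≤ k p ⟩
        k ℕ.* (s ℕ.* x)        ≡⟨ sym (ℕP.*-assoc k s x) ⟩
        k ℕ.* s ℕ.* x          ∎)
        where open ℕP.≤-Reasoning
      go : ∀ a t → (∃ λ b → t ≡ suc b) → t ≤ s ℕ.* ℕ.∣ c ℕ.* a - t ∣ → ℚ.∣ frac a t ℚ.- frac 1 24 ∣ ℚ.< unit E → ⊥
      go a _ (b , refl) p lt = finish 24 b ℕ.∣ 24 ℕ.* a - suc b ∣ refl
        (subst (λ x → suc b ≤ s ℕ.* ℕ.∣ x ℕ.* a - suc b ∣) c≡ p) (close⁻ a b E lt)

  -- Permutations that agree as functions need not be equal as records, so patterns are identified
  -- only pointwise; the densities have to respect this.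
  density-ext : ∀ {n} (σ ρ : Perm 4) (π : Perm n) → (∀ t → σ ⟨$⟩ʳ t ≡ ρ ⟨$⟩ʳ t) → density σ π ≡ density ρ π
  density-ext {n} σ ρ π h = cong (λ x → frac x (n C 4)) (trans (length-filterᵇ _ (subsets n 4)) (trans
    (∑-cong (subsets n 4) (λ v → cong ⟦_⟧ (cong and (map-cong (λ i → cong and (map-cong (λ j →
      cong₂ (λ x y → (toℕ x <ᵇ toℕ y) ==ᵇ (toℕ (π ⟨$⟩ʳ V.lookup v i) <ᵇ toℕ (π ⟨$⟩ʳ V.lookup v j))) (h i) (h j)) (L.allFin 4))) (L.allFin 4)))))
    (sym (length-filterᵇ _ (subsets n 4)))))
    where
    open import Data.List.Properties using (map-cong)
    open import Data.Bool.ListAction using (and)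

  -- Collects the errors in units of `T`: coinciding coordinates of points, the gap between M⁴ and
  -- 24 times the binomial coefficient, and the offsets lost to ties in both coordinates.
  Γ : ℕ
  Γ = c₂₄ ℕ.* c₂₄ ℕ.* 12 ℕ.+ 6 ℕ.+ c₂₄ ℕ.* (d₁₂ ℕ.+ d₁₂)

  nz : ℕ.NonZero c₂₄
  nz = subst ℕ.NonZero (sym c₂₄≡) _

  module Count (n N s M : ℕ) (N≥ : 12 ℕ.+ n ≤ N) (s≥1 : 1 ≤ s) (M≡ : M ≡ N ℕ.* N ℕ.* s) where

    s⁴ N₇ N₈ P T C₄ : ℕ
    s⁴ = s ℕ.* s ℕ.* s ℕ.* s
    N₇ = N ℕ.* N ℕ.* N ℕ.* N ℕ.* (N ℕ.* N ℕ.* N)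
    N₈ = N ℕ.* N ℕ.* N ℕ.* N ℕ.* (N ℕ.* N ℕ.* N ℕ.* N)
    P = N₈ ℕ.* s⁴
    T = s⁴ ℕ.* N₇
    C₄ = M C 4

    N≥12 : 12 ≤ N
    N≥12 = ≤-trans (ℕP.m≤m+n 12 n) N≥

    N≥1 : 1 ≤ N
    N≥1 = ≤-trans (s≤s z≤n) N≥

    N>n : suc n ≤ N
    N>n = ≤-trans (s≤s (ℕP.m≤n+m n 11)) N≥

    M≥N : N ≤ M
    M≥N = subst (N ≤_) (sym M≡) (≤-trans (ℕP.m≤m*n N N ⦃ ℕ.>-nonZero N≥1 ⦄) (≤-trans (≤-reflexive (sym (ℕP.*-identityʳ _))) (ℕP.*-monoʳ-≤ (N ℕ.* N) s≥1)))

    M⁴≡P : M ℕ.* M ℕ.* M ℕ.* M ≡ P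
    M⁴≡P = trans (cong (λ m → m ℕ.* m ℕ.* m ℕ.* m) M≡) (eq N s)
      where
      eq : ∀ a b → a ℕ.* a ℕ.* b ℕ.* (a ℕ.* a ℕ.* b) ℕ.* (a ℕ.* a ℕ.* b) ℕ.* (a ℕ.* a ℕ.* b) ≡
           a ℕ.* a ℕ.* a ℕ.* a ℕ.* (a ℕ.* a ℕ.* a ℕ.* a) ℕ.* (b ℕ.* b ℕ.* b ℕ.* b)
      eq = ℕS.solve-∀

    M³≤T : M ℕ.* M ℕ.* M ≤ T
    M³≤T = ≤-trans (≤-reflexive (cong (λ m → m ℕ.* m ℕ.* m) M≡)) (≤-trans
      (≤-trans (≤-reflexive (sym (ℕP.*-identityʳ _))) (ℕP.*-monoʳ-≤ (N ℕ.* N ℕ.* s ℕ.* (N ℕ.* N ℕ.* s) ℕ.* (N ℕ.* N ℕ.* s)) (ℕP.*-mono-≤ (N≥1) s≥1)))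
      (≤-reflexive (eq N s)))
      where
      eq : ∀ a b → a ℕ.* a ℕ.* b ℕ.* (a ℕ.* a ℕ.* b) ℕ.* (a ℕ.* a ℕ.* b) ℕ.* (a ℕ.* b) ≡
           b ℕ.* b ℕ.* b ℕ.* b ℕ.* (a ℕ.* a ℕ.* a ℕ.* a ℕ.* (a ℕ.* a ℕ.* a))
      eq = ℕS.solve-∀

    NT≡P : N ℕ.* T ≡ P
    NT≡P = eq N s
      where
      eq : ∀ a b → a ℕ.* (b ℕ.* b ℕ.* b ℕ.* b ℕ.* (a ℕ.* a ℕ.* a ℕ.* a ℕ.* (a ℕ.* a ℕ.* a))) ≡
           a ℕ.* a ℕ.* a ℕ.* a ℕ.* (a ℕ.* a ℕ.* a ℕ.* a) ℕ.* (b ℕ.* b ℕ.* b ℕ.* b)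
      eq = ℕS.solve-∀

    C≤P : c₂₄ ℕ.* C₄ ≤ P
    C≤P = subst₂ (λ x y → x ℕ.* C₄ ≤ y) (sym c₂₄≡) M⁴≡P (C4-upper M)

    P≤C : P ≤ c₂₄ ℕ.* C₄ ℕ.+ 6 ℕ.* (M ℕ.* M ℕ.* M)
    P≤C = subst₂ (λ x y → y ≤ x ℕ.* C₄ ℕ.+ 6 ℕ.* (M ℕ.* M ℕ.* M)) (sym c₂₄≡) M⁴≡P (C4-lower M)

    -- Adding two copies of `P≤C` leaves an error 12 M³, which M⁴ absorbs once M is at least 12.
    -- This is the origin of the 12 in the blow-up factor.
    P≤2C : P ≤ 2 ℕ.* (c₂₄ ℕ.* C₄)
    P≤2C = ℕP.+-cancelʳ-≤ P P _ (begin
      P ℕ.+ P                                            ≤⟨ ℕP.+-mono-≤ P≤C P≤C ⟩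
      (X ℕ.+ 6 ℕ.* Y) ℕ.+ (X ℕ.+ 6 ℕ.* Y)                ≡⟨ eq X Y ⟩
      2 ℕ.* X ℕ.+ 12 ℕ.* Y                               ≤⟨ ℕP.+-monoʳ-≤ (2 ℕ.* X) (≤-trans (ℕP.*-monoˡ-≤ Y (≤-trans N≥12 M≥N)) (≤-reflexive (trans (ℕP.*-comm M Y) M⁴≡P))) ⟩
      2 ℕ.* X ℕ.+ P                                      ∎)
      where
      open ℕP.≤-Reasoning
      X = c₂₄ ℕ.* C₄
      Y = M ℕ.* M ℕ.* M
      eq : ∀ x y → (x ℕ.+ 6 ℕ.* y) ℕ.+ (x ℕ.+ 6 ℕ.* y) ≡ 2 ℕ.* x ℕ.+ 12 ℕ.* y
      eq = ℕS.solve-∀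

    P>0 : 1 ≤ P
    P>0 = ℕP.*-mono-≤ (ℕP.*-mono-≤ (power N≥1) (power N≥1)) (power s≥1)
      where
      power : ∀ {a} → 1 ≤ a → 1 ≤ a ℕ.* a ℕ.* a ℕ.* a
      power h = ℕP.*-mono-≤ (ℕP.*-mono-≤ (ℕP.*-mono-≤ h h) h) h

    C>0 : ∃ λ b → C₄ ≡ suc b
    C>0 = go C₄ (≤-trans P>0 P≤2C)
      where
      go : ∀ t → 1 ≤ 2 ℕ.* (c₂₄ ℕ.* t) → ∃ λ b → t ≡ suc b
      go (suc b) _ = b , refl
      go zero h = ⊥-elim (ℕP.<⇒≱ h (≤-reflexive (cong (2 ℕ.*_) (ℕP.*-zeroʳ c₂₄))))

    module Pattern (a φ : ℕ) (lower : N₈ ℕ.* φ ≤ c₂₄ ℕ.* c₂₄ ℕ.* a ℕ.+ c₂₄ ℕ.* (d₁₂ ℕ.+ d₁₂) ℕ.* T)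
      (upper : c₂₄ ℕ.* c₂₄ ℕ.* a ≤ N₈ ℕ.* φ ℕ.+ c₂₄ ℕ.* c₂₄ ℕ.* 12 ℕ.* T) where

      Δ : ℕ
      Δ = ℕ.∣ φ - s⁴ ∣

      above : N₈ ℕ.* φ ≤ c₂₄ ℕ.* (c₂₄ ℕ.* a) ℕ.+ Γ ℕ.* T
      above = ≤-trans lower (ℕP.+-mono-≤ (≤-reflexive (ℕP.*-assoc c₂₄ c₂₄ a))
        (ℕP.*-monoˡ-≤ T (ℕP.m≤n+m (c₂₄ ℕ.* (d₁₂ ℕ.+ d₁₂)) (c₂₄ ℕ.* c₂₄ ℕ.* 12 ℕ.+ 6))))

      below : c₂₄ ℕ.* (c₂₄ ℕ.* a) ℕ.+ 6 ℕ.* T ≤ N₈ ℕ.* φ ℕ.+ Γ ℕ.* T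
      below = ≤-trans (ℕP.+-monoˡ-≤ (6 ℕ.* T) (≤-trans (≤-reflexive (sym (ℕP.*-assoc c₂₄ c₂₄ a))) upper))
        (≤-trans (≤-reflexive (eq (N₈ ℕ.* φ) (c₂₄ ℕ.* c₂₄ ℕ.* 12) T))
          (ℕP.+-monoʳ-≤ (N₈ ℕ.* φ) (ℕP.*-monoˡ-≤ T (ℕP.m≤m+n (c₂₄ ℕ.* c₂₄ ℕ.* 12 ℕ.+ 6) (c₂₄ ℕ.* (d₁₂ ℕ.+ d₁₂))))))
        where
        eq : ∀ x y t → x ℕ.+ y ℕ.* t ℕ.+ 6 ℕ.* t ≡ x ℕ.+ (y ℕ.+ 6) ℕ.* t
        eq = ℕS.solve-∀

      δ : ℕ
      δ = ℕ.∣ c₂₄ ℕ.* a - C₄ ∣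

      cδ : c₂₄ ℕ.* δ ≡ ℕ.∣ c₂₄ ℕ.* (c₂₄ ℕ.* a) - c₂₄ ℕ.* C₄ ∣
      cδ = ℕP.*-distribˡ-∣-∣ c₂₄ (c₂₄ ℕ.* a) C₄

      -- Together with `far-random`: the deviation of the count and the defect Δ of the template
      -- agree up to Γ T. The 6 T on the left of `below` pays for the excess of M⁴ over 24 times the
      -- binomial coefficient.
      near-random : c₂₄ ℕ.* δ ≤ Γ ℕ.* T ℕ.+ N₈ ℕ.* Δ
      near-random = subst (_≤ Γ ℕ.* T ℕ.+ N₈ ℕ.* Δ) (sym cδ) (dist≤ up down)
        where
        open ℕP.≤-Reasoning
        up : c₂₄ ℕ.* (c₂₄ ℕ.* a) ≤ c₂₄ ℕ.* C₄ ℕ.+ (Γ ℕ.* T ℕ.+ N₈ ℕ.* Δ)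
        up = ℕP.+-cancelʳ-≤ (6 ℕ.* T) _ _ (begin
          c₂₄ ℕ.* (c₂₄ ℕ.* a) ℕ.+ 6 ℕ.* T                       ≤⟨ below ⟩
          N₈ ℕ.* φ ℕ.+ Γ ℕ.* T                              ≤⟨ ℕP.+-monoˡ-≤ (Γ ℕ.* T) (≤-trans (ℕP.*-monoʳ-≤ N₈ (ℕP.m≤n+∣m-n∣ (φ) s⁴)) (≤-reflexive (ℕP.*-distribˡ-+ N₈ s⁴ (Δ)))) ⟩
          P ℕ.+ N₈ ℕ.* Δ ℕ.+ Γ ℕ.* T                          ≤⟨ ℕP.+-monoˡ-≤ (Γ ℕ.* T) (ℕP.+-monoˡ-≤ (N₈ ℕ.* Δ) (≤-trans P≤C (ℕP.+-monoʳ-≤ (c₂₄ ℕ.* C₄) (ℕP.*-monoʳ-≤ 6 M³≤T)))) ⟩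
          c₂₄ ℕ.* C₄ ℕ.+ 6 ℕ.* T ℕ.+ N₈ ℕ.* Δ ℕ.+ Γ ℕ.* T     ≡⟨ eq (c₂₄ ℕ.* C₄) (6 ℕ.* T) (N₈ ℕ.* Δ) (Γ ℕ.* T) ⟩
          c₂₄ ℕ.* C₄ ℕ.+ (Γ ℕ.* T ℕ.+ N₈ ℕ.* Δ) ℕ.+ 6 ℕ.* T   ∎)
          where
          eq : ∀ x y z t → x ℕ.+ y ℕ.+ z ℕ.+ t ≡ x ℕ.+ (t ℕ.+ z) ℕ.+ y
          eq = ℕS.solve-∀
        down : c₂₄ ℕ.* C₄ ≤ c₂₄ ℕ.* (c₂₄ ℕ.* a) ℕ.+ (Γ ℕ.* T ℕ.+ N₈ ℕ.* Δ)
        down = begin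
          c₂₄ ℕ.* C₄                                            ≤⟨ C≤P ⟩
          N₈ ℕ.* s⁴                                             ≤⟨ ℕP.*-monoʳ-≤ N₈ (ℕP.m≤n+∣n-m∣ s⁴ (φ)) ⟩
          N₈ ℕ.* (φ ℕ.+ Δ)                                ≡⟨ ℕP.*-distribˡ-+ N₈ (φ) (Δ) ⟩
          N₈ ℕ.* φ ℕ.+ N₈ ℕ.* Δ                           ≤⟨ ℕP.+-monoˡ-≤ (N₈ ℕ.* Δ) above ⟩
          c₂₄ ℕ.* (c₂₄ ℕ.* a) ℕ.+ Γ ℕ.* T ℕ.+ N₈ ℕ.* Δ        ≡⟨ ℕP.+-assoc (c₂₄ ℕ.* (c₂₄ ℕ.* a)) _ _ ⟩
          c₂₄ ℕ.* (c₂₄ ℕ.* a) ℕ.+ (Γ ℕ.* T ℕ.+ N₈ ℕ.* Δ)      ∎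

      far-random : N₈ ℕ.* Δ ≤ c₂₄ ℕ.* δ ℕ.+ Γ ℕ.* T
      far-random with ℕP.≤-total (φ) s⁴
      ... | inj₁ Φ≤ = ℕP.+-cancelˡ-≤ (c₂₄ ℕ.* (c₂₄ ℕ.* a) ℕ.+ 6 ℕ.* T) _ _ (begin
          c₂₄ ℕ.* (c₂₄ ℕ.* a) ℕ.+ 6 ℕ.* T ℕ.+ N₈ ℕ.* Δ        ≤⟨ ℕP.+-monoˡ-≤ (N₈ ℕ.* Δ) below ⟩
          N₈ ℕ.* φ ℕ.+ Γ ℕ.* T ℕ.+ N₈ ℕ.* Δ               ≡⟨ e₁ N₈ (φ) (Δ) (Γ ℕ.* T) ⟩
          N₈ ℕ.* (φ ℕ.+ Δ) ℕ.+ Γ ℕ.* T                    ≡⟨ cong (λ t → N₈ ℕ.* t ℕ.+ Γ ℕ.* T) (trans (cong (φ ℕ.+_) (ℕP.m≤n⇒∣m-n∣≡n∸m Φ≤)) (ℕP.m+[n∸m]≡n Φ≤)) ⟩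
          P ℕ.+ Γ ℕ.* T                                         ≤⟨ ℕP.+-monoˡ-≤ (Γ ℕ.* T) (≤-trans P≤C (ℕP.+-monoʳ-≤ (c₂₄ ℕ.* C₄) (ℕP.*-monoʳ-≤ 6 M³≤T))) ⟩
          c₂₄ ℕ.* C₄ ℕ.+ 6 ℕ.* T ℕ.+ Γ ℕ.* T                    ≤⟨ ℕP.+-monoˡ-≤ (Γ ℕ.* T) (ℕP.+-monoˡ-≤ (6 ℕ.* T)
               (subst (λ t → c₂₄ ℕ.* C₄ ≤ c₂₄ ℕ.* (c₂₄ ℕ.* a) ℕ.+ t) (sym cδ) (ℕP.m≤n+∣n-m∣ (c₂₄ ℕ.* C₄) (c₂₄ ℕ.* (c₂₄ ℕ.* a))))) ⟩
          c₂₄ ℕ.* (c₂₄ ℕ.* a) ℕ.+ c₂₄ ℕ.* δ ℕ.+ 6 ℕ.* T ℕ.+ Γ ℕ.* T  ≡⟨ e₂ (c₂₄ ℕ.* (c₂₄ ℕ.* a)) (c₂₄ ℕ.* δ) (6 ℕ.* T) (Γ ℕ.* T) ⟩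
          c₂₄ ℕ.* (c₂₄ ℕ.* a) ℕ.+ 6 ℕ.* T ℕ.+ (c₂₄ ℕ.* δ ℕ.+ Γ ℕ.* T) ∎)
        where
        open ℕP.≤-Reasoning
        e₁ : ∀ n f d g → n ℕ.* f ℕ.+ g ℕ.+ n ℕ.* d ≡ n ℕ.* (f ℕ.+ d) ℕ.+ g
        e₁ = ℕS.solve-∀
        e₂ : ∀ x y z t → x ℕ.+ y ℕ.+ z ℕ.+ t ≡ x ℕ.+ z ℕ.+ (y ℕ.+ t)
        e₂ = ℕS.solve-∀
      ... | inj₂ ≤Φ = ℕP.+-cancelˡ-≤ (c₂₄ ℕ.* C₄) _ _ (begin
          c₂₄ ℕ.* C₄ ℕ.+ N₈ ℕ.* Δ                             ≤⟨ ℕP.+-monoˡ-≤ (N₈ ℕ.* Δ) C≤P ⟩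
          N₈ ℕ.* s⁴ ℕ.+ N₈ ℕ.* Δ                              ≡⟨ sym (ℕP.*-distribˡ-+ N₈ s⁴ (Δ)) ⟩
          N₈ ℕ.* (s⁴ ℕ.+ Δ)                                   ≡⟨ cong (N₈ ℕ.*_) (trans (cong (s⁴ ℕ.+_) (trans (ℕP.∣-∣-comm (φ) s⁴) (ℕP.m≤n⇒∣m-n∣≡n∸m ≤Φ))) (ℕP.m+[n∸m]≡n ≤Φ)) ⟩
          N₈ ℕ.* φ                                          ≤⟨ above ⟩
          c₂₄ ℕ.* (c₂₄ ℕ.* a) ℕ.+ Γ ℕ.* T                       ≤⟨ ℕP.+-monoˡ-≤ (Γ ℕ.* T)
               (subst (λ t → c₂₄ ℕ.* (c₂₄ ℕ.* a) ≤ c₂₄ ℕ.* C₄ ℕ.+ t) (sym cδ) (ℕP.m≤n+∣m-n∣ (c₂₄ ℕ.* (c₂₄ ℕ.* a)) (c₂₄ ℕ.* C₄))) ⟩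
          c₂₄ ℕ.* C₄ ℕ.+ c₂₄ ℕ.* δ ℕ.+ Γ ℕ.* T                  ≡⟨ ℕP.+-assoc (c₂₄ ℕ.* C₄) _ _ ⟩
          c₂₄ ℕ.* C₄ ℕ.+ (c₂₄ ℕ.* δ ℕ.+ Γ ℕ.* T)                ∎)
        where open ℕP.≤-Reasoning

      -- The error decays because N T is the main term P and N exceeds n; the defect decays by
      -- hypothesis.
      converges : ∀ L → suc n ℕ.* Δ ≤ L ℕ.* s⁴ → suc n ℕ.* δ ≤ (2 ℕ.* (Γ ℕ.+ L)) ℕ.* C₄
      converges L h = ℕP.*-cancelˡ-≤ c₂₄ ⦃ nz ⦄ (begin
        c₂₄ ℕ.* (suc n ℕ.* δ)                          ≡⟨ e₁ c₂₄ (suc n) δ ⟩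
        suc n ℕ.* (c₂₄ ℕ.* δ)                          ≤⟨ ℕP.*-monoʳ-≤ (suc n) near-random ⟩
        suc n ℕ.* (Γ ℕ.* T ℕ.+ N₈ ℕ.* Δ)        ≡⟨ e₂ (suc n) Γ T N₈ (Δ) ⟩
        Γ ℕ.* (suc n ℕ.* T) ℕ.+ N₈ ℕ.* (suc n ℕ.* Δ) ≤⟨ ℕP.+-mono-≤ (ℕP.*-monoʳ-≤ Γ (≤-trans (ℕP.*-monoˡ-≤ T N>n) (≤-reflexive NT≡P)))
                                                                (ℕP.*-monoʳ-≤ N₈ h) ⟩
        Γ ℕ.* P ℕ.+ N₈ ℕ.* (L ℕ.* s⁴)                  ≡⟨ e₃ Γ N₈ L s⁴ ⟩
        (Γ ℕ.+ L) ℕ.* P                                ≤⟨ ℕP.*-monoʳ-≤ (Γ ℕ.+ L) P≤2C ⟩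
        (Γ ℕ.+ L) ℕ.* (2 ℕ.* (c₂₄ ℕ.* C₄))             ≡⟨ e₄ (Γ ℕ.+ L) c₂₄ C₄ ⟩
        c₂₄ ℕ.* ((2 ℕ.* (Γ ℕ.+ L)) ℕ.* C₄)             ∎)
        where
        open ℕP.≤-Reasoning
        e₁ : ∀ c n d → c ℕ.* (n ℕ.* d) ≡ n ℕ.* (c ℕ.* d)
        e₁ = ℕS.solve-∀
        e₂ : ∀ n g t m d → n ℕ.* (g ℕ.* t ℕ.+ m ℕ.* d) ≡ g ℕ.* (n ℕ.* t) ℕ.+ m ℕ.* (n ℕ.* d)
        e₂ = ℕS.solve-∀
        e₃ : ∀ g n l s → g ℕ.* (n ℕ.* s) ℕ.+ n ℕ.* (l ℕ.* s) ≡ (g ℕ.+ l) ℕ.* (n ℕ.* s)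
        e₃ = ℕS.solve-∀
        e₄ : ∀ x c d → x ℕ.* (2 ℕ.* (c ℕ.* d)) ≡ c ℕ.* ((2 ℕ.* x) ℕ.* d)
        e₄ = ℕS.solve-∀

      -- The defect is at least the fraction 1 / S⁴ of the main term, and from n = 2 S⁴ Γ on the
      -- error takes away at most half of that.
      diverges : ∀ S⁴ → 2 ℕ.* (S⁴ ℕ.* Γ) ≤ n → s⁴ ≤ S⁴ ℕ.* Δ → C₄ ≤ (2 ℕ.* S⁴) ℕ.* δ
      diverges S⁴ big h = ℕP.*-cancelˡ-≤ c₂₄ ⦃ nz ⦄ (≤-trans C≤P (ℕP.+-cancelʳ-≤ P P _ (begin
        P ℕ.+ P                                                ≡⟨ e₁ N₈ s⁴ ⟩
        2 ℕ.* (N₈ ℕ.* s⁴)                                      ≤⟨ ℕP.*-monoʳ-≤ 2 (ℕP.*-monoʳ-≤ N₈ h) ⟩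
        2 ℕ.* (N₈ ℕ.* (S⁴ ℕ.* Δ))                            ≡⟨ e₂ N₈ S⁴ (Δ) ⟩
        2 ℕ.* S⁴ ℕ.* (N₈ ℕ.* Δ)                              ≤⟨ ℕP.*-monoʳ-≤ (2 ℕ.* S⁴) far-random ⟩
        2 ℕ.* S⁴ ℕ.* (c₂₄ ℕ.* δ ℕ.+ Γ ℕ.* T)                   ≡⟨ e₃ S⁴ c₂₄ δ Γ T ⟩
        c₂₄ ℕ.* (2 ℕ.* S⁴ ℕ.* δ) ℕ.+ 2 ℕ.* (S⁴ ℕ.* Γ) ℕ.* T    ≤⟨ ℕP.+-monoʳ-≤ _ (≤-trans (ℕP.*-monoˡ-≤ T (≤-trans big (ℕP.<⇒≤ N>n))) (≤-reflexive NT≡P)) ⟩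
        c₂₄ ℕ.* (2 ℕ.* S⁴ ℕ.* δ) ℕ.+ P                         ∎)))
        where
        open ℕP.≤-Reasoning
        e₁ : ∀ n s → n ℕ.* s ℕ.+ n ℕ.* s ≡ 2 ℕ.* (n ℕ.* s)
        e₁ = ℕS.solve-∀
        e₂ : ∀ n s d → 2 ℕ.* (n ℕ.* (s ℕ.* d)) ≡ 2 ℕ.* s ℕ.* (n ℕ.* d)
        e₂ = ℕS.solve-∀
        e₃ : ∀ s c d g t → 2 ℕ.* s ℕ.* (c ℕ.* d ℕ.+ g ℕ.* t) ≡ c ℕ.* (2 ℕ.* s ℕ.* d) ℕ.+ 2 ℕ.* (s ℕ.* g) ℕ.* t
        e₃ = ℕS.solve-∀

  module Refute {A : Set} (row col : A → ℕ) (c₀ : A) (cs₀ : List A) {r : ℕ}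
    (σs : Fin r → Perm 4) (τ : Perm 4) (z e : A → ℤ) (d : Fin r → A → ℤ) (K L S η : ℕ) (K≥ : 576 ≤ K) where

    cs : List A
    cs = c₀ ∷ cs₀

    module Tm = Template row col cs
    open Tm using (κ; Φ)
    open Forms cs using (‖_‖)

    -- Lowering every coefficient by 1 subtracts s⁴ from Φ, so the equation Φ = s⁴ becomes the
    -- vanishing of a single form.
    coeff : Perm 4 → A → A → A → A → ℤ
    coeff σ x y u v = + κ σ (x ∷ y ∷ u ∷ v ∷ []) ℤ.- 1ℤ

    coeff≤K : ∀ σ x y u v → ∣ coeff σ x y u v ∣ ≤ K
    coeff≤K σ x y u v = ≤-trans (go (κ σ (x ∷ y ∷ u ∷ v ∷ []))) (≤-trans (ℕP.⊔-lub (ℕP.*-mono-≤ (kw≤24 (V.map row (x ∷ y ∷ u ∷ v ∷ []))) (kw≤24 (reindex (V.map col (x ∷ y ∷ u ∷ v ∷ [])) (σ ⟨$⟩ˡ_)))) (s≤s z≤n)) K≥)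
      where
      go : ∀ n → ∣ + n ℤ.- 1ℤ ∣ ≤ n ℕ.⊔ 1
      go zero = ≤-refl
      go (suc n) = ≤-trans (ℕP.n≤1+n n) (ℕP.m≤m⊔n (suc n) 1)

    module Fm (σ : Perm 4) = Forms.Form cs (coeff σ) K (coeff≤K σ)
    module N = Newton cs K (λ i → coeff (σs i)) (λ i → coeff≤K (σs i)) z e d L S η

    module _ (η-ok : ‖ e ‖ ℕ.+ ∑ (fins r) (λ j → ‖ d j ‖) ≤ η) (S-ok : ‖ z ‖ ℕ.+ η ≤ S) (L>0 : 1 ≤ L)
      (start : ∀ i → 2 ℕ.* (∣ Fm.F (σs i) z ℤ.+ Fm.D (σs i) z e ∣ ℕ.+ N.E) ≤ L)
      (jacobian : ∀ i → 2 ℕ.* (∑ (fins r) (λ j → ∣ Fm.D (σs i) z (d j) ℤ.- + L ℤ.* kron i j ∣) ℕ.+ N.E) ≤ L)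
      (far : 1 ℕ.+ ∑ (fins r) (λ j → ∣ Fm.D τ z (d j) ∣) ℕ.+ N.E ≤ ∣ Fm.F τ z ℤ.+ Fm.D τ z e ∣)
      (positive : All (λ c → + suc (∑ (fins r) (λ j → ∣ d j c ∣)) ℤ.≤ z c ℤ.+ e c) cs)
      where

      module At (n : ℕ) where
        open N.State (N.states η-ok S-ok L>0 start jacobian n) public

        W : A → ℤ
        W = N.W q u

        w : A → ℕ
        w c = ∣ W c ∣

        -- `positive` leaves room for the largest correction the directions can make, and 1 more.
        -- Hence the iterates have positive entries and are genuine weights.
        W≥q : All (λ c → + q ℤ.≤ W c) cs
        W≥q = All.map (λ {c} → go c) positive
          where
          go : ∀ c → + suc (∑ (fins r) (λ j → ∣ d j c ∣)) ℤ.≤ z c ℤ.+ e c → + q ℤ.≤ W c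
          go c h = begin
            + q                                                      ≡⟨ lemma (+ q) (+ b) ⟩
            + q ℤ.* (1ℤ ℤ.+ + b) ℤ.+ ℤ.- (+ q ℤ.* + b)               ≤⟨ ℤP.+-mono-≤ (ℤP.*-monoˡ-≤-nonNeg (+ q) h) low ⟩
            W c                                                      ∎
            where
            open ℤP.≤-Reasoning
            b = ∑ (fins r) (λ j → ∣ d j c ∣)
            Y = ∑ᶻ (fins r) (λ j → u j ℤ.* d j c)
            lemma : ∀ q b → q ≡ q ℤ.* (1ℤ ℤ.+ b) ℤ.+ ℤ.- (q ℤ.* b)
            lemma = solve-∀
            Y≤ : ∣ Y ∣ ≤ q ℕ.* b
            Y≤ = subst (_≤ q ℕ.* b) (ℕP.*-identityˡ ∣ Y ∣)
                   (∣∑*∣ (fins r) u (λ j → d j c) 1 q (λ j → subst (_≤ q) (sym (ℕP.*-identityˡ _)) (u≤q j)))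
            -∣i∣≤i : ∀ i → ℤ.- + ∣ i ∣ ℤ.≤ i
            -∣i∣≤i (+ zero) = +≤+ z≤n
            -∣i∣≤i (+ suc n) = ℤ.-≤+
            -∣i∣≤i -[1+ n ] = ℤP.≤-refl
            low : ℤ.- (+ q ℤ.* + b) ℤ.≤ Y
            low = ℤP.≤-trans (ℤP.neg-mono-≤ (subst (+ ∣ Y ∣ ℤ.≤_) (ℤP.pos-* q b) (+≤+ Y≤))) (-∣i∣≤i Y)

        W≡w : All (λ c → W c ≡ + w c) cs
        W≡w = All.map (λ h → sym (ℤP.0≤i⇒+∣i∣≡i (ℤP.≤-trans (+≤+ z≤n) h))) W≥q

        s : ℕ
        s = ∑ cs w

        -- With `s≤qS`, this translates between the scale q⁴ of the iteration and the scale s⁴ of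
        -- the densities.
        s≥q : q ≤ s
        s≥q = ≤-trans (ℤP.drop‿+≤+ (subst (+ q ℤ.≤_) (All.head W≡w) (All.head W≥q))) (ℕP.m≤m+n (w c₀) _)

        s≤qS : s ≤ q ℕ.* S
        s≤qS = N.total η-ok S-ok q u u≤q

        s⁴ : ℕ
        s⁴ = s ℕ.* s ℕ.* s ℕ.* s

        form : ∀ σ → Fm.F σ W ≡ + Φ σ w ℤ.- + s⁴
        form σ = begin
          Fm.F σ W
            ≡⟨ Fm.M-def σ W W W W ⟩
          ∑⁴ (λ x y u v → coeff σ x y u v ℤ.* (W x ℤ.* (W y ℤ.* (W u ℤ.* W v))))
            ≡⟨ (∑ᶻ-congᴬ W≡w λ x px → ∑ᶻ-congᴬ W≡w λ y py → ∑ᶻ-congᴬ W≡w λ u pu → ∑ᶻ-congᴬ W≡w λ v pv →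
                 trans (cong₂ (λ a b → coeff σ x y u v ℤ.* (a ℤ.* b)) px (cong₂ ℤ._*_ py (cong₂ ℤ._*_ pu pv)))
                 (trans (cong (coeff σ x y u v ℤ.*_) (pos₄ x y u v)) (lemma (+ κ σ (x ∷ y ∷ u ∷ v ∷ [])) (+ ∏ w (x ∷ y ∷ u ∷ v ∷ []))))) ⟩
          ∑⁴ (λ x y u v → ℤ.- 1ℤ ℤ.* + ∏ w (x ∷ y ∷ u ∷ v ∷ []) ℤ.+ + ∏ w (x ∷ y ∷ u ∷ v ∷ []) ℤ.* + κ σ (x ∷ y ∷ u ∷ v ∷ []))
            ≡⟨ ∑⁴-lin (ℤ.- 1ℤ) (λ x y u v → + ∏ w (x ∷ y ∷ u ∷ v ∷ [])) (λ x y u v → + ∏ w (x ∷ y ∷ u ∷ v ∷ []) ℤ.* + κ σ (x ∷ y ∷ u ∷ v ∷ [])) ⟩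
          ℤ.- 1ℤ ℤ.* ∑⁴ (λ x y u v → + ∏ w (x ∷ y ∷ u ∷ v ∷ [])) ℤ.+ ∑⁴ (λ x y u v → + ∏ w (x ∷ y ∷ u ∷ v ∷ []) ℤ.* + κ σ (x ∷ y ∷ u ∷ v ∷ []))
            ≡⟨ cong₂ (λ a b → ℤ.- 1ℤ ℤ.* a ℤ.+ b) (trans (pos-∑ (∏ w)) (cong +_ (trans (∑ⁿ-∏ 4 cs w) (pow s))))
                 (trans (∑⁴-cong λ x y u v → sym (ℤP.pos-* (∏ w (x ∷ y ∷ u ∷ v ∷ [])) (κ σ (x ∷ y ∷ u ∷ v ∷ [])))) (pos-∑ (λ t → ∏ w t ℕ.* κ σ t))) ⟩
          ℤ.- 1ℤ ℤ.* + s⁴ ℤ.+ + Φ σ w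
            ≡⟨ flip (+ s⁴) (+ Φ σ w) ⟩
          + Φ σ w ℤ.- + s⁴ ∎
          where
          open ≡-Reasoning
          open Forms cs using (∑⁴; ∑⁴-lin; ∑⁴-cong)
          lemma : ∀ k p → (k ℤ.- 1ℤ) ℤ.* p ≡ ℤ.- 1ℤ ℤ.* p ℤ.+ p ℤ.* k
          lemma = solve-∀
          flip : ∀ a b → ℤ.- 1ℤ ℤ.* a ℤ.+ b ≡ b ℤ.- a
          flip = solve-∀
          pow : ∀ s → s ℕ.* (s ℕ.* (s ℕ.* (s ℕ.* 1))) ≡ s ℕ.* s ℕ.* s ℕ.* s
          pow = ℕS.solve-∀
          pos₄ : ∀ x y u v → + w x ℤ.* (+ w y ℤ.* (+ w u ℤ.* + w v)) ≡ + ∏ w (x ∷ y ∷ u ∷ v ∷ [])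
          pos₄ x y u v = sym (trans (ℤP.pos-* (w x) _) (cong (+ w x ℤ.*_) (trans (ℤP.pos-* (w y) _) (cong (+ w y ℤ.*_)
            (trans (ℤP.pos-* (w u) _) (cong (λ t → + w u ℤ.* + t) (ℕP.*-identityʳ (w v))))))))
          pos-∑ : ∀ f → ∑⁴ (λ x y u v → + f (x ∷ y ∷ u ∷ v ∷ [])) ≡ + ∑ⁿ 4 cs f
          pos-∑ f = trans (∑ᶻ-cong cs λ x → trans (∑ᶻ-cong cs λ y → trans (∑ᶻ-cong cs λ u → ∑ᶻ-pos cs _) (∑ᶻ-pos cs _)) (∑ᶻ-pos cs _)) (∑ᶻ-pos cs _)

        Δ : Perm 4 → ℕ
        Δ σ = ℕ.∣ Φ σ w - s⁴ ∣

        Δ≡ : ∀ σ → ∣ Fm.F σ W ∣ ≡ Δ σ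
        Δ≡ σ = trans (cong ∣_∣ (form σ)) (∣⊖∣ (Φ σ w) s⁴)

        q⁴≤s⁴ : q ℕ.* q ℕ.* q ℕ.* q ≤ s⁴
        q⁴≤s⁴ = ℕP.*-mono-≤ (ℕP.*-mono-≤ (ℕP.*-mono-≤ s≥q s≥q) s≥q) s≥q

        n<2ⁿ : ∀ n → suc n ≤ 2 ^ suc n
        n<2ⁿ zero = s≤s z≤n
        n<2ⁿ (suc n) = ≤-trans (s≤s (n<2ⁿ n)) (≤-trans (ℕP.+-monoˡ-≤ (2 ^ suc n) (ℕP.m^n>0 2 (suc n)))
          (≤-reflexive (cong (2 ^ suc n ℕ.+_) (sym (ℕP.+-identityʳ (2 ^ suc n))))))

        Δ-small : ∀ i → suc n ℕ.* Δ (σs i) ≤ L ℕ.* s⁴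
        Δ-small i = ≤-trans (ℕP.*-monoˡ-≤ (Δ (σs i)) (n<2ⁿ n)) (≤-trans
          (subst (λ t → 2 ^ suc n ℕ.* t ≤ L ℕ.* (q ℕ.* q ℕ.* q ℕ.* q)) (Δ≡ (σs i)) (F≤ i)) (ℕP.*-monoʳ-≤ L q⁴≤s⁴))

        Δ-large : s⁴ ≤ S ℕ.* S ℕ.* S ℕ.* S ℕ.* Δ τ
        Δ-large = begin
          s⁴                                                                   ≤⟨ ℕP.*-mono-≤ (ℕP.*-mono-≤ (ℕP.*-mono-≤ s≤qS s≤qS) s≤qS) s≤qS ⟩
          q ℕ.* S ℕ.* (q ℕ.* S) ℕ.* (q ℕ.* S) ℕ.* (q ℕ.* S)                    ≡⟨ e₁ q S ⟩
          S ℕ.* S ℕ.* S ℕ.* S ℕ.* (q ℕ.* q ℕ.* q ℕ.* q)                        ≤⟨ ℕP.*-monoʳ-≤ (S ℕ.* S ℕ.* S ℕ.* S) (≤-trans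
               (N.Value.away η-ok S-ok (coeff τ) (coeff≤K τ) far q u u≤q) (≤-reflexive (Δ≡ τ))) ⟩
          S ℕ.* S ℕ.* S ℕ.* S ℕ.* Δ τ ∎
          where
          open ℕP.≤-Reasoning
          e₁ : ∀ q s → q ℕ.* s ℕ.* (q ℕ.* s) ℕ.* (q ℕ.* s) ℕ.* (q ℕ.* s) ≡ s ℕ.* s ℕ.* s ℕ.* s ℕ.* (q ℕ.* q ℕ.* q ℕ.* q)
          e₁ = ℕS.solve-∀

        s≥1 : 1 ≤ s
        s≥1 = ≤-trans q>0 s≥q

      abstract
        N : ℕ → ℕ
        N n = 12 ℕ.+ n

        N≥ : ∀ n → 12 ℕ.+ n ≤ N n
        N≥ n = ≤-refl

      -- The diagonal choice: iterate n is blown up by `N n`, so the defect of the template and the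
      -- error of the blow-up vanish along one sequence.
      M : ℕ → ℕ
      M n = Ranking.card (ranking (Tm.points (At.w n) (N n)))

      π : ∀ n → Perm (M n)
      π n = Tm.π (At.w n) (N n)

      module Ct (n : ℕ) = Count n (N n) (At.s n) (M n) (N≥ n) (At.s≥1 n) (Tm.card-points (At.w n) (N n))
      module Pt (n : ℕ) (σ : Perm 4) = Ct.Pattern n (count σ (π n)) (Φ σ (At.w n)) (Tm.count-above (At.w n) (N n) σ) (Tm.count-below (At.w n) (N n) σ)

      S⁴ : ℕ
      S⁴ = S ℕ.* S ℕ.* S ℕ.* S

      open Limits M π c₂₄ c₂₄≡ (λ n → ≤-trans (ℕP.<⇒≤ (Ct.N>n n)) (Ct.M≥N n)) Ct.C>0

      refute : (T : List (Perm 4)) → (∀ σ → σ ∈ T → ∃ λ i → ∀ t → σ ⟨$⟩ʳ t ≡ σs i ⟨$⟩ʳ t) → ¬ QuasirandomForcing T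
      refute T cover forcing = not-tends τ (2 ℕ.* S⁴) (2 ℕ.* (S⁴ ℕ.* Γ)) (λ n big → Pt.diverges n τ S⁴ big (At.Δ-large n))
        (forcing sequence sizes (λ σ σ∈T → go σ (cover σ σ∈T)) 4 τ)
        where
        near : ∀ i → DensityTendsToRandom sequence (σs i)
        near i = tends (σs i) (2 ℕ.* (Γ ℕ.+ L)) (λ n → Pt.converges n (σs i) L (At.Δ-small n i))
        go : ∀ σ → (∃ λ i → ∀ t → σ ⟨$⟩ʳ t ≡ σs i ⟨$⟩ʳ t) → DensityTendsToRandom sequence σ
        go σ (i , h) ε 0<ε = proj₁ (near i ε 0<ε) , λ n big →
          subst (λ x → ℚ.∣ x ℚ.- frac 1 24 ∣ ℚ.< ε) (sym (density-ext σ (σs i) (π n) h)) (proj₂ (near i ε 0<ε) n big)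

-- Values and derivatives of the density forms as dot products

module Gradients where

  open Sums
  open Ties
  open Templates
  open QuadrilinearForms
  open Iteration
  open Refutation
  open import Data.Bool using (Bool; true; false)
  open import Data.Fin as F using (suc)
  open import Data.Fin.Patterns
  open import Data.Integer as ℤ using (ℤ; +_; ∣_∣; 0ℤ; 1ℤ)
  import Data.Integer.Properties as ℤP
  open import Data.Integer.Tactic.RingSolver using (solve-∀)
  open import Data.List using (List; []; _∷_; filterᵇ)
  open import Data.List.Relation.Unary.All using ([]; _∷_)
  open import Data.Nat as ℕ using (ℕ; suc; _≤_)
  import Data.Nat.Properties as ℕP
  open import Data.Vec using (Vec; []; _∷_; lookup; toList)
  open import Relation.Binary.PropositionalEquality

  private variable
    A : Set

  ∑-lookup : ∀ {n} (v : Vec A n) (f : A → ℕ) → ∑ (fins n) (λ i → f (lookup v i)) ≡ ∑ (toList v) f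
  ∑-lookup [] f = refl
  ∑-lookup (x ∷ v) f = cong (f x ℕ.+_) (trans (∑-map F.suc (fins _) (λ i → f (lookup (x ∷ v) i))) (∑-lookup v f))

  dot : ∀ {n} → Vec ℤ n → Vec ℤ n → ℤ
  dot [] [] = 0ℤ
  dot (x ∷ u) (y ∷ v) = x ℤ.* y ℤ.+ dot u v

  ∑ᶻ-dot : ∀ {n} (u v : Vec ℤ n) → ∑ᶻ (fins n) (λ i → lookup u i ℤ.* lookup v i) ≡ dot u v
  ∑ᶻ-dot [] [] = refl
  ∑ᶻ-dot (x ∷ u) (y ∷ v) = cong (λ t → x ℤ.* y ℤ.+ t) (trans (∑ᶻ-map F.suc (fins _) (λ i → lookup (x ∷ u) i ℤ.* lookup (y ∷ v) i)) (∑ᶻ-dot u v))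

  ∑-zero : (xs : List A) {f : A → ℕ} → (∀ x → f x ≡ 0) → ∑ xs f ≡ 0
  ∑-zero xs h = trans (∑-cong xs h) (∑-0 xs)

  ∑-filter : (p : A → Bool) (xs : List A) {f : A → ℕ} → (∀ x → p x ≡ false → f x ≡ 0) → ∑ (filterᵇ p xs) f ≡ ∑ xs f
  ∑-filter p [] h = refl
  ∑-filter p (x ∷ xs) {f} h with p x in eq
  ... | true = cong (f x ℕ.+_) (∑-filter p xs h)
  ... | false = trans (∑-filter p xs h) (sym (cong (ℕ._+ ∑ xs f) (h x eq)))

  -- The type checker evaluates these sums, so candidates are discarded before the inner loops. The
  -- relations are conditions on pairs of slots without which the coefficient vanishes.
  module Pruned {A : Set} (w : A → ℕ) (cs : List A) (R₁₂ R₁₃ R₁₄ R₂₃ R₂₄ R₃₄ : A → A → Bool)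
    (k : A → A → A → A → ℕ) where

    full₃ : A → A → A → ℕ
    full₃ x y u = ∑ cs λ v → w v ℕ.* k x y u v

    full₂ : A → A → ℕ
    full₂ x y = ∑ cs λ u → w u ℕ.* full₃ x y u

    full : A → ℕ
    full x = ∑ cs λ y → w y ℕ.* full₂ x y

    go₃ : A → A → A → List A → ℕ
    go₃ x y u vs = ∑ (filterᵇ (R₃₄ u) vs) λ v → w v ℕ.* k x y u v

    go₂ : A → A → List A → List A → ℕ
    go₂ x y us vs = ∑ us λ u → w u ℕ.* go₃ x y u vs

    go₁ : A → List A → List A → List A → ℕ
    go₁ x ys us vs = ∑ ys λ y → w y ℕ.* go₂ x y (filterᵇ (R₂₃ y) us) (filterᵇ (R₂₄ y) vs)

    pruned : A → ℕ
    pruned x = go₁ x (filterᵇ (R₁₂ x) cs) (filterᵇ (R₁₃ x) cs) (filterᵇ (R₁₄ x) cs)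

    module _
      (h₁₂ : ∀ x y u v → R₁₂ x y ≡ false → k x y u v ≡ 0) (h₁₃ : ∀ x y u v → R₁₃ x u ≡ false → k x y u v ≡ 0)
      (h₁₄ : ∀ x y u v → R₁₄ x v ≡ false → k x y u v ≡ 0) (h₂₃ : ∀ x y u v → R₂₃ y u ≡ false → k x y u v ≡ 0)
      (h₂₄ : ∀ x y u v → R₂₄ y v ≡ false → k x y u v ≡ 0) (h₃₄ : ∀ x y u v → R₃₄ u v ≡ false → k x y u v ≡ 0)
      where

      private
        times0 : ∀ a {b} → b ≡ 0 → a ℕ.* b ≡ 0
        times0 a refl = ℕP.*-zeroʳ a

      prune₃ : ∀ x y u → go₃ x y u (filterᵇ (R₂₄ y) (filterᵇ (R₁₄ x) cs)) ≡ full₃ x y u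
      prune₃ x y u = trans (∑-filter (R₃₄ u) (filterᵇ (R₂₄ y) (filterᵇ (R₁₄ x) cs)) λ v r → times0 (w v) (h₃₄ x y u v r))
        (trans (∑-filter (R₂₄ y) (filterᵇ (R₁₄ x) cs) λ v r → times0 (w v) (h₂₄ x y u v r))
          (∑-filter (R₁₄ x) cs λ v r → times0 (w v) (h₁₄ x y u v r)))

      prune₂ : ∀ x y → go₂ x y (filterᵇ (R₂₃ y) (filterᵇ (R₁₃ x) cs)) (filterᵇ (R₂₄ y) (filterᵇ (R₁₄ x) cs)) ≡ full₂ x y
      prune₂ x y = trans (∑-cong (filterᵇ (R₂₃ y) (filterᵇ (R₁₃ x) cs)) λ u → cong (w u ℕ.*_) (prune₃ x y u))
        (trans (∑-filter (R₂₃ y) (filterᵇ (R₁₃ x) cs) λ u r → times0 (w u) (∑-zero cs λ v → times0 (w v) (h₂₃ x y u v r)))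
          (∑-filter (R₁₃ x) cs λ u r → times0 (w u) (∑-zero cs λ v → times0 (w v) (h₁₃ x y u v r))))

      pruned≡full : ∀ x → pruned x ≡ full x
      pruned≡full x = trans (∑-cong (filterᵇ (R₁₂ x) cs) λ y → cong (w y ℕ.*_) (prune₂ x y))
        (∑-filter (R₁₂ x) cs λ y r → times0 (w y) (∑-zero cs λ u → times0 (w u) (∑-zero cs λ v → times0 (w v) (h₁₂ x y u v r))))

  full : {A : Set} (w : A → ℕ) (cs : List A) (k : A → A → A → A → ℕ) → A → ℕ
  full w cs k x = ∑ cs λ y → w y ℕ.* ∑ cs λ u → w u ℕ.* ∑ cs λ v → w v ℕ.* k x y u v

  ∑ᶻ-+ : (xs : List A) (f g : A → ℤ) → ∑ᶻ xs (λ x → f x ℤ.+ g x) ≡ ∑ᶻ xs f ℤ.+ ∑ᶻ xs g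
  ∑ᶻ-+ xs f g = trans (∑ᶻ-cong xs λ x → cong (λ t → t ℤ.+ g x) (sym (ℤP.*-identityˡ (f x))))
    (trans (∑ᶻ-lin xs 1ℤ f g) (cong (λ t → t ℤ.+ ∑ᶻ xs g) (ℤP.*-identityˡ (∑ᶻ xs f))))

  ∑ᶻ-swap : {B : Set} (xs : List A) (ys : List B) (f : A → B → ℤ) →
            ∑ᶻ xs (λ x → ∑ᶻ ys (f x)) ≡ ∑ᶻ ys (λ y → ∑ᶻ xs (λ x → f x y))
  ∑ᶻ-swap [] ys f = sym (∑ᶻ-0 ys)
  ∑ᶻ-swap (x ∷ xs) ys f = trans (cong (λ t → ∑ᶻ ys (f x) ℤ.+ t) (∑ᶻ-swap xs ys f)) (sym (∑ᶻ-+ ys (f x) _))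

  ∑ᶻ-diff : (xs : List A) (a : ℤ) (f g : A → ℕ) →
            ∑ᶻ xs (λ x → a ℤ.* (+ f x ℤ.- + g x)) ≡ a ℤ.* (+ ∑ xs f ℤ.- + ∑ xs g)
  ∑ᶻ-diff xs a f g = trans (∑ᶻ-*ˡ xs a _) (cong (a ℤ.*_) (begin
    ∑ᶻ xs (λ x → + f x ℤ.- + g x)                      ≡⟨ ∑ᶻ-cong xs (λ x → e₁ (+ f x) (+ g x)) ⟩
    ∑ᶻ xs (λ x → ℤ.- 1ℤ ℤ.* + g x ℤ.+ + f x)           ≡⟨ ∑ᶻ-lin xs (ℤ.- 1ℤ) (λ x → + g x) (λ x → + f x) ⟩
    ℤ.- 1ℤ ℤ.* ∑ᶻ xs (λ x → + g x) ℤ.+ ∑ᶻ xs (λ x → + f x)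
      ≡⟨ cong₂ (λ s t → ℤ.- 1ℤ ℤ.* s ℤ.+ t) (∑ᶻ-pos xs g) (∑ᶻ-pos xs f) ⟩
    ℤ.- 1ℤ ℤ.* + ∑ xs g ℤ.+ + ∑ xs f                   ≡⟨ sym (e₁ (+ ∑ xs f) (+ ∑ xs g)) ⟩
    + ∑ xs f ℤ.- + ∑ xs g ∎))
    where
    open ≡-Reasoning
    e₁ : ∀ a b → a ℤ.- b ≡ ℤ.- 1ℤ ℤ.* b ℤ.+ a
    e₁ = solve-∀

  module Partials {A : Set} (cs : List A) (w : A → ℕ) where
    open Forms cs

    s : ℕ
    s = ∑ cs w

    z : A → ℤ
    z x = + w x

    -- With the cell in the slot of δ fixed, the other three sums do not involve δ: the coefficients
    -- k give `full`, and the -1 gives the cube of the total weight.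
    slice : (k : A → A → A → A → ℕ) (δ : A → ℤ) →
      ∑⁴ (λ x y u v → (+ k x y u v ℤ.- 1ℤ) ℤ.* (δ x ℤ.* (z y ℤ.* (z u ℤ.* z v)))) ≡
      ∑ᶻ cs (λ x → δ x ℤ.* (+ full w cs k x ℤ.- + (s ℕ.* (s ℕ.* s))))
    slice k δ = ∑ᶻ-cong cs λ x → trans (∑ᶻ-cong cs λ y → trans (∑ᶻ-cong cs λ u →
        trans (∑ᶻ-cong cs λ v → point x y u v) (trans (∑ᶻ-diff cs (δ x) (λ v → w y ℕ.* (w u ℕ.* (w v ℕ.* k x y u v))) (λ v → w y ℕ.* (w u ℕ.* w v)))
          (out (δ x) (trans (∑-*ˡ (w y) cs _) (cong (w y ℕ.*_) (∑-*ˡ (w u) cs _))) (trans (∑-*ˡ (w y) cs _) (cong (w y ℕ.*_) (∑-*ˡ (w u) cs _))))))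
        (trans (∑ᶻ-diff cs (δ x) (λ u → w y ℕ.* (w u ℕ.* ∑ cs (λ v → w v ℕ.* k x y u v))) (λ u → w y ℕ.* (w u ℕ.* s)))
          (out (δ x) (∑-*ˡ (w y) cs _) (trans (∑-*ˡ (w y) cs _) (cong (w y ℕ.*_) (times s))))))
      (trans (∑ᶻ-diff cs (δ x) (λ y → w y ℕ.* ∑ cs (λ u → w u ℕ.* ∑ cs (λ v → w v ℕ.* k x y u v))) (λ y → w y ℕ.* (s ℕ.* s)))
        (out (δ x) refl (times (s ℕ.* s))))
      where
      times : ∀ m → ∑ cs (λ x → w x ℕ.* m) ≡ s ℕ.* m
      times m = trans (∑-cong cs λ x → ℕP.*-comm (w x) m) (trans (∑-*ˡ m cs w) (ℕP.*-comm m s))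
      out : ∀ a {p p′ q q′} → p ≡ p′ → q ≡ q′ → a ℤ.* (+ p ℤ.- + q) ≡ a ℤ.* (+ p′ ℤ.- + q′)
      out a refl refl = refl
      ring : ∀ k d a b c → (k ℤ.- 1ℤ) ℤ.* (d ℤ.* (a ℤ.* (b ℤ.* c))) ≡ d ℤ.* (a ℤ.* (b ℤ.* (c ℤ.* k)) ℤ.- a ℤ.* (b ℤ.* c))
      ring = solve-∀
      point : ∀ x y u v → (+ k x y u v ℤ.- 1ℤ) ℤ.* (δ x ℤ.* (z y ℤ.* (z u ℤ.* z v))) ≡
        δ x ℤ.* (+ (w y ℕ.* (w u ℕ.* (w v ℕ.* k x y u v))) ℤ.- + (w y ℕ.* (w u ℕ.* w v)))
      point x y u v = trans (ring (+ k x y u v) (δ x) (z y) (z u) (z v)) (cong₂ (λ a b → δ x ℤ.* (a ℤ.- b))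
        (sym (trans (ℤP.pos-* (w y) _) (cong (z y ℤ.*_) (trans (ℤP.pos-* (w u) _) (cong (z u ℤ.*_) (ℤP.pos-* (w v) _))))))
        (sym (trans (ℤP.pos-* (w y) _) (cong (z y ℤ.*_) (ℤP.pos-* (w u) _)))))

    module _ (k : A → A → A → A → ℕ) (K : ℕ) (k≤K : ∀ x y u v → ∣ + k x y u v ℤ.- 1ℤ ∣ ≤ K) where
      open Form (λ x y u v → + k x y u v ℤ.- 1ℤ) K k≤K

      s³ : ℕ
      s³ = s ℕ.* (s ℕ.* s)

      T₁ T₂ T₃ T₄ : A → ℕ
      T₁ = full w cs k
      T₂ = full w cs (λ x y u v → k y x u v)
      T₃ = full w cs (λ x y u v → k y u x v)
      T₄ = full w cs (λ x y u v → k y u v x)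

      F-partials : F z ≡ ∑ᶻ cs (λ x → z x ℤ.* (+ T₁ x ℤ.- + s³))
      F-partials = trans (M-def z z z z) (slice k z)

      -- The bracket is the gradient at z. It is independent of δ, so one computation per pattern
      -- turns every derivative into a dot product.
      D-partials : ∀ δ → D z δ ≡ ∑ᶻ cs (λ x → δ x ℤ.* (+ (T₁ x ℕ.+ T₂ x ℕ.+ T₃ x ℕ.+ T₄ x) ℤ.- + (4 ℕ.* s³)))
      D-partials δ = trans (cong₂ ℤ._+_ (cong₂ ℤ._+_ (cong₂ ℤ._+_ p₁ p₂) p₃) p₄)
        (trans (cong (λ t → t ℤ.+ ∑ᶻ cs (λ x → δ x ℤ.* g T₄ x)) (trans (cong (λ t → t ℤ.+ ∑ᶻ cs (λ x → δ x ℤ.* g T₃ x))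
          (sym (∑ᶻ-+ cs _ _))) (sym (∑ᶻ-+ cs _ _)))) (trans (sym (∑ᶻ-+ cs _ _)) (∑ᶻ-cong cs λ x →
            trans (collect (δ x) (+ T₁ x) (+ T₂ x) (+ T₃ x) (+ T₄ x) (+ s³)) (cong (λ t → δ x ℤ.* (+ (T₁ x ℕ.+ T₂ x ℕ.+ T₃ x ℕ.+ T₄ x) ℤ.- t)) (sym (ℤP.pos-* 4 s³))))))
        where
        g : (A → ℕ) → A → ℤ
        g T x = + T x ℤ.- + s³
        collect : ∀ d a b c e s → d ℤ.* (a ℤ.- s) ℤ.+ d ℤ.* (b ℤ.- s) ℤ.+ d ℤ.* (c ℤ.- s) ℤ.+ d ℤ.* (e ℤ.- s) ≡
                  d ℤ.* (a ℤ.+ b ℤ.+ c ℤ.+ e ℤ.- + 4 ℤ.* s)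
        collect = solve-∀
        r₂ : ∀ k a b c d → k ℤ.* (a ℤ.* (b ℤ.* (c ℤ.* d))) ≡ k ℤ.* (b ℤ.* (a ℤ.* (c ℤ.* d)))
        r₂ = solve-∀
        r₃ : ∀ k a b c d → k ℤ.* (a ℤ.* (b ℤ.* (c ℤ.* d))) ≡ k ℤ.* (c ℤ.* (a ℤ.* (b ℤ.* d)))
        r₃ = solve-∀
        r₄ : ∀ k a b c d → k ℤ.* (a ℤ.* (b ℤ.* (c ℤ.* d))) ≡ k ℤ.* (d ℤ.* (a ℤ.* (b ℤ.* c)))
        r₄ = solve-∀
        kz : A → A → A → A → ℤ
        kz x y u v = + k x y u v ℤ.- 1ℤ
        p₁ : M δ z z z ≡ ∑ᶻ cs (λ x → δ x ℤ.* g T₁ x)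
        p₁ = trans (M-def δ z z z) (slice k δ)
        p₂ : M z δ z z ≡ ∑ᶻ cs (λ x → δ x ℤ.* g T₂ x)
        p₂ = trans (M-def z δ z z) (trans (∑ᶻ-swap cs cs _)
          (trans (∑⁴-cong λ x y u v → r₂ (kz y x u v) (z y) (δ x) (z u) (z v)) (slice (λ x y u v → k y x u v) δ)))
        p₃ : M z z δ z ≡ ∑ᶻ cs (λ x → δ x ℤ.* g T₃ x)
        p₃ = trans (M-def z z δ z) (trans (∑ᶻ-cong cs λ x → ∑ᶻ-swap cs cs _) (trans (∑ᶻ-swap cs cs _)
          (trans (∑⁴-cong λ x y u v → r₃ (kz y u x v) (z y) (z u) (δ x) (z v)) (slice (λ x y u v → k y u x v) δ))))
        p₄ : M z z z δ ≡ ∑ᶻ cs (λ x → δ x ℤ.* g T₄ x)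
        p₄ = trans (M-def z z z δ) (trans (∑ᶻ-cong cs λ x → trans (∑ᶻ-cong cs λ y → ∑ᶻ-swap cs cs _) (∑ᶻ-swap cs cs _)) (trans (∑ᶻ-swap cs cs _)
          (trans (∑⁴-cong λ x y u v → r₄ (kz y u v x) (z y) (z u) (z v) (δ x)) (slice (λ x y u v → k y u v x) δ))))

-- A Boolean test of a starting template, and its soundness

module Checking where

  open Sums
  open Ties
  open Templates
  open QuadrilinearForms
  open Iteration
  open Refutation
  open Gradients
  open import Data.Bool using (Bool; true; false; _∧_; if_then_else_; T)
  open import Data.Empty using (⊥-elim)
  open import Data.Fin as F using (Fin; toℕ; zero; suc)
  open import Data.Fin.Patterns
  open import Data.Fin.Permutation as Pm using (_⟨$⟩ʳ_; _⟨$⟩ˡ_)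
  open import Data.Integer as ℤ using (ℤ; +_; ∣_∣; 1ℤ)
  import Data.Integer.Properties as ℤP
  open import Data.List as L using (List; []; _∷_)
  open import Data.List.Membership.Propositional using (_∈_)
  open import Data.List.Relation.Unary.All as All using (All; []; _∷_)
  open import Data.List.Relation.Unary.Any using (here; there)
  open import Data.Nat as ℕ using (ℕ; zero; suc; _≤_; z≤n; s≤s; _≤ᵇ_)
  open import Data.Nat.Properties as ℕP using (≤-trans; ≤-refl)
  open import Data.Product using (_×_; _,_; proj₁; proj₂; ∃)
  open import Data.Unit using (tt)
  open import Data.Vec as V using (Vec; []; _∷_; lookup; tabulate; toList)
  open import Data.Vec.Properties using (lookup∘tabulate; lookup-map; tabulate-cong)
  open import Relation.Binary.PropositionalEquality
  open import Relation.Nullary using (¬_; yes; no)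

  kw-sorted : ∀ v → ¬ kw v ≡ 0 → ∀ i j → toℕ i ≤ toℕ j → lookup v i ≤ lookup v j
  kw-sorted (a ∷ b ∷ c ∷ d ∷ []) h with b ℕ.<ᵇ a in p | c ℕ.<ᵇ b in q | d ℕ.<ᵇ c in r
  ... | true | _ | _ = ⊥-elim (h refl)
  ... | false | true | _ = ⊥-elim (h refl)
  ... | false | false | true = ⊥-elim (h refl)
  ... | false | false | false = go
    where
    ord : ∀ {m n} → (m ℕ.<ᵇ n) ≡ false → n ≤ m
    ord {m} {n} eq = ℕP.≮⇒≥ λ lt → subst T eq (ℕP.<⇒<ᵇ lt)
    ab = ord {b} {a} p
    bc = ord {c} {b} q
    cd = ord {d} {c} r
    go : ∀ i j → toℕ i ≤ toℕ j → lookup (a ∷ b ∷ c ∷ d ∷ []) i ≤ lookup (a ∷ b ∷ c ∷ d ∷ []) j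
    go 0F 0F _ = ≤-refl
    go 0F 1F _ = ab
    go 0F 2F _ = ≤-trans ab bc
    go 0F 3F _ = ≤-trans ab (≤-trans bc cd)
    go 1F 1F _ = ≤-refl
    go 1F 2F _ = bc
    go 1F 3F _ = ≤-trans bc cd
    go 2F 2F _ = ≤-refl
    go 2F 3F _ = cd
    go 3F 3F _ = ≤-refl
    go 1F 0F ()
    go 2F 0F ()
    go 2F 1F (s≤s ())
    go 3F 0F ()
    go 3F 1F (s≤s ())
    go 3F 2F (s≤s (s≤s ()))

  record Cell : Set where
    constructor cell
    field row col weight : ℕ
  open Cell

  -- The coefficient `κ` with the inverse of σ read from a table, a form suited to evaluation.
  κᶜ : Vec (Fin 4) 4 → Vec Cell 4 → ℕ
  κᶜ q a = kw (V.map row a) ℕ.* kw (reindex (V.map col a) (lookup q))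

  -- Necessary for two cells to hold an earlier and a later point of the pattern; `up` tells whether
  -- the pattern rises between them. The inequalities are weak because points of the same row or
  -- column can still come in either order.
  fits : Bool → Cell → Cell → Bool
  fits up x y = (row x ≤ᵇ row y) ∧ (if up then col x ≤ᵇ col y else col y ≤ᵇ col x)

  ≤ᵇ-true : ∀ {m n} → m ≤ n → (m ≤ᵇ n) ≡ true
  ≤ᵇ-true {m} {n} h with m ≤ᵇ n | ℕP.≤⇒≤ᵇ h
  ... | true | _ = refl

  module Code (σ : Perm 4) where

    image preimage : Vec (Fin 4) 4
    image = tabulate (σ ⟨$⟩ʳ_)
    preimage = tabulate (σ ⟨$⟩ˡ_)

  module Gradient (p q : Vec (Fin 4) 4) (cs : List Cell) where

    up : Fin 4 → Fin 4 → Bool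
    up i j = toℕ (lookup p i) ℕ.<ᵇ toℕ (lookup p j)

    R : Fin 4 → Fin 4 → Cell → Cell → Bool
    R i j = fits (up i j)

    -- `Pruned` takes the fixed cell first, whichever slot it occupies, so its relations to earlier
    -- slots are reversed.
    Rᵒ : Fin 4 → Fin 4 → Cell → Cell → Bool
    Rᵒ i j x y = fits (up i j) y x

    k : Cell → Cell → Cell → Cell → ℕ
    k x y u v = κᶜ q (x ∷ y ∷ u ∷ v ∷ [])

    module P₁ = Pruned weight cs (R 0F 1F) (R 0F 2F) (R 0F 3F) (R 1F 2F) (R 1F 3F) (R 2F 3F) k
    module P₂ = Pruned weight cs (Rᵒ 0F 1F) (R 1F 2F) (R 1F 3F) (R 0F 2F) (R 0F 3F) (R 2F 3F) (λ x y u v → k y x u v)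
    module P₃ = Pruned weight cs (Rᵒ 0F 2F) (Rᵒ 1F 2F) (R 2F 3F) (R 0F 1F) (R 0F 3F) (R 1F 3F) (λ x y u v → k y u x v)
    module P₄ = Pruned weight cs (Rᵒ 0F 3F) (Rᵒ 1F 3F) (Rᵒ 2F 3F) (R 0F 1F) (R 0F 2F) (R 1F 2F) (λ x y u v → k y u v x)

    f g : ℕ → Cell → ℤ
    f s³ c = + P₁.pruned c ℤ.- + s³
    g s³ c = + (P₁.pruned c ℕ.+ P₂.pruned c ℕ.+ P₃.pruned c ℕ.+ P₄.pruned c) ℤ.- + (4 ℕ.* s³)

  Grad : ℕ → Set
  Grad n = Vec ℤ n × Vec ℤ n

  cube : ℕ → ℕ
  cube s = s ℕ.* (s ℕ.* s)

  grad : ∀ {n} → Perm 4 → Vec Cell n → Grad n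
  grad σ v = V.map (f (cube (∑ (toList v) weight))) v , V.map (g (cube (∑ (toList v) weight))) v
    where open Gradient (Code.image σ) (Code.preimage σ) (toList v)

  full-lookup : ∀ {n} (v : Vec Cell n) (k : Cell → Cell → Cell → Cell → ℕ) c →
    full (λ i → weight (lookup v i)) (fins n) (λ x y u t → k (lookup v x) (lookup v y) (lookup v u) (lookup v t)) c ≡
    full weight (toList v) k (lookup v c)
  full-lookup v k c = trans (∑-cong (fins _) λ y → cong (weight (lookup v y) ℕ.*_) (trans (∑-cong (fins _) λ u → cong (weight (lookup v u) ℕ.*_)
      (∑-lookup v (λ t → weight t ℕ.* k (lookup v c) (lookup v y) (lookup v u) t))) (∑-lookup v (λ u → weight u ℕ.* ∑ (toList v) (λ t → weight t ℕ.* k (lookup v c) (lookup v y) u t)))))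
    (∑-lookup v (λ y → weight y ℕ.* ∑ (toList v) (λ u → weight u ℕ.* ∑ (toList v) (λ t → weight t ℕ.* k (lookup v c) y u t))))

  module Correct (σ : Perm 4) where
    open Code σ

    private
      up : Fin 4 → Fin 4 → Bool
      up i j = toℕ (lookup image i) ℕ.<ᵇ toℕ (lookup image j)

    -- A nonzero product has both `kw` factors nonzero, hence the rows weakly increase in the order
    -- of positions and the columns in the order of values.
    κᶜ-fits : ∀ a → ¬ κᶜ preimage a ≡ 0 → ∀ i j → toℕ i ≤ toℕ j → fits (up i j) (lookup a i) (lookup a j) ≡ true
    κᶜ-fits a h i j i≤j = cong₂ _∧_ (≤ᵇ-true rows) cols
      where
      h₁ : ¬ kw (V.map row a) ≡ 0
      h₁ eq = h (cong (ℕ._* kw (reindex (V.map col a) (lookup preimage))) eq)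
      h₂ : ¬ kw (reindex (V.map col a) (lookup preimage)) ≡ 0
      h₂ eq = h (trans (cong (kw (V.map row a) ℕ.*_) eq) (ℕP.*-zeroʳ (kw (V.map row a))))
      rows : row (lookup a i) ≤ row (lookup a j)
      rows = subst₂ _≤_ (lookup-map i row a) (lookup-map j row a) (kw-sorted (V.map row a) h₁ i j i≤j)
      at : ∀ i → lookup (reindex (V.map col a) (lookup preimage)) (σ ⟨$⟩ʳ i) ≡ col (lookup a i)
      at i = trans (lookup∘tabulate (λ t → lookup (V.map col a) (lookup preimage t)) (σ ⟨$⟩ʳ i)) (trans (cong (lookup (V.map col a))
        (trans (lookup∘tabulate (σ ⟨$⟩ˡ_) (σ ⟨$⟩ʳ i)) (Pm.inverseˡ σ))) (lookup-map i col a))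
      mono : ∀ i j → toℕ (σ ⟨$⟩ʳ i) ≤ toℕ (σ ⟨$⟩ʳ j) → col (lookup a i) ≤ col (lookup a j)
      mono i j le = subst₂ _≤_ (at i) (at j) (kw-sorted (reindex (V.map col a) (lookup preimage)) h₂ (σ ⟨$⟩ʳ i) (σ ⟨$⟩ʳ j) le)
      img : ∀ i → toℕ (lookup image i) ≡ toℕ (σ ⟨$⟩ʳ i)
      img i = cong toℕ (lookup∘tabulate (σ ⟨$⟩ʳ_) i)
      cols : (if up i j then col (lookup a i) ≤ᵇ col (lookup a j) else col (lookup a j) ≤ᵇ col (lookup a i)) ≡ true
      cols with up i j in eq
      ... | true = ≤ᵇ-true (mono i j (subst₂ _≤_ (img i) (img j) (ℕP.<⇒≤ (ℕP.<ᵇ⇒< _ _ (subst T (sym eq) tt)))))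
      ... | false = ≤ᵇ-true (mono j i (subst₂ _≤_ (img j) (img i) (ℕP.≮⇒≥ λ lt → subst T eq (ℕP.<⇒<ᵇ lt))))

    κᶜ-0 : ∀ a i j → toℕ i ≤ toℕ j → fits (up i j) (lookup a i) (lookup a j) ≡ false → κᶜ preimage a ≡ 0
    κᶜ-0 a i j i≤j no-fit with κᶜ preimage a ℕ.≟ 0
    ... | yes eq = eq
    ... | no neq = ⊥-elim (true≢false (trans (sym (κᶜ-fits a neq i j i≤j)) no-fit))
      where
      true≢false : ¬ true ≡ false
      true≢false ()

    module _ (cs : List Cell) where
      open Gradient image preimage cs hiding (up)

      private
        z₀₁ : ∀ x y u v → R 0F 1F x y ≡ false → k x y u v ≡ 0
        z₀₁ x y u v = κᶜ-0 (x ∷ y ∷ u ∷ v ∷ []) 0F 1F z≤n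
        z₀₂ : ∀ x y u v → R 0F 2F x u ≡ false → k x y u v ≡ 0
        z₀₂ x y u v = κᶜ-0 (x ∷ y ∷ u ∷ v ∷ []) 0F 2F z≤n
        z₀₃ : ∀ x y u v → R 0F 3F x v ≡ false → k x y u v ≡ 0
        z₀₃ x y u v = κᶜ-0 (x ∷ y ∷ u ∷ v ∷ []) 0F 3F z≤n
        z₁₂ : ∀ x y u v → R 1F 2F y u ≡ false → k x y u v ≡ 0
        z₁₂ x y u v = κᶜ-0 (x ∷ y ∷ u ∷ v ∷ []) 1F 2F (s≤s z≤n)
        z₁₃ : ∀ x y u v → R 1F 3F y v ≡ false → k x y u v ≡ 0
        z₁₃ x y u v = κᶜ-0 (x ∷ y ∷ u ∷ v ∷ []) 1F 3F (s≤s z≤n)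
        z₂₃ : ∀ x y u v → R 2F 3F u v ≡ false → k x y u v ≡ 0
        z₂₃ x y u v = κᶜ-0 (x ∷ y ∷ u ∷ v ∷ []) 2F 3F (s≤s (s≤s z≤n))

      pruned₁ : ∀ x → P₁.pruned x ≡ full weight cs k x
      pruned₁ = P₁.pruned≡full z₀₁ z₀₂ z₀₃ z₁₂ z₁₃ z₂₃
      pruned₂ : ∀ x → P₂.pruned x ≡ full weight cs (λ x y u v → k y x u v) x
      pruned₂ = P₂.pruned≡full (λ x y → z₀₁ y x) (λ x y → z₁₂ y x) (λ x y → z₁₃ y x) (λ x y → z₀₂ y x) (λ x y → z₀₃ y x) (λ x y → z₂₃ y x)
      pruned₃ : ∀ x → P₃.pruned x ≡ full weight cs (λ x y u v → k y u x v) x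
      pruned₃ = P₃.pruned≡full (λ x y u → z₀₂ y u x) (λ x y u → z₁₂ y u x) (λ x y u → z₂₃ y u x) (λ x y u → z₀₁ y u x) (λ x y u → z₀₃ y u x) (λ x y u → z₁₃ y u x)
      pruned₄ : ∀ x → P₄.pruned x ≡ full weight cs (λ x y u v → k y u v x) x
      pruned₄ = P₄.pruned≡full (λ x y u v → z₀₃ y u v x) (λ x y u v → z₁₃ y u v x) (λ x y u v → z₂₃ y u v x) (λ x y u v → z₀₁ y u v x) (λ x y u v → z₀₂ y u v x) (λ x y u v → z₁₂ y u v x)

  full-cong : {A : Set} (w : A → ℕ) (cs : List A) {k k′ : A → A → A → A → ℕ} → (∀ x y u v → k x y u v ≡ k′ x y u v) →
              ∀ x → full w cs k x ≡ full w cs k′ x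
  full-cong w cs h x = ∑-cong cs λ y → cong (w y ℕ.*_) (∑-cong cs λ u → cong (w u ℕ.*_) (∑-cong cs λ v → cong (w v ℕ.*_) (h x y u v)))

  norm : ∀ {n} → Vec ℤ n → ℕ
  norm u = ∑ (toList u) ∣_∣

  weights : ∀ {n} → Vec Cell n → Vec ℤ n
  weights = V.map (λ c → + weight c)

  module Evaluate {n : ℕ} (v : Vec Cell n) (K : ℕ) (σ : Perm 4) where

    w : Fin n → ℕ
    w i = weight (lookup v i)

    row′ col′ : Fin n → ℕ
    row′ i = row (lookup v i)
    col′ i = col (lookup v i)

    κ : Fin n → Fin n → Fin n → Fin n → ℕ
    κ x y u t = Template.κ row′ col′ (fins n) σ (x ∷ y ∷ u ∷ t ∷ [])

    module _ (κ≤K : ∀ x y u t → ∣ + κ x y u t ℤ.- 1ℤ ∣ ≤ K) where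
      module Fm = Forms.Form (fins n) (λ x y u t → + κ x y u t ℤ.- 1ℤ) K κ≤K
      module Pt = Partials (fins n) w

      private
        cs = toList v
        open Code σ
        module G = Gradient image preimage cs

        κ≡ : ∀ x y u t → κ x y u t ≡ G.k (lookup v x) (lookup v y) (lookup v u) (lookup v t)
        κ≡ x y u t = cong (λ p → kw (row′ x ∷ row′ y ∷ row′ u ∷ row′ t ∷ []) ℕ.* kw p)
          (tabulate-cong (λ i → cong (lookup (col′ x ∷ col′ y ∷ col′ u ∷ col′ t ∷ [])) (sym (lookup∘tabulate (σ ⟨$⟩ˡ_) i))))

        t₁ : ∀ x → Pt.T₁ κ K κ≤K x ≡ G.P₁.pruned (lookup v x)
        t₁ x = trans (full-cong w (fins n) κ≡ x) (trans (full-lookup v G.k x) (sym (Correct.pruned₁ σ cs (lookup v x))))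
        t₂ : ∀ x → Pt.T₂ κ K κ≤K x ≡ G.P₂.pruned (lookup v x)
        t₂ x = trans (full-cong w (fins n) (λ x y u t → κ≡ y x u t) x)
          (trans (full-lookup v (λ x y u t → G.k y x u t) x) (sym (Correct.pruned₂ σ cs (lookup v x))))
        t₃ : ∀ x → Pt.T₃ κ K κ≤K x ≡ G.P₃.pruned (lookup v x)
        t₃ x = trans (full-cong w (fins n) (λ x y u t → κ≡ y u x t) x)
          (trans (full-lookup v (λ x y u t → G.k y u x t) x) (sym (Correct.pruned₃ σ cs (lookup v x))))
        t₄ : ∀ x → Pt.T₄ κ K κ≤K x ≡ G.P₄.pruned (lookup v x)
        t₄ x = trans (full-cong w (fins n) (λ x y u t → κ≡ y u t x) x)
          (trans (full-lookup v (λ x y u t → G.k y u t x) x) (sym (Correct.pruned₄ σ cs (lookup v x))))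

        s³≡ : Pt.s³ κ K κ≤K ≡ cube (∑ cs weight)
        s³≡ = cong cube (∑-lookup v weight)

      F≡ : Fm.F Pt.z ≡ dot (weights v) (proj₁ (grad σ v))
      F≡ = trans (Pt.F-partials κ K κ≤K) (trans (∑ᶻ-cong (fins n) λ x → cong₂ ℤ._*_ (sym (lookup-map x (λ c → + weight c) v))
          (trans (cong₂ (λ a b → + a ℤ.- + b) (t₁ x) s³≡) (sym (lookup-map x (G.f (cube (∑ cs weight))) v))))
        (∑ᶻ-dot (weights v) (proj₁ (grad σ v))))

      D≡ : ∀ δ → Fm.D Pt.z (lookup δ) ≡ dot δ (proj₂ (grad σ v))
      D≡ δ = trans (Pt.D-partials κ K κ≤K (lookup δ)) (trans (∑ᶻ-cong (fins n) λ x → cong (lookup δ x ℤ.*_)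
          (trans (cong₂ (λ a b → + a ℤ.- + (4 ℕ.* b)) (cong₂ ℕ._+_ (cong₂ ℕ._+_ (cong₂ ℕ._+_ (t₁ x) (t₂ x)) (t₃ x)) (t₄ x)) s³≡)
            (sym (lookup-map x (G.g (cube (∑ cs weight))) v))))
        (∑ᶻ-dot δ (proj₂ (grad σ v))))

  allF : ∀ {r} → (Fin r → Bool) → Bool
  allF {zero} p = true
  allF {suc r} p = p zero ∧ allF (λ i → p (suc i))

  ∧-true : ∀ {a b} → a ∧ b ≡ true → a ≡ true × b ≡ true
  ∧-true {true} h = refl , h

  allF-true : ∀ {r} (p : Fin r → Bool) → allF p ≡ true → ∀ i → p i ≡ true
  allF-true p h zero = proj₁ (∧-true h)
  allF-true p h (suc i) = allF-true (λ i → p (suc i)) (proj₂ (∧-true {p zero} h)) i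

  ≤ᵇ-≤ : ∀ m n → (m ≤ᵇ n) ≡ true → m ≤ n
  ≤ᵇ-≤ m n h = ℕP.≤ᵇ⇒≤ m n (subst T (sym h) tt)

  value : ∀ {n} → Vec ℤ n → Vec ℤ n → Grad n → ℤ
  value z e (f , g) = dot z f ℤ.+ dot e g

  slope : ∀ {n} → Grad n → Vec ℤ n → ℤ
  slope (f , g) δ = dot δ g

  error : ℕ → ℕ → ℕ → ℕ
  error K S η = 12 ℕ.* (K ℕ.* (η ℕ.* (η ℕ.* (S ℕ.* S))))

  module _ {n r : ℕ} (z e : Vec ℤ n) (ds : Vec (Vec ℤ n) r) (gs : Vec (Grad n) r) (gτ : Grad n) (L S η E : ℕ) where

    η-okᵇ S-okᵇ startᵇ jacobianᵇ farᵇ positiveᵇ check′ : Bool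
    η-okᵇ = norm e ℕ.+ ∑ (fins r) (λ j → norm (lookup ds j)) ≤ᵇ η
    S-okᵇ = norm z ℕ.+ η ≤ᵇ S
    startᵇ = allF (λ i → 2 ℕ.* (∣ value z e (lookup gs i) ∣ ℕ.+ E) ≤ᵇ L)
    jacobianᵇ = allF (λ i → 2 ℕ.* (∑ (fins r) (λ j → ∣ slope (lookup gs i) (lookup ds j) ℤ.- + L ℤ.* kron i j ∣) ℕ.+ E) ≤ᵇ L)
    farᵇ = 1 ℕ.+ ∑ (fins r) (λ j → ∣ slope gτ (lookup ds j) ∣) ℕ.+ E ≤ᵇ ∣ value z e gτ ∣
    positiveᵇ = allF (λ c → + suc (∑ (fins r) (λ j → ∣ lookup (lookup ds j) c ∣)) ℤ.≤ᵇ lookup z c ℤ.+ lookup e c)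
    check′ = η-okᵇ ∧ (S-okᵇ ∧ ((1 ≤ᵇ L) ∧ (startᵇ ∧ (jacobianᵇ ∧ (farᵇ ∧ positiveᵇ)))))

  -- The error bound is passed as an argument, to be shared by all the comparisons.
  check : ∀ {n r} → Vec ℤ n → Vec ℤ n → Vec (Vec ℤ n) r → Vec (Grad n) r → Grad n → (K L S η : ℕ) → Bool
  check z e ds gs gτ K L S η = check′ z e ds gs gτ L S η (error K S η)

  norm-lookup : ∀ {n} (u : Vec ℤ n) → ∑ (fins n) (λ x → ∣ lookup u x ∣) ≡ norm u
  norm-lookup u = ∑-lookup u ∣_∣

  -- Stated for every list covered by X, so that it passes to subsets: a handful of large sets can
  -- then settle many small ones.
  Unforced : List (Perm 4) → Set
  Unforced X = ∀ T → (∀ σ → σ ∈ T → ∃ λ ρ → ρ ∈ X × (∀ t → σ ⟨$⟩ʳ t ≡ ρ ⟨$⟩ʳ t)) → ¬ QuasirandomForcing T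

  module _ {n r : ℕ} (v : Vec Cell (suc n)) (e : Vec ℤ (suc n)) (ds : Vec (Vec ℤ (suc n)) r)
    (σs : Vec (Perm 4) r) (τ : Perm 4) (K L S η : ℕ) (K≥ : 576 ≤ K)
    (ok : check (weights v) e ds (V.map (λ σ → grad σ v) σs) (grad τ v) K L S η ≡ true) where

    private
      m = suc n
      module Ref = Refute (λ i → row (lookup v i)) (λ i → col (lookup v i)) 0F (L.map suc (fins n))
        (lookup σs) τ (λ i → + weight (lookup v i)) (lookup e) (λ j → lookup (lookup ds j)) K L S η K≥

      gs = V.map (λ σ → grad σ v) σs
      E = error K S η
      zs = weights v

      c₁ = ∧-true {η-okᵇ zs e ds gs (grad τ v) L S η E} ok
      c₂ = ∧-true {S-okᵇ zs e ds gs (grad τ v) L S η E} (proj₂ c₁)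
      c₃ = ∧-true {1 ≤ᵇ L} (proj₂ c₂)
      c₄ = ∧-true {startᵇ zs e ds gs (grad τ v) L S η E} (proj₂ c₃)
      c₅ = ∧-true {jacobianᵇ zs e ds gs (grad τ v) L S η E} (proj₂ c₄)
      c₆ = ∧-true {farᵇ zs e ds gs (grad τ v) L S η E} (proj₂ c₅)

      F≡ : ∀ σ → Ref.Fm.F σ (λ i → + weight (lookup v i)) ≡ dot zs (proj₁ (grad σ v))
      F≡ σ = Evaluate.F≡ v K σ (Ref.coeff≤K σ)

      D≡ : ∀ σ δ → Ref.Fm.D σ (λ i → + weight (lookup v i)) (lookup δ) ≡ dot δ (proj₂ (grad σ v))
      D≡ σ δ = Evaluate.D≡ v K σ (Ref.coeff≤K σ) δ

      FD≡ : ∀ σ → Ref.Fm.F σ (λ i → + weight (lookup v i)) ℤ.+ Ref.Fm.D σ (λ i → + weight (lookup v i)) (lookup e) ≡ value zs e (grad σ v)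
      FD≡ σ = cong₂ ℤ._+_ (F≡ σ) (D≡ σ e)

      norm-z : norm zs ≡ ∑ (fins m) (λ i → ∣ + weight (lookup v i) ∣)
      norm-z = trans (sym (norm-lookup zs)) (∑-cong (fins m) λ i → cong ∣_∣ (lookup-map i (λ c → + weight c) v))

    -- Each conjunct of the test is one hypothesis of `Refute`, transported along the identities
    -- that express values and derivatives as dot products.
    unforced : Unforced (toList σs)
    unforced Y cover = Ref.refute
      (subst (_≤ η) (cong₂ ℕ._+_ (sym (norm-lookup e)) (∑-cong (fins r) λ j → sym (norm-lookup (lookup ds j)))) (≤ᵇ-≤ _ η (proj₁ c₁)))
      (subst (λ t → t ℕ.+ η ≤ S) norm-z (≤ᵇ-≤ _ S (proj₁ c₂)))
      (≤ᵇ-≤ 1 L (proj₁ c₃))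
      (λ i → subst (λ t → 2 ℕ.* (∣ t ∣ ℕ.+ E) ≤ L) (sym (FD≡ (lookup σs i)))
        (subst (λ g → 2 ℕ.* (∣ value zs e g ∣ ℕ.+ E) ≤ L) (lookup-map i (λ σ → grad σ v) σs)
          (≤ᵇ-≤ _ L (allF-true (λ i → 2 ℕ.* (∣ value zs e (lookup gs i) ∣ ℕ.+ E) ≤ᵇ L) (proj₁ c₄) i))))
      (λ i → subst (λ t → 2 ℕ.* (t ℕ.+ E) ≤ L) (∑-cong (fins r) λ j → cong (λ t → ∣ t ℤ.- + L ℤ.* kron i j ∣) (sym (D≡ (lookup σs i) (lookup ds j))))
        (subst (λ g → 2 ℕ.* (∑ (fins r) (λ j → ∣ slope g (lookup ds j) ℤ.- + L ℤ.* kron i j ∣) ℕ.+ E) ≤ L) (lookup-map i (λ σ → grad σ v) σs)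
          (≤ᵇ-≤ _ L (allF-true (λ i → 2 ℕ.* (∑ (fins r) (λ j → ∣ slope (lookup gs i) (lookup ds j) ℤ.- + L ℤ.* kron i j ∣) ℕ.+ E) ≤ᵇ L) (proj₁ c₅) i))))
      (subst₂ (λ s t → 1 ℕ.+ s ℕ.+ E ≤ ∣ t ∣) (∑-cong (fins r) λ j → cong ∣_∣ (sym (D≡ τ (lookup ds j)))) (sym (FD≡ τ))
        (≤ᵇ-≤ (1 ℕ.+ ∑ (fins r) (λ j → ∣ slope (grad τ v) (lookup ds j) ∣) ℕ.+ E) _ (proj₁ c₆)))
      (All.universal (λ c → subst (λ t → + suc (∑ (fins r) (λ j → ∣ lookup (lookup ds j) c ∣)) ℤ.≤ t ℤ.+ lookup e c) (lookup-map c (λ c → + weight c) v)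
        (ℤP.≤ᵇ⇒≤ (subst T (sym (allF-true (λ c → + suc (∑ (fins r) (λ j → ∣ lookup (lookup ds j) c ∣)) ℤ.≤ᵇ lookup zs c ℤ.+ lookup e c) (proj₂ c₆) c)) tt))) (fins m))
      Y (λ σ σ∈ → index σ (cover σ σ∈))
      where
      find : ∀ {k} (ρs : Vec (Perm 4) k) {ρ} → ρ ∈ toList ρs → ∃ λ i → lookup ρs i ≡ ρ
      find (ρ ∷ ρs) (here refl) = zero , refl
      find (ρ ∷ ρs) (there p) = suc (proj₁ (find ρs p)) , proj₂ (find ρs p)
      index : ∀ σ → (∃ λ ρ → ρ ∈ toList σs × (∀ t → σ ⟨$⟩ʳ t ≡ ρ ⟨$⟩ʳ t)) → ∃ λ i → ∀ t → σ ⟨$⟩ʳ t ≡ lookup σs i ⟨$⟩ʳ t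
      index σ (ρ , ρ∈ , h) = proj₁ (find σs ρ∈) , λ t → trans (h t) (cong (_⟨$⟩ʳ t) (sym (proj₂ (find σs ρ∈))))

-- Enumeration of the patterns and covers of their small subsets

module Covering where

  open Sums
  open QuadrilinearForms
  open Checking
  open import Data.Bool using (Bool; true; false; _∧_; _∨_; T)
  open import Data.Empty using (⊥-elim)
  open import Data.Fin as F using (zero; suc)
  open import Data.Fin.Patterns
  open import Data.Fin.Permutation as Pm using (_⟨$⟩ʳ_)
  open import Data.List as L using (List; []; _∷_; filterᵇ; length)
  open import Data.List.Membership.Propositional using (_∈_)
  import Data.List.Membership.Propositional.Properties as ∈
  open import Data.List.Properties using (filter-notAll; length-map)
  open import Data.List.Relation.Unary.All as All using (All; []; _∷_)
  open import Data.List.Relation.Unary.Any as Any using (here; there)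
  open import Data.Nat as ℕ using (ℕ; zero; suc; _≤_; _<_; z≤n; s≤s; _≡ᵇ_)
  open import Data.Nat.Properties as ℕP using (≤-trans)
  open import Data.Product using (_×_; _,_; proj₁; proj₂; ∃)
  open import Data.Vec using ([]; _∷_; lookup)
  open Gradients
  open import Relation.Binary.PropositionalEquality
  open import Relation.Nullary using (¬_; yes; no; ¬?)

  -- The order is lexicographic in the images; the numbers that stand for patterns in the data refer
  -- to it.
  allPerms : ∀ n → List (Perm n)
  allPerms zero = Pm.id ∷ []
  allPerms (suc n) = L.concatMap (λ j → L.map (Pm.insert zero j) (allPerms n)) (L.allFin (suc n))

  allPerms-complete : ∀ n (π : Perm n) → ∃ λ ρ → ρ ∈ allPerms n × (∀ t → π ⟨$⟩ʳ t ≡ ρ ⟨$⟩ʳ t)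
  allPerms-complete zero π = Pm.id , here refl , λ ()
  allPerms-complete (suc n) π with allPerms-complete n (Pm.remove zero π)
  ... | ρ , ρ∈ , eq = Pm.insert zero (π ⟨$⟩ʳ zero) ρ ,
    ∈.∈-concatMap⁺ (λ j → L.map (Pm.insert zero j) (allPerms n)) {xs = L.allFin (suc n)}
      (Any.map (λ { refl → ∈.∈-map⁺ (Pm.insert zero (π ⟨$⟩ʳ zero)) ρ∈ }) (∈.∈-allFin (π ⟨$⟩ʳ zero))) , same
    where
    same : ∀ t → π ⟨$⟩ʳ t ≡ Pm.insert zero (π ⟨$⟩ʳ zero) ρ ⟨$⟩ʳ t
    same zero = refl
    same (suc t) = trans (Pm.punchIn-permute π zero t) (trans (cong (F.punchIn (π ⟨$⟩ʳ zero)) (eq t))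
      (sym (Pm.insert-punchIn zero (π ⟨$⟩ʳ zero) ρ t)))

  nth : {A : Set} → A → List A → ℕ → A
  nth a [] k = a
  nth a (x ∷ xs) zero = x
  nth a (x ∷ xs) (suc k) = nth a xs k

  nth-map : {A B : Set} (f : A → B) (a : A) (xs : List A) (k : ℕ) → nth (f a) (L.map f xs) k ≡ f (nth a xs k)
  nth-map f a [] k = refl
  nth-map f a (x ∷ xs) zero = refl
  nth-map f a (x ∷ xs) (suc k) = nth-map f a xs k

  ∈-nth : {A : Set} (a : A) {x : A} {xs : List A} → x ∈ xs → ∃ λ k → k < length xs × nth a xs k ≡ x
  ∈-nth a (here refl) = 0 , s≤s z≤n , refl
  ∈-nth a (there p) = suc (proj₁ (∈-nth a p)) , s≤s (proj₁ (proj₂ (∈-nth a p))) , proj₂ (proj₂ (∈-nth a p))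

  perm₄ : ℕ → Perm 4
  perm₄ = nth Pm.id (allPerms 4)

  indices : List ℕ
  indices = L.upTo 24

  ∈-nth-index : (ρs : List (Perm 4)) (σ : Perm 4) → (∃ λ ρ → ρ ∈ ρs × (∀ t → σ ⟨$⟩ʳ t ≡ ρ ⟨$⟩ʳ t)) →
                ∃ λ k → k < length ρs × (∀ t → σ ⟨$⟩ʳ t ≡ nth Pm.id ρs k ⟨$⟩ʳ t)
  ∈-nth-index ρs σ (ρ , ρ∈ , eq) with ∈-nth Pm.id ρ∈
  ... | k , k< , refl = k , k< , eq

  perm-complete : (σ : Perm 4) → ∃ λ k → k < 24 × (∀ t → σ ⟨$⟩ʳ t ≡ perm₄ k ⟨$⟩ʳ t)
  perm-complete σ = ∈-nth-index (allPerms 4) σ (allPerms-complete 4 σ)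

  elem : ℕ → List ℕ → Bool
  elem c [] = false
  elem c (x ∷ xs) = (c ≡ᵇ x) ∨ elem c xs

  elem-∈ : ∀ c xs → elem c xs ≡ true → c ∈ xs
  elem-∈ c (x ∷ xs) h with c ≡ᵇ x in eq
  ... | true = here (ℕP.≡ᵇ⇒≡ c x (subst T (sym eq) _))
  ... | false = there (elem-∈ c xs h)

  ∈-filterᵇ : {A : Set} (p : A → Bool) (xs : List A) {x : A} → x ∈ filterᵇ p xs → x ∈ xs × p x ≡ true
  ∈-filterᵇ p (y ∷ ys) h with p y in eq
  ∈-filterᵇ p (y ∷ ys) (here refl) | true = here refl , eq
  ∈-filterᵇ p (y ∷ ys) (there h) | true = there (proj₁ (∈-filterᵇ p ys h)) , proj₂ (∈-filterᵇ p ys h)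
  ∈-filterᵇ p (y ∷ ys) h | false = there (proj₁ (∈-filterᵇ p ys h)) , proj₂ (∈-filterᵇ p ys h)

  -- Asks whether any k or fewer numbers from cs lie in a common member of Xs. Branching on the
  -- choice of c, and then keeping only the members that contain c, shares work among the 10626 sets
  -- of four patterns.
  covers : ℕ → List ℕ → List (List ℕ) → Bool
  covers k cs [] = false
  covers k [] (X ∷ Xs) = true
  covers zero (c ∷ cs) (X ∷ Xs) = true
  covers (suc k) (c ∷ cs) (X ∷ Xs) = covers k cs (filterᵇ (elem c) (X ∷ Xs)) ∧ covers (suc k) cs (X ∷ Xs)

  covers-sound : ∀ k cs Xs → covers k cs Xs ≡ true → ∀ Y → (∀ {x} → x ∈ Y → x ∈ cs) → length Y ≤ k →
                 ∃ λ X → X ∈ Xs × (∀ {x} → x ∈ Y → x ∈ X)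
  covers-sound k [] (X ∷ Xs) h Y sub _ = X , here refl , λ x∈ → ⊥-elim (none (sub x∈))
    where
    none : ∀ {x : ℕ} → ¬ x ∈ []
    none ()
  covers-sound zero (c ∷ cs) (X ∷ Xs) h [] sub _ = X , here refl , λ ()
  covers-sound (suc k) (c ∷ cs) (X ∷ Xs) h Y sub len with Any.any? (c ℕ.≟_) Y
  ... | no c∉Y = covers-sound (suc k) cs (X ∷ Xs) (proj₂ (∧-true {covers k cs (filterᵇ (elem c) (X ∷ Xs))} h)) Y (λ x∈ → tail x∈ (sub x∈)) len
    where
    tail : ∀ {x} → x ∈ Y → x ∈ c ∷ cs → x ∈ cs
    tail x∈ (here refl) = ⊥-elim (c∉Y x∈)
    tail x∈ (there p) = p
  ... | yes c∈Y with covers-sound k cs (filterᵇ (elem c) (X ∷ Xs)) (proj₁ (∧-true h)) Y′ sub′ len′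
    where
    -- All copies of c are removed, so the length drops even if Y has repetitions.
    Y′ = L.filter (λ x → ¬? (c ℕ.≟ x)) Y
    sub′ : ∀ {x} → x ∈ Y′ → x ∈ cs
    sub′ {x} x∈ with ∈.∈-filter⁻ (λ x → ¬? (c ℕ.≟ x)) {xs = Y} x∈
    ... | x∈Y , x≢ with sub x∈Y
    ... | here refl = ⊥-elim (x≢ refl)
    ... | there p = p
    len′ : length Y′ ≤ k
    len′ = ℕ.s≤s⁻¹ (≤-trans (filter-notAll (λ x → ¬? (c ℕ.≟ x)) Y (Any.map (λ eq neq → neq eq) c∈Y)) len)
  ... | Z , Z∈ , Y′⊆Z = Z , proj₁ (∈-filterᵇ (elem c) (X ∷ Xs) Z∈) , λ {x} x∈ → back x x∈
    where
    back : ∀ x → x ∈ Y → x ∈ Z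
    back x x∈ with c ℕ.≟ x
    ... | yes refl = elem-∈ c Z (proj₂ (∈-filterᵇ (elem c) (X ∷ Xs) Z∈))
    ... | no c≢x = Y′⊆Z (∈.∈-filter⁺ (λ x → ¬? (c ℕ.≟ x)) x∈ c≢x)

  UnforcedSet : List ℕ → Set
  UnforcedSet X = Unforced (L.map perm₄ X)

  module _ (p : ℕ → Perm 4) (is : List ℕ) (complete : (σ : Perm 4) → ∃ λ k → k ∈ is × (∀ t → σ ⟨$⟩ʳ t ≡ p k ⟨$⟩ʳ t)) where

    covers⇒not-forcing : ∀ k Xs → covers k is Xs ≡ true → All (λ X → Unforced (L.map p X)) Xs →
                         (S : List (Perm 4)) → length S ≤ k → ¬ QuasirandomForcing S
    covers⇒not-forcing k Xs cov all S len with covers-sound k is Xs cov (L.map (λ σ → proj₁ (complete σ)) S) in-range (subst (_≤ k) (sym (length-map _ S)) len)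
      where
      in-range : ∀ {x} → x ∈ L.map (λ σ → proj₁ (complete σ)) S → x ∈ is
      in-range x∈ with ∈.∈-map⁻ (λ σ → proj₁ (complete σ)) x∈
      ... | σ , _ , refl = proj₁ (proj₂ (complete σ))
    ... | X , X∈ , S⊆X = All.lookup all X∈ S λ σ σ∈ → p (proj₁ (complete σ)) ,
      ∈.∈-map⁺ p (S⊆X (∈.∈-map⁺ (λ σ → proj₁ (complete σ)) σ∈)) , proj₂ (proj₂ (complete σ))

  not-forcing : ∀ k Xs → covers k indices Xs ≡ true → All UnforcedSet Xs → (S : List (Perm 4)) → length S ≤ k → ¬ QuasirandomForcing S
  not-forcing = covers⇒not-forcing perm₄ indices λ σ → proj₁ (perm-complete σ) , ∈.∈-upTo⁺ (proj₁ (proj₂ (perm-complete σ))) , proj₂ (proj₂ (perm-complete σ))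

-- Numerically found starts for the degenerate sets

module Certificates where

  open Sums
  open QuadrilinearForms
  open Checking
  open import Data.Bool using (Bool; true; if_then_else_)
  open import Data.Fin using (Fin; toℕ; suc)
  open import Data.Fin.Patterns
  open import Data.Integer as ℤ using (ℤ; +_; -[1+_]; 0ℤ)
  open import Data.List as L using (List; []; _∷_; length)
  open import Data.List.Relation.Unary.All using ([]; _∷_)
  open import Data.Nat as ℕ using (ℕ; suc; _≤_; _≡ᵇ_)
  open import Data.Product using (_×_; _,_)
  open import Data.Vec as V using (Vec; []; _∷_; lookup; tabulate; toList)
  open import Data.Vec.Properties using (toList-map; map-∘)
  open Gradients
  open Covering
  open import Relation.Binary.PropositionalEquality

  -- Uses the least η and S that the test admits; `go` binds η so that it is shared.
  certify : ∀ {n r} → ℕ → Vec Cell n → Vec ℤ n → Vec (Vec ℤ n) r → Vec (Grad n) r → Grad n → ℕ → Bool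
  certify {r = r} K v e ds gs gτ L = go (norm e ℕ.+ ∑ (fins r) (λ j → norm (lookup ds j)))
    where
    go : ℕ → Bool
    go η = check (weights v) e ds gs gτ K L (norm (weights v) ℕ.+ η) η

  certify-unforced : ∀ {n r} K (v : Vec Cell (suc n)) e (ds : Vec (Vec ℤ (suc n)) r) σs τ L → 576 ≤ K →
    certify K v e ds (V.map (λ σ → grad σ v) σs) (grad τ v) L ≡ true → Unforced (toList σs)
  certify-unforced {r = r} K v e ds σs τ L K≥ ok = unforced v e ds σs τ K L (norm (weights v) ℕ.+ η) η K≥ ok
    where
    η = norm e ℕ.+ ∑ (fins r) (λ j → norm (lookup ds j))

  -- A template whose i-th cell lies in row i; a cell is given by its column and weight.
  record Certificate : Set where
    constructor certificate
    field
      patterns : Vec ℕ 4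
      outlier : ℕ
      first : ℕ × ℕ
      rest : List (ℕ × ℕ)
      moves : List (ℕ × Vec ℤ 4)
      pivot : ℕ

    place : ℕ → (xs : List (ℕ × ℕ)) → Vec Cell (length xs)
    place i [] = []
    place i ((j , w) ∷ xs) = cell i j w ∷ place (suc i) xs

    cells : Vec Cell (suc (length rest))
    cells = place 0 (first ∷ rest)

    -- The moves are sparse: four cells are enough to steer four patterns, and the other cells stay
    -- fixed.
    entry : List (ℕ × Vec ℤ 4) → ℕ → Fin 4 → ℤ
    entry [] i j = 0ℤ
    entry ((k , d) ∷ ds) i j = if i ≡ᵇ k then lookup d j else entry ds i j

    directions : Vec (Vec ℤ (suc (length rest))) 4
    directions = tabulate (λ j → tabulate (λ i → entry moves (toℕ i) j))

    valid : (ℕ → Perm 4) → ℕ → Bool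
    -- The shift e is zero, because at these starts the outlier already deviates from 1/24.
    valid p K = certify K cells (V.replicate _ 0ℤ) directions (V.map (λ k → grad (p k) cells) patterns) (grad (p outlier) cells) pivot

    valid⇒unforced : ∀ p K → 576 ≤ K → valid p K ≡ true → Unforced (L.map p (toList patterns))
    valid⇒unforced p K K≥ h = subst Unforced (toList-map p patterns)
      (certify-unforced K cells (V.replicate _ 0ℤ) directions (V.map p patterns) (p outlier) pivot K≥
        (subst (λ g → certify K cells (V.replicate _ 0ℤ) directions g (grad (p outlier) cells) pivot ≡ true)
          (map-∘ (λ σ → grad σ cells) p patterns) h))
  open Certificate

  -- Entries with the same pivot are images of one another under symmetries of the square, acting on
  -- template and patterns alike. The weights are large compared with the moves because the error
  -- bound grows like η² S² and the pivot like η S³.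
  certificates : List Certificate
  certificates =
      certificate (0 ∷ 5 ∷ 14 ∷ 16 ∷ []) 23 (4 , 15089731912) ((0 , 8602412498) ∷ (2 , 18159751739) ∷ (1 , 49545691353) ∷ (3 , 8602412498) ∷ [])
      ((0 , + 20593 ∷ + 16727 ∷ + 16727 ∷ + 125109 ∷ []) ∷ (1 , + 34258 ∷ + 48860 ∷ + 14934 ∷ + 85271 ∷ []) ∷ (2 , -[1+ 16744 ] ∷ + 101928 ∷ + 101928 ∷ + 162722 ∷ []) ∷ (4 , + 34258 ∷ + 14934 ∷ + 48860 ∷ + 85271 ∷ []) ∷ [])
      358017180928220112667788188875103404032
    ∷ certificate (23 ∷ 18 ∷ 9 ∷ 7 ∷ []) 0 (0 , 15089731912) ((4 , 8602412498) ∷ (2 , 18159751739) ∷ (3 , 49545691353) ∷ (1 , 8602412498) ∷ [])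
      ((0 , + 20593 ∷ + 16727 ∷ + 16727 ∷ + 125109 ∷ []) ∷ (1 , + 34258 ∷ + 48860 ∷ + 14934 ∷ + 85271 ∷ []) ∷ (2 , -[1+ 16744 ] ∷ + 101928 ∷ + 101928 ∷ + 162722 ∷ []) ∷ (4 , + 34258 ∷ + 14934 ∷ + 48860 ∷ + 85271 ∷ []) ∷ [])
      358017180928220112667788188875103404032
    ∷ certificate (0 ∷ 9 ∷ 16 ∷ 18 ∷ []) 5 (4 , 5443300515) ((0 , 13926447680) ∷ (2 , 3691289096) ∷ (3 , 50356338141) ∷ (1 , 26582624568) ∷ [])
      ((2 , + 57424 ∷ -[1+ 2343 ] ∷ + 82113 ∷ + 26663 ∷ []) ∷ (0 , -[1+ 3094 ] ∷ -[1+ 7460 ] ∷ + 16352 ∷ + 45461 ∷ []) ∷ (4 , + 100445 ∷ -[1+ 150773 ] ∷ + 292844 ∷ -[1+ 653 ] ∷ []) ∷ (1 , + 95111 ∷ -[1+ 103798 ] ∷ + 99700 ∷ + 3818 ∷ []) ∷ [])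
      490974040223931566970452204156973219840
    ∷ certificate (23 ∷ 14 ∷ 7 ∷ 5 ∷ []) 18 (0 , 5443300515) ((4 , 13926447680) ∷ (2 , 3691289096) ∷ (1 , 50356338141) ∷ (3 , 26582624568) ∷ [])
      ((2 , + 57424 ∷ -[1+ 2343 ] ∷ + 82113 ∷ + 26663 ∷ []) ∷ (0 , -[1+ 3094 ] ∷ -[1+ 7460 ] ∷ + 16352 ∷ + 45461 ∷ []) ∷ (4 , + 100445 ∷ -[1+ 150773 ] ∷ + 292844 ∷ -[1+ 653 ] ∷ []) ∷ (1 , + 95111 ∷ -[1+ 103798 ] ∷ + 99700 ∷ + 3818 ∷ []) ∷ [])
      490974040223931566970452204156973219840
    ∷ certificate (1 ∷ 3 ∷ 20 ∷ 22 ∷ []) 14 (0 , 9693814588) ((4 , 4737602702) ∷ (2 , 44543048913) ∷ (1 , 26021783824) ∷ (3 , 15003749972) ∷ [])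
      ((4 , + 76478 ∷ -[1+ 75060 ] ∷ -[1+ 10393 ] ∷ + 30975 ∷ []) ∷ (1 , + 15772 ∷ + 8741 ∷ + 25235 ∷ + 12140 ∷ []) ∷ (3 , + 165948 ∷ -[1+ 91046 ] ∷ -[1+ 49139 ] ∷ + 192050 ∷ []) ∷ (0 , + 74500 ∷ + 9317 ∷ + 492 ∷ + 50524 ∷ []) ∷ [])
      326887884838581000377807138109958127616
    ∷ certificate (1 ∷ 4 ∷ 15 ∷ 17 ∷ []) 14 (0 , 9693814588) ((3 , 26021783824) ∷ (2 , 44543048913) ∷ (4 , 15003749972) ∷ (1 , 4737602702) ∷ [])
      ((4 , + 15772 ∷ + 8741 ∷ + 25235 ∷ + 12140 ∷ []) ∷ (0 , + 74500 ∷ + 9317 ∷ + 492 ∷ + 50524 ∷ []) ∷ (1 , + 165948 ∷ -[1+ 91046 ] ∷ -[1+ 49139 ] ∷ + 192050 ∷ []) ∷ (3 , + 76478 ∷ -[1+ 75060 ] ∷ -[1+ 10393 ] ∷ + 30975 ∷ []) ∷ [])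
      326887884838581000377807138109958127616
    ∷ certificate (17 ∷ 11 ∷ 12 ∷ 6 ∷ []) 18 (3 , 15003749972) ((1 , 26021783824) ∷ (2 , 44543048913) ∷ (4 , 4737602702) ∷ (0 , 9693814588) ∷ [])
      ((3 , + 15772 ∷ + 8741 ∷ + 25235 ∷ + 12140 ∷ []) ∷ (0 , + 76478 ∷ -[1+ 75060 ] ∷ -[1+ 10393 ] ∷ + 30975 ∷ []) ∷ (1 , + 165948 ∷ -[1+ 91046 ] ∷ -[1+ 49139 ] ∷ + 192050 ∷ []) ∷ (4 , + 74500 ∷ + 9317 ∷ + 492 ∷ + 50524 ∷ []) ∷ [])
      326887884838581000377807138109958127616
    ∷ certificate (22 ∷ 19 ∷ 8 ∷ 6 ∷ []) 9 (4 , 9693814588) ((1 , 26021783824) ∷ (2 , 44543048913) ∷ (0 , 15003749972) ∷ (3 , 4737602702) ∷ [])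
      ((4 , + 15772 ∷ + 8741 ∷ + 25235 ∷ + 12140 ∷ []) ∷ (0 , + 74500 ∷ + 9317 ∷ + 492 ∷ + 50524 ∷ []) ∷ (1 , + 165948 ∷ -[1+ 91046 ] ∷ -[1+ 49139 ] ∷ + 192050 ∷ []) ∷ (3 , + 76478 ∷ -[1+ 75060 ] ∷ -[1+ 10393 ] ∷ + 30975 ∷ []) ∷ [])
      326887884838581000377807138109958127616
    ∷ certificate (1 ∷ 6 ∷ 17 ∷ 22 ∷ []) 5 (0 , 11995818984) ((3 , 17633847719) ∷ (2 , 40740666594) ∷ (1 , 17633847719) ∷ (4 , 11995818984) ∷ [])
      ((3 , + 17786 ∷ -[1+ 6231 ] ∷ -[1+ 13382 ] ∷ + 41660 ∷ []) ∷ (1 , + 17786 ∷ -[1+ 6231 ] ∷ + 41660 ∷ -[1+ 13382 ] ∷ []) ∷ (2 , -[1+ 42163 ] ∷ -[1+ 97654 ] ∷ -[1+ 59699 ] ∷ -[1+ 59699 ] ∷ []) ∷ (0 , + 16339 ∷ -[1+ 16338 ] ∷ + 0 ∷ + 0 ∷ []) ∷ [])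
      83988164865083942475124267762447286272
    ∷ certificate (1 ∷ 8 ∷ 17 ∷ 19 ∷ []) 18 (3 , 34895126657) ((0 , 11479846735) ∷ (1 , 26723665785) ∷ (4 , 11981519043) ∷ (2 , 14919841780) ∷ [])
      ((3 , + 14340 ∷ + 11358 ∷ + 6772 ∷ + 4356 ∷ []) ∷ (1 , -[1+ 25933 ] ∷ -[1+ 36108 ] ∷ -[1+ 39051 ] ∷ -[1+ 33512 ] ∷ []) ∷ (2 , + 24919 ∷ + 60073 ∷ + 11227 ∷ + 73348 ∷ []) ∷ (4 , + 19614 ∷ -[1+ 4497 ] ∷ + 20780 ∷ + 1087 ∷ []) ∷ [])
      62106097173379262224376577850439892992
    ∷ certificate (1 ∷ 12 ∷ 22 ∷ 11 ∷ []) 9 (1 , 11479846735) ((2 , 26723665785) ∷ (4 , 14919841780) ∷ (0 , 34895126657) ∷ (3 , 11981519043) ∷ [])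
      ((4 , + 14340 ∷ + 11358 ∷ + 6772 ∷ + 4356 ∷ []) ∷ (0 , -[1+ 25933 ] ∷ -[1+ 36108 ] ∷ -[1+ 39051 ] ∷ -[1+ 33512 ] ∷ []) ∷ (1 , + 24919 ∷ + 60073 ∷ + 11227 ∷ + 73348 ∷ []) ∷ (2 , + 19614 ∷ -[1+ 4497 ] ∷ + 20780 ∷ + 1087 ∷ []) ∷ [])
      62106097173379262224376577850439892992
    ∷ certificate (22 ∷ 15 ∷ 6 ∷ 4 ∷ []) 5 (1 , 34895126657) ((4 , 11479846735) ∷ (3 , 26723665785) ∷ (0 , 11981519043) ∷ (2 , 14919841780) ∷ [])
      ((3 , + 14340 ∷ + 11358 ∷ + 6772 ∷ + 4356 ∷ []) ∷ (1 , -[1+ 25933 ] ∷ -[1+ 36108 ] ∷ -[1+ 39051 ] ∷ -[1+ 33512 ] ∷ []) ∷ (2 , + 24919 ∷ + 60073 ∷ + 11227 ∷ + 73348 ∷ []) ∷ (4 , + 19614 ∷ -[1+ 4497 ] ∷ + 20780 ∷ + 1087 ∷ []) ∷ [])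
      62106097173379262224376577850439892992
    ∷ certificate (17 ∷ 20 ∷ 6 ∷ 3 ∷ []) 5 (3 , 11981519043) ((0 , 34895126657) ∷ (4 , 14919841780) ∷ (2 , 26723665785) ∷ (1 , 11479846735) ∷ [])
      ((0 , + 14340 ∷ + 11358 ∷ + 6772 ∷ + 4356 ∷ []) ∷ (4 , -[1+ 25933 ] ∷ -[1+ 36108 ] ∷ -[1+ 39051 ] ∷ -[1+ 33512 ] ∷ []) ∷ (3 , + 24919 ∷ + 60073 ∷ + 11227 ∷ + 73348 ∷ []) ∷ (2 , + 19614 ∷ -[1+ 4497 ] ∷ + 20780 ∷ + 1087 ∷ []) ∷ [])
      62106097173379262224376577850439892992
    ∷ certificate (2 ∷ 3 ∷ 12 ∷ 13 ∷ []) 6 (2 , 25973657243) ((0 , 20958795735) ∷ (3 , 13335253221) ∷ (4 , 32973969265) ∷ (1 , 6758324538) ∷ [])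
      ((4 , + 15769 ∷ + 25426 ∷ + 2090 ∷ + 31774 ∷ []) ∷ (3 , -[1+ 55660 ] ∷ + 175407 ∷ + 15028 ∷ -[1+ 100878 ] ∷ []) ∷ (2 , + 159969 ∷ + 17854 ∷ + 41289 ∷ + 64191 ∷ []) ∷ (1 , + 51071 ∷ + 98229 ∷ + 113172 ∷ + 11596 ∷ []) ∷ [])
      397813755226488155908605299636737933312
    ∷ certificate (2 ∷ 4 ∷ 8 ∷ 10 ∷ []) 6 (1 , 20958795735) ((4 , 6758324538) ∷ (0 , 25973657243) ∷ (2 , 13335253221) ∷ (3 , 32973969265) ∷ [])
      ((1 , + 15769 ∷ + 25426 ∷ + 2090 ∷ + 31774 ∷ []) ∷ (4 , -[1+ 55660 ] ∷ + 175407 ∷ + 15028 ∷ -[1+ 100878 ] ∷ []) ∷ (3 , + 159969 ∷ + 17854 ∷ + 41289 ∷ + 64191 ∷ []) ∷ (0 , + 51071 ∷ + 98229 ∷ + 113172 ∷ + 11596 ∷ []) ∷ [])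
      397813755226488155908605299636737933312
    ∷ certificate (21 ∷ 20 ∷ 11 ∷ 10 ∷ []) 17 (2 , 25973657243) ((4 , 20958795735) ∷ (1 , 13335253221) ∷ (0 , 32973969265) ∷ (3 , 6758324538) ∷ [])
      ((4 , + 15769 ∷ + 25426 ∷ + 2090 ∷ + 31774 ∷ []) ∷ (3 , -[1+ 55660 ] ∷ + 175407 ∷ + 15028 ∷ -[1+ 100878 ] ∷ []) ∷ (2 , + 159969 ∷ + 17854 ∷ + 41289 ∷ + 64191 ∷ []) ∷ (1 , + 51071 ∷ + 98229 ∷ + 113172 ∷ + 11596 ∷ []) ∷ [])
      397813755226488155908605299636737933312
    ∷ certificate (21 ∷ 15 ∷ 19 ∷ 13 ∷ []) 22 (3 , 32973969265) ((2 , 13335253221) ∷ (0 , 25973657243) ∷ (4 , 6758324538) ∷ (1 , 20958795735) ∷ [])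
      ((3 , + 15769 ∷ + 25426 ∷ + 2090 ∷ + 31774 ∷ []) ∷ (0 , -[1+ 55660 ] ∷ + 175407 ∷ + 15028 ∷ -[1+ 100878 ] ∷ []) ∷ (1 , + 159969 ∷ + 17854 ∷ + 41289 ∷ + 64191 ∷ []) ∷ (4 , + 51071 ∷ + 98229 ∷ + 113172 ∷ + 11596 ∷ []) ∷ [])
      397813755226488155908605299636737933312
    ∷ certificate (2 ∷ 7 ∷ 16 ∷ 21 ∷ []) 14 (2 , 1304217959) ((3 , 61785082686) ∷ (0 , 3566797598) ∷ (1 , 17566583405) ∷ (4 , 15777318352) ∷ [])
      ((2 , + 22082 ∷ + 29963 ∷ + 26739 ∷ + 33977 ∷ []) ∷ (4 , -[1+ 8054 ] ∷ + 349 ∷ -[1+ 3737 ] ∷ -[1+ 18885 ] ∷ []) ∷ (3 , -[1+ 57430 ] ∷ -[1+ 61798 ] ∷ -[1+ 39177 ] ∷ -[1+ 91294 ] ∷ []) ∷ (0 , -[1+ 3571 ] ∷ -[1+ 13326 ] ∷ -[1+ 4785 ] ∷ -[1+ 19460 ] ∷ []) ∷ [])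
      78345325065782043624985086301489332224
    ∷ certificate (3 ∷ 11 ∷ 14 ∷ 18 ∷ []) 13 (3 , 20328911127) ((1 , 10700939744) ∷ (0 , 8175292219) ∷ (4 , 29116945007) ∷ (2 , 31677911902) ∷ [])
      ((4 , -[1+ 1434 ] ∷ -[1+ 2429 ] ∷ -[1+ 1317 ] ∷ -[1+ 1744 ] ∷ []) ∷ (2 , -[1+ 7080 ] ∷ -[1+ 12725 ] ∷ -[1+ 5823 ] ∷ -[1+ 14421 ] ∷ []) ∷ (0 , -[1+ 620 ] ∷ + 428 ∷ + 339 ∷ + 466 ∷ []) ∷ (1 , + 7310 ∷ + 12589 ∷ + 6245 ∷ + 15032 ∷ []) ∷ [])
      3360220288531961131946459951414640640
    ∷ certificate (4 ∷ 19 ∷ 14 ∷ 9 ∷ []) 10 (2 , 8175292219) ((1 , 10700939744) ∷ (4 , 31677911902) ∷ (0 , 20328911127) ∷ (3 , 29116945007) ∷ [])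
      ((2 , -[1+ 1434 ] ∷ -[1+ 2429 ] ∷ -[1+ 1317 ] ∷ -[1+ 1744 ] ∷ []) ∷ (0 , -[1+ 7080 ] ∷ -[1+ 12725 ] ∷ -[1+ 5823 ] ∷ -[1+ 14421 ] ∷ []) ∷ (3 , -[1+ 620 ] ∷ + 428 ∷ + 339 ∷ + 466 ∷ []) ∷ (1 , + 7310 ∷ + 12589 ∷ + 6245 ∷ + 15032 ∷ []) ∷ [])
      3360220288531961131946459951414640640
    ∷ certificate (20 ∷ 12 ∷ 9 ∷ 5 ∷ []) 10 (1 , 20328911127) ((3 , 10700939744) ∷ (4 , 8175292219) ∷ (0 , 29116945007) ∷ (2 , 31677911902) ∷ [])
      ((4 , -[1+ 1434 ] ∷ -[1+ 2429 ] ∷ -[1+ 1317 ] ∷ -[1+ 1744 ] ∷ []) ∷ (2 , -[1+ 7080 ] ∷ -[1+ 12725 ] ∷ -[1+ 5823 ] ∷ -[1+ 14421 ] ∷ []) ∷ (0 , -[1+ 620 ] ∷ + 428 ∷ + 339 ∷ + 466 ∷ []) ∷ (1 , + 7310 ∷ + 12589 ∷ + 6245 ∷ + 15032 ∷ []) ∷ [])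
      3360220288531961131946459951414640640
    ∷ certificate (15 ∷ 8 ∷ 18 ∷ 5 ∷ []) 13 (3 , 29116945007) ((0 , 20328911127) ∷ (4 , 31677911902) ∷ (1 , 10700939744) ∷ (2 , 8175292219) ∷ [])
      ((2 , -[1+ 1434 ] ∷ -[1+ 2429 ] ∷ -[1+ 1317 ] ∷ -[1+ 1744 ] ∷ []) ∷ (4 , -[1+ 7080 ] ∷ -[1+ 12725 ] ∷ -[1+ 5823 ] ∷ -[1+ 14421 ] ∷ []) ∷ (1 , -[1+ 620 ] ∷ + 428 ∷ + 339 ∷ + 466 ∷ []) ∷ (3 , + 7310 ∷ + 12589 ∷ + 6245 ∷ + 15032 ∷ []) ∷ [])
      3360220288531961131946459951414640640
    ∷ certificate (5 ∷ 9 ∷ 14 ∷ 18 ∷ []) 0 (3 , 3997934430) ((1 , 24030050289) ∷ (2 , 60603746164) ∷ (0 , 3997934430) ∷ (4 , 7370334686) ∷ [])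
      ((3 , -[1+ 32514 ] ∷ + 40038 ∷ + 6815 ∷ + 515 ∷ []) ∷ (0 , -[1+ 32514 ] ∷ + 515 ∷ + 6815 ∷ + 40038 ∷ []) ∷ (4 , -[1+ 105296 ] ∷ -[1+ 36423 ] ∷ + 27523 ∷ -[1+ 36423 ] ∷ []) ∷ (1 , -[1+ 512581 ] ∷ -[1+ 66632 ] ∷ -[1+ 418976 ] ∷ -[1+ 66632 ] ∷ []) ∷ [])
      848365340279732328184220291699759382528
    ∷ certificate (0 ∷ 1 ∷ 6 ∷ 7 ∷ []) 9 (2 , 11148273676) ((0 , 13631891992) ∷ (4 , 15303552239) ∷ (3 , 12063309771) ∷ (5 , 15529573244) ∷ (1 , 32323399077) ∷ [])
      ((2 , + 123326 ∷ -[1+ 117506 ] ∷ -[1+ 73536 ] ∷ + 101510 ∷ []) ∷ (0 , -[1+ 27163 ] ∷ -[1+ 16659 ] ∷ + 50083 ∷ -[1+ 4660 ] ∷ []) ∷ (4 , + 34759 ∷ + 13485 ∷ + 5564 ∷ -[1+ 30017 ] ∷ []) ∷ (1 , + 325 ∷ + 4578 ∷ + 4832 ∷ + 19995 ∷ []) ∷ [])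
      163561158167797624074617652357208473600
    ∷ certificate (23 ∷ 22 ∷ 17 ∷ 16 ∷ []) 14 (3 , 11148273676) ((5 , 13631891992) ∷ (1 , 15303552239) ∷ (2 , 12063309771) ∷ (0 , 15529573244) ∷ (4 , 32323399077) ∷ [])
      ((2 , + 123326 ∷ -[1+ 117506 ] ∷ -[1+ 73536 ] ∷ + 101510 ∷ []) ∷ (0 , -[1+ 27163 ] ∷ -[1+ 16659 ] ∷ + 50083 ∷ -[1+ 4660 ] ∷ []) ∷ (4 , + 34759 ∷ + 13485 ∷ + 5564 ∷ -[1+ 30017 ] ∷ []) ∷ (1 , + 325 ∷ + 4578 ∷ + 4832 ∷ + 19995 ∷ []) ∷ [])
      163561158167797624074617652357208473600
    ∷ certificate (0 ∷ 10 ∷ 13 ∷ 23 ∷ []) 9 (2 , 13081404463) ((3 , 13081404463) ∷ (5 , 15116834490) ∷ (0 , 15472017861) ∷ (4 , 28131504233) ∷ (1 , 15116834490) ∷ [])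
      ((4 , + 73500 ∷ + 80545 ∷ + 95034 ∷ + 102926 ∷ []) ∷ (3 , + 5413 ∷ + 40013 ∷ + 40516 ∷ + 22890 ∷ []) ∷ (5 , -[1+ 10809 ] ∷ -[1+ 5756 ] ∷ + 9706 ∷ + 11116 ∷ []) ∷ (2 , -[1+ 10809 ] ∷ + 12804 ∷ -[1+ 8854 ] ∷ + 11116 ∷ []) ∷ [])
      121745607289785957742832163259120877568
    ∷ certificate (2 ∷ 10 ∷ 15 ∷ 19 ∷ []) 13 (5 , 4905435972) ((0 , 6396581151) ∷ (2 , 32479052193) ∷ (4 , 19692007724) ∷ (1 , 26442559623) ∷ (3 , 10084363337) ∷ [])
      ((1 , + 20002 ∷ -[1+ 38473 ] ∷ -[1+ 51610 ] ∷ -[1+ 24389 ] ∷ []) ∷ (5 , + 749 ∷ + 48835 ∷ -[1+ 46647 ] ∷ + 1498 ∷ []) ∷ (4 , -[1+ 161359 ] ∷ -[1+ 118524 ] ∷ -[1+ 295169 ] ∷ -[1+ 201382 ] ∷ []) ∷ (0 , -[1+ 10409 ] ∷ -[1+ 1075 ] ∷ + 164 ∷ + 37163 ∷ []) ∷ [])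
      463748133924029668589523499180273696768
    ∷ certificate (2 ∷ 13 ∷ 20 ∷ 11 ∷ []) 10 (1 , 6396581151) ((4 , 26442559623) ∷ (2 , 32479052193) ∷ (5 , 10084363337) ∷ (3 , 19692007724) ∷ (0 , 4905435972) ∷ [])
      ((1 , -[1+ 161359 ] ∷ -[1+ 118524 ] ∷ -[1+ 295169 ] ∷ -[1+ 201382 ] ∷ []) ∷ (0 , + 20002 ∷ -[1+ 38473 ] ∷ -[1+ 51610 ] ∷ -[1+ 24389 ] ∷ []) ∷ (5 , -[1+ 10409 ] ∷ -[1+ 1075 ] ∷ + 164 ∷ + 37163 ∷ []) ∷ (3 , + 749 ∷ + 48835 ∷ -[1+ 46647 ] ∷ + 1498 ∷ []) ∷ [])
      463748133924029668589523499180273696768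
    ∷ certificate (21 ∷ 13 ∷ 8 ∷ 4 ∷ []) 10 (0 , 4905435972) ((5 , 6396581151) ∷ (3 , 32479052193) ∷ (1 , 19692007724) ∷ (4 , 26442559623) ∷ (2 , 10084363337) ∷ [])
      ((1 , + 20002 ∷ -[1+ 38473 ] ∷ -[1+ 51610 ] ∷ -[1+ 24389 ] ∷ []) ∷ (5 , + 749 ∷ + 48835 ∷ -[1+ 46647 ] ∷ + 1498 ∷ []) ∷ (4 , -[1+ 161359 ] ∷ -[1+ 118524 ] ∷ -[1+ 295169 ] ∷ -[1+ 201382 ] ∷ []) ∷ (0 , -[1+ 10409 ] ∷ -[1+ 1075 ] ∷ + 164 ∷ + 37163 ∷ []) ∷ [])
      463748133924029668589523499180273696768
    ∷ certificate (21 ∷ 10 ∷ 12 ∷ 3 ∷ []) 13 (0 , 4905435972) ((3 , 19692007724) ∷ (5 , 10084363337) ∷ (2 , 32479052193) ∷ (4 , 26442559623) ∷ (1 , 6396581151) ∷ [])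
      ((4 , -[1+ 161359 ] ∷ -[1+ 118524 ] ∷ -[1+ 295169 ] ∷ -[1+ 201382 ] ∷ []) ∷ (2 , + 749 ∷ + 48835 ∷ -[1+ 46647 ] ∷ + 1498 ∷ []) ∷ (0 , -[1+ 10409 ] ∷ -[1+ 1075 ] ∷ + 164 ∷ + 37163 ∷ []) ∷ (5 , + 20002 ∷ -[1+ 38473 ] ∷ -[1+ 51610 ] ∷ -[1+ 24389 ] ∷ []) ∷ [])
      463748133924029668589523499180273696768
    ∷ certificate (3 ∷ 5 ∷ 9 ∷ 11 ∷ []) 14 (1 , 9134357551) ((4 , 14910685020) ∷ (3 , 26367472119) ∷ (0 , 17795725658) ∷ (5 , 22289328254) ∷ (2 , 9502431399) ∷ [])
      ((5 , -[1+ 17248 ] ∷ + 37344 ∷ + 10828 ∷ -[1+ 28636 ] ∷ []) ∷ (2 , -[1+ 34752 ] ∷ -[1+ 12 ] ∷ + 69735 ∷ + 51492 ∷ []) ∷ (1 , -[1+ 69952 ] ∷ + 95693 ∷ -[1+ 43321 ] ∷ -[1+ 17335 ] ∷ []) ∷ (0 , + 13592 ∷ -[1+ 8949 ] ∷ + 52 ∷ + 38479 ∷ []) ∷ [])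
      119782706981084154923891973160993554432
    ∷ certificate (4 ∷ 5 ∷ 18 ∷ 19 ∷ []) 14 (3 , 17795725658) ((0 , 9134357551) ∷ (5 , 9502431399) ∷ (2 , 26367472119) ∷ (1 , 14910685020) ∷ (4 , 22289328254) ∷ [])
      ((4 , -[1+ 69952 ] ∷ + 95693 ∷ -[1+ 43321 ] ∷ -[1+ 17335 ] ∷ []) ∷ (3 , -[1+ 34752 ] ∷ -[1+ 12 ] ∷ + 69735 ∷ + 51492 ∷ []) ∷ (2 , -[1+ 17248 ] ∷ + 37344 ∷ + 10828 ∷ -[1+ 28636 ] ∷ []) ∷ (1 , + 13592 ∷ -[1+ 8949 ] ∷ + 52 ∷ + 38479 ∷ []) ∷ [])
      119782706981084154923891973160993554432
    ∷ certificate (20 ∷ 18 ∷ 14 ∷ 12 ∷ []) 9 (4 , 9134357551) ((1 , 14910685020) ∷ (2 , 26367472119) ∷ (5 , 17795725658) ∷ (0 , 22289328254) ∷ (3 , 9502431399) ∷ [])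
      ((5 , -[1+ 17248 ] ∷ + 37344 ∷ + 10828 ∷ -[1+ 28636 ] ∷ []) ∷ (2 , -[1+ 34752 ] ∷ -[1+ 12 ] ∷ + 69735 ∷ + 51492 ∷ []) ∷ (1 , -[1+ 69952 ] ∷ + 95693 ∷ -[1+ 43321 ] ∷ -[1+ 17335 ] ∷ []) ∷ (0 , + 13592 ∷ -[1+ 8949 ] ∷ + 52 ∷ + 38479 ∷ []) ∷ [])
      119782706981084154923891973160993554432
    ∷ certificate (15 ∷ 9 ∷ 14 ∷ 8 ∷ []) 18 (4 , 22289328254) ((1 , 14910685020) ∷ (2 , 26367472119) ∷ (5 , 9502431399) ∷ (0 , 9134357551) ∷ (3 , 17795725658) ∷ [])
      ((1 , -[1+ 69952 ] ∷ + 95693 ∷ -[1+ 43321 ] ∷ -[1+ 17335 ] ∷ []) ∷ (3 , -[1+ 17248 ] ∷ + 37344 ∷ + 10828 ∷ -[1+ 28636 ] ∷ []) ∷ (4 , + 13592 ∷ -[1+ 8949 ] ∷ + 52 ∷ + 38479 ∷ []) ∷ (2 , -[1+ 34752 ] ∷ -[1+ 12 ] ∷ + 69735 ∷ + 51492 ∷ []) ∷ [])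
      119782706981084154923891973160993554432
    ∷ certificate (3 ∷ 11 ∷ 12 ∷ 20 ∷ []) 7 (5 , 5136330522) ((2 , 4513020356) ∷ (1 , 40350649122) ∷ (4 , 40350649122) ∷ (3 , 4513020356) ∷ (0 , 5136330522) ∷ [])
      ((5 , -[1+ 55763 ] ∷ + 193678 ∷ + 28943 ∷ + 47836 ∷ []) ∷ (1 , + 97995 ∷ + 206661 ∷ + 397268 ∷ + 206661 ∷ []) ∷ (0 , + 28943 ∷ + 47836 ∷ -[1+ 55763 ] ∷ + 193678 ∷ []) ∷ (4 , + 397268 ∷ + 206661 ∷ + 97995 ∷ + 206661 ∷ []) ∷ [])
      2529373408461181395577901866838940188672
    ∷ certificate (4 ∷ 19 ∷ 8 ∷ 15 ∷ []) 7 (5 , 5136330522) ((2 , 40350649122) ∷ (1 , 4513020356) ∷ (4 , 4513020356) ∷ (3 , 40350649122) ∷ (0 , 5136330522) ∷ [])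
      ((0 , -[1+ 55763 ] ∷ + 193678 ∷ + 28943 ∷ + 47836 ∷ []) ∷ (2 , + 97995 ∷ + 206661 ∷ + 397268 ∷ + 206661 ∷ []) ∷ (5 , + 28943 ∷ + 47836 ∷ -[1+ 55763 ] ∷ + 193678 ∷ []) ∷ (3 , + 397268 ∷ + 206661 ∷ + 97995 ∷ + 206661 ∷ []) ∷ [])
      2529373408461181395577901866838940188672
    ∷ certificate (0 ∷ 7 ∷ 17 ∷ 22 ∷ []) 16 (3 , 23544914429) ((6 , 12560163724) ∷ (1 , 18793016550) ∷ (4 , 19421894384) ∷ (0 , 3637041635) ∷ (2 , 14505839845) ∷ (5 , 7537129433) ∷ [])
      ((0 , + 20315 ∷ + 17576 ∷ + 24321 ∷ + 17106 ∷ []) ∷ (4 , -[1+ 332 ] ∷ -[1+ 5473 ] ∷ + 1619 ∷ -[1+ 4540 ] ∷ []) ∷ (1 , + 15798 ∷ + 11545 ∷ + 12367 ∷ + 22571 ∷ []) ∷ (6 , + 10411 ∷ + 3229 ∷ + 7654 ∷ + 9157 ∷ []) ∷ [])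
      14043598109651777499247972072799862784
    ∷ certificate (23 ∷ 16 ∷ 6 ∷ 1 ∷ []) 7 (3 , 23544914429) ((0 , 12560163724) ∷ (5 , 18793016550) ∷ (2 , 19421894384) ∷ (6 , 3637041635) ∷ (4 , 14505839845) ∷ (1 , 7537129433) ∷ [])
      ((0 , + 20315 ∷ + 17576 ∷ + 24321 ∷ + 17106 ∷ []) ∷ (4 , -[1+ 332 ] ∷ -[1+ 5473 ] ∷ + 1619 ∷ -[1+ 4540 ] ∷ []) ∷ (1 , + 15798 ∷ + 11545 ∷ + 12367 ∷ + 22571 ∷ []) ∷ (6 , + 10411 ∷ + 3229 ∷ + 7654 ∷ + 9157 ∷ []) ∷ [])
      14043598109651777499247972072799862784
    ∷ certificate (7 ∷ 10 ∷ 13 ∷ 16 ∷ []) 6 (4 , 17301568611) ((7 , 12123371990) ∷ (3 , 7807087271) ∷ (0 , 16450011051) ∷ (5 , 16999726674) ∷ (6 , 16999726674) ∷ (2 , 6159253864) ∷ (1 , 6159253864) ∷ [])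
      ((1 , -[1+ 26204 ] ∷ + 29640 ∷ + 5596 ∷ + 16770 ∷ []) ∷ (3 , + 8202 ∷ + 101987 ∷ + 104031 ∷ + 658 ∷ []) ∷ (2 , -[1+ 114578 ] ∷ + 104772 ∷ + 80735 ∷ -[1+ 84494 ] ∷ []) ∷ (6 , -[1+ 30576 ] ∷ -[1+ 22047 ] ∷ + 11394 ∷ + 15426 ∷ []) ∷ [])
      237728407231619227008447145785205719040
    ∷ certificate (0 ∷ 2 ∷ 21 ∷ 23 ∷ []) 10 (8 , 6779917964) ((3 , 16166152973) ∷ (0 , 10546746558) ∷ (5 , 9439425460) ∷ (4 , 9448562560) ∷ (1 , 14655158944) ∷ (7 , 10497820634) ∷ (6 , 10545437251) ∷ (2 , 11920777656) ∷ [])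
      ((4 , -[1+ 22777 ] ∷ + 34894 ∷ + 38810 ∷ -[1+ 38817 ] ∷ []) ∷ (0 , + 32057 ∷ -[1+ 6142 ] ∷ + 4757 ∷ + 18703 ∷ []) ∷ (2 , + 80555 ∷ -[1+ 12440 ] ∷ + 2722 ∷ + 32334 ∷ []) ∷ (1 , + 5255 ∷ + 4768 ∷ + 53497 ∷ -[1+ 56987 ] ∷ []) ∷ [])
      82316335658867824336339618222758166528
    ∷ certificate (0 ∷ 7 ∷ 16 ∷ 23 ∷ []) 10 (3 , 7540697763) ((7 , 7285385790) ∷ (11 , 3143704881) ∷ (15 , 7540697763) ∷ (2 , 3143704881) ∷ (6 , 7030211566) ∷ (10 , 7030211566) ∷ (14 , 7285385790) ∷ (1 , 7285385790) ∷ (5 , 7030211566) ∷ (9 , 7030211566) ∷ (13 , 3143704881) ∷ (0 , 7540697763) ∷ (4 , 3143704881) ∷ (8 , 7285385790) ∷ (12 , 7540697763) ∷ [])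
      ((12 , -[1+ 4279 ] ∷ -[1+ 7212 ] ∷ -[1+ 8278 ] ∷ -[1+ 1292 ] ∷ []) ∷ (5 , + 20797 ∷ + 24403 ∷ + 11450 ∷ + 28413 ∷ []) ∷ (6 , + 28413 ∷ + 11450 ∷ + 24403 ∷ + 20797 ∷ []) ∷ (15 , -[1+ 1292 ] ∷ -[1+ 8278 ] ∷ -[1+ 7212 ] ∷ -[1+ 4279 ] ∷ []) ∷ [])
      18683804635517326749394611343668019200
    ∷ certificate (2 ∷ 10 ∷ 13 ∷ 21 ∷ []) 0 (41 , 59795805) ((26 , 1846636396) ∷ (23 , 386329011) ∷ (24 , 3007257628) ∷ (3 , 2272708288) ∷ (31 , 618396688) ∷ (5 , 1882319154) ∷ (4 , 1880068219) ∷ (28 , 2974404107) ∷ (27 , 3741407024) ∷ (12 , 2796913974) ∷ (11 , 2840888114) ∷ (35 , 2547218000) ∷ (9 , 3304046952) ∷ (34 , 2601036163) ∷ (33 , 3079686421) ∷ (39 , 2012800011) ∷ (16 , 2127332752) ∷ (40 , 2910954085) ∷ (19 , 3485191635) ∷ (20 , 3624609571) ∷ (21 , 3624609571) ∷ (22 , 3485191635) ∷ (1 , 2910954085) ∷ (25 , 2127332752) ∷ (2 , 2012800011) ∷ (8 , 3079686421) ∷ (7 , 2601036163) ∷ (32 , 3304046952) ∷ (6 , 2547218000) ∷ (30 , 2840888114) ∷ (29 , 2796913974) ∷ (14 , 3741407024) ∷ (13 , 2974404107) ∷ (37 , 1880068219) ∷ (36 , 1882319154) ∷ (10 , 618396688)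 ∷ (38 , 2272708288) ∷ (17 , 3007257628) ∷ (18 , 386329011) ∷ (15 , 1846636396) ∷ (0 , 59795805) ∷ [])
      ((40 , -[1+ 145 ] ∷ + 64 ∷ + 926 ∷ + 278 ∷ []) ∷ (0 , + 5568 ∷ + 6047 ∷ + 6191 ∷ + 6184 ∷ []) ∷ (18 , -[1+ 25 ] ∷ + 1132 ∷ + 292 ∷ + 461 ∷ []) ∷ (22 , -[1+ 15961 ] ∷ -[1+ 17249 ] ∷ -[1+ 17802 ] ∷ -[1+ 16830 ] ∷ []) ∷ [])
      3755552325880679432579044673698398208
    ∷ []

-- Starts at the uniform grid

module FrameData where

  open Sums
  open QuadrilinearForms
  open Checking
  open import Data.Bool using (Bool; true; _∧_; if_then_else_)
  open import Data.Fin using (Fin; toℕ; suc)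
  open import Data.Fin.Patterns
  import Data.Fin.Permutation as Pm
  open import Data.Integer as ℤ using (ℤ; +_; -[1+_])
  open import Data.List as L using (List; []; _∷_)
  open import Data.List.Relation.Unary.All as All using (All; []; _∷_)
  import Data.List.Relation.Unary.All.Properties as AllP
  open import Data.Nat as ℕ using (ℕ; suc; _≤_; _≡ᵇ_)
  open import Data.Product using (_×_; _,_; proj₁; proj₂)
  open import Data.Vec as V using (Vec; []; _∷_; lookup; tabulate; toList)
  open import Data.Vec.Properties using (toList-map; map-∘; map-cong)
  open Gradients
  open Covering
  open Certificates
  open import Relation.Binary.PropositionalEquality

  -- The pivot scales with the cube of the weight and the error bound only with its square, so a
  -- large weight makes the test succeed.
  grid : Vec Cell 16
  grid = V.concat (tabulate {n = 4} λ r → tabulate {n = 4} λ c → cell (toℕ r) (toℕ c) 10000000000000)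

  -- Columns of a multiple of the inverse of the matrix (b t r), where b t r is the
  -- total kw of the weakly increasing 4-tuples over 4 rows whose t-th entry is r.
  dual : Vec (Vec ℤ 4) 4
  dual = ((+ 75 ∷ -[1+ 64 ] ∷ + 35 ∷ -[1+ 8 ] ∷ []) ∷ (-[1+ 68 ] ∷ + 207 ∷ -[1+ 140 ] ∷ + 39 ∷ []) ∷ (+ 39 ∷ -[1+ 140 ] ∷ + 207 ∷ -[1+ 68 ] ∷ []) ∷ (-[1+ 8 ] ∷ + 35 ∷ -[1+ 64 ] ∷ + 75 ∷ []) ∷ [])

  -- Nine permutations spanning the permutation matrices modulo the all-ones matrix,
  -- each with the element of the dual basis (scaled by 4) vanishing on the other eight.
  basis : Vec (ℕ × Vec (Vec ℤ 4) 4) 9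
  basis =
      (15 , ((-[1+ 0 ] ∷ + 0 ∷ + 2 ∷ -[1+ 0 ] ∷ []) ∷ (+ 0 ∷ + 1 ∷ -[1+ 0 ] ∷ + 0 ∷ []) ∷ (+ 1 ∷ -[1+ 1 ] ∷ + 0 ∷ + 1 ∷ []) ∷ (+ 0 ∷ + 1 ∷ -[1+ 0 ] ∷ + 0 ∷ []) ∷ []))
    ∷ (8 , ((+ 1 ∷ + 0 ∷ + 0 ∷ -[1+ 0 ] ∷ []) ∷ (-[1+ 1 ] ∷ + 1 ∷ + 1 ∷ + 0 ∷ []) ∷ (+ 1 ∷ + 0 ∷ + 0 ∷ -[1+ 0 ] ∷ []) ∷ (+ 0 ∷ -[1+ 0 ] ∷ -[1+ 0 ] ∷ + 2 ∷ []) ∷ []))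
    ∷ (9 , ((-[1+ 0 ] ∷ + 2 ∷ -[1+ 0 ] ∷ + 0 ∷ []) ∷ (+ 0 ∷ -[1+ 0 ] ∷ + 0 ∷ + 1 ∷ []) ∷ (+ 0 ∷ -[1+ 0 ] ∷ + 0 ∷ + 1 ∷ []) ∷ (+ 1 ∷ + 0 ∷ + 1 ∷ -[1+ 1 ] ∷ []) ∷ []))
    ∷ (17 , ((+ 2 ∷ -[1+ 0 ] ∷ + 0 ∷ -[1+ 0 ] ∷ []) ∷ (-[1+ 0 ] ∷ + 0 ∷ + 1 ∷ + 0 ∷ []) ∷ (-[1+ 1 ] ∷ + 3 ∷ + 0 ∷ -[1+ 0 ] ∷ []) ∷ (+ 1 ∷ -[1+ 1 ] ∷ -[1+ 0 ] ∷ + 2 ∷ []) ∷ []))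
    ∷ (1 , ((+ 2 ∷ + 0 ∷ -[1+ 0 ] ∷ -[1+ 0 ] ∷ []) ∷ (-[1+ 0 ] ∷ + 1 ∷ + 0 ∷ + 0 ∷ []) ∷ (-[1+ 0 ] ∷ + 1 ∷ + 0 ∷ + 0 ∷ []) ∷ (+ 0 ∷ -[1+ 1 ] ∷ + 1 ∷ + 1 ∷ []) ∷ []))
    ∷ (5 , ((+ 0 ∷ + 1 ∷ + 0 ∷ -[1+ 0 ] ∷ []) ∷ (-[1+ 0 ] ∷ + 0 ∷ -[1+ 0 ] ∷ + 2 ∷ []) ∷ (+ 1 ∷ -[1+ 1 ] ∷ + 1 ∷ + 0 ∷ []) ∷ (+ 0 ∷ + 1 ∷ + 0 ∷ -[1+ 0 ] ∷ []) ∷ []))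
    ∷ (6 , ((+ 1 ∷ + 0 ∷ + 0 ∷ -[1+ 0 ] ∷ []) ∷ (+ 1 ∷ + 0 ∷ + 0 ∷ -[1+ 0 ] ∷ []) ∷ (-[1+ 1 ] ∷ + 1 ∷ + 1 ∷ + 0 ∷ []) ∷ (+ 0 ∷ -[1+ 0 ] ∷ -[1+ 0 ] ∷ + 2 ∷ []) ∷ []))
    ∷ (21 , ((+ 1 ∷ -[1+ 0 ] ∷ -[1+ 0 ] ∷ + 1 ∷ []) ∷ (-[1+ 0 ] ∷ + 1 ∷ + 1 ∷ -[1+ 0 ] ∷ []) ∷ (-[1+ 0 ] ∷ + 1 ∷ + 1 ∷ -[1+ 0 ] ∷ []) ∷ (+ 1 ∷ -[1+ 0 ] ∷ -[1+ 0 ] ∷ + 1 ∷ []) ∷ []))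
    ∷ (3 , ((+ 2 ∷ -[1+ 1 ] ∷ + 0 ∷ + 0 ∷ []) ∷ (+ 0 ∷ + 0 ∷ + 2 ∷ -[1+ 1 ] ∷ []) ∷ (-[1+ 1 ] ∷ + 2 ∷ + 0 ∷ + 0 ∷ []) ∷ (+ 0 ∷ + 0 ∷ -[1+ 1 ] ∷ + 2 ∷ []) ∷ []))
    ∷ []

  -- Applying `dual` on both sides of a matrix V with zero sum undoes the smearing by rows and
  -- columns: at the grid, the derivative for ρ becomes a multiple of the sum of the V t (ρ t). Here
  -- V i j = W (h i) (g⁻¹ j), whose pairing with g b h is that of W with b.
  direction : Vec (Fin 4) 4 → Vec (Fin 4) 4 → Vec (Vec ℤ 4) 4 → Vec ℤ 16
  direction g⁻¹ h W = V.concat (tabulate {n = 4} λ r → spread (tabulate λ j →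
      dot (lookup dual r) (tabulate λ i → lookup (lookup W (lookup h i)) (lookup g⁻¹ j))))
    where
    spread : Vec ℤ 4 → Vec ℤ 4
    spread u = V.map (dot u) dual

  position : ℕ → List ℕ → ℕ
  position k [] = 0
  position k (x ∷ xs) = if k ≡ᵇ x then 0 else suc (position k xs)

  -- A pattern read as a base 4 numeral, so that a composite is recognised by comparing numbers.
  key : Vec (Fin 4) 4 → ℕ
  key = V.foldl′ (λ s i → 4 ℕ.* s ℕ.+ toℕ i) 0

  -- The translate g B h of the basis B, with its t-th element as the outlier.
  record Frame : Set where
    constructor frame
    field
      left right : ℕ
      outlier : Fin 9

  module _ {n r : ℕ} (v : Vec Cell (suc n)) (K L : ℕ) where

    -- The gradients at the grid come from a table common to all frames.
    byTable : List (Grad (suc n)) → Grad (suc n) → ℕ × Vec ℤ (suc n) → Vec (ℕ × Vec ℤ (suc n)) r → Bool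
    byTable table g₀ x xs = certify K v (proj₂ x) (V.map proj₂ xs) (V.map (λ y → nth g₀ table (proj₁ y)) xs) (nth g₀ table (proj₁ x)) L

    byTable⇒unforced : ∀ ρs x xs → 576 ≤ K → byTable (L.map (λ σ → grad σ v) ρs) (grad Pm.id v) x xs ≡ true →
                       Unforced (L.map (nth Pm.id ρs) (toList (V.map proj₁ xs)))
    byTable⇒unforced ρs x xs K≥ ok = subst Unforced (trans (cong toList (map-∘ (nth Pm.id ρs) proj₁ xs)) (toList-map (nth Pm.id ρs) (V.map proj₁ xs)))
      (certify-unforced K v (proj₂ x) (V.map proj₂ xs) (V.map (λ y → nth Pm.id ρs (proj₁ y)) xs) (nth Pm.id ρs (proj₁ x)) L K≥
        (subst₂ (λ gs g → certify K v (proj₂ x) (V.map proj₂ xs) gs g L ≡ true)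
          (trans (map-cong (λ y → nth-map gr Pm.id ρs (proj₁ y)) xs) (map-∘ gr (λ y → nth Pm.id ρs (proj₁ y)) xs))
          (nth-map gr Pm.id ρs (proj₁ x)) ok))
      where
      gr : Perm 4 → Grad (suc n)
      gr σ = grad σ v

  allᴸ : {A : Set} → (A → Bool) → List A → Bool
  allᴸ p [] = true
  allᴸ p (x ∷ xs) = p x ∧ allᴸ p xs

  allᴸ-All : {A : Set} (p : A → Bool) (xs : List A) → allᴸ p xs ≡ true → All (λ x → p x ≡ true) xs
  allᴸ-All p [] h = []
  allᴸ-All p (x ∷ xs) h = proj₁ (∧-true h) ∷ allᴸ-All p xs (proj₂ (∧-true {p x} h))

  module _ {A : Set} {n r : ℕ} (v : Vec Cell (suc n)) (K L : ℕ)
    (out : A → ℕ × Vec ℤ (suc n)) (kept : A → Vec (ℕ × Vec ℤ (suc n)) r) where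

    allByTable : List (Grad (suc n)) → Grad (suc n) → List A → Bool
    allByTable table g₀ = allᴸ (λ x → byTable v K L table g₀ (out x) (kept x))

    allByTable⇒unforced : ∀ ρs xs → 576 ≤ K → allByTable (L.map (λ σ → grad σ v) ρs) (grad Pm.id v) xs ≡ true →
      All (λ X → Unforced (L.map (nth Pm.id ρs) X)) (L.map (λ x → toList (V.map proj₁ (kept x))) xs)
    allByTable⇒unforced ρs xs K≥ h = AllP.map⁺ (All.map (λ {x} → byTable⇒unforced v K L ρs (out x) (kept x) K≥)
      (allᴸ-All (λ x → byTable v K L (L.map (λ σ → grad σ v) ρs) (grad Pm.id v) (out x) (kept x)) xs h))

  allValid⇒unforced : ∀ p K cs → 576 ≤ K → allᴸ (λ c → Certificate.valid c p K) cs ≡ true →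
    All (λ X → Unforced (L.map p X)) (L.map (λ c → toList (Certificate.patterns c)) cs)
  allValid⇒unforced p K cs K≥ h = AllP.map⁺ (All.map (λ {c} → Certificate.valid⇒unforced c p K K≥)
    (allᴸ-All (λ c → Certificate.valid c p K) cs h))

  -- Images and preimages of the elements of allPerms 4.
  codes : List (Vec (Fin 4) 4 × Vec (Fin 4) 4)
  codes =
      ((0F ∷ 1F ∷ 2F ∷ 3F ∷ []) , (0F ∷ 1F ∷ 2F ∷ 3F ∷ []))
    ∷ ((0F ∷ 1F ∷ 3F ∷ 2F ∷ []) , (0F ∷ 1F ∷ 3F ∷ 2F ∷ []))
    ∷ ((0F ∷ 2F ∷ 1F ∷ 3F ∷ []) , (0F ∷ 2F ∷ 1F ∷ 3F ∷ []))
    ∷ ((0F ∷ 2F ∷ 3F ∷ 1F ∷ []) , (0F ∷ 3F ∷ 1F ∷ 2F ∷ []))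
    ∷ ((0F ∷ 3F ∷ 1F ∷ 2F ∷ []) , (0F ∷ 2F ∷ 3F ∷ 1F ∷ []))
    ∷ ((0F ∷ 3F ∷ 2F ∷ 1F ∷ []) , (0F ∷ 3F ∷ 2F ∷ 1F ∷ []))
    ∷ ((1F ∷ 0F ∷ 2F ∷ 3F ∷ []) , (1F ∷ 0F ∷ 2F ∷ 3F ∷ []))
    ∷ ((1F ∷ 0F ∷ 3F ∷ 2F ∷ []) , (1F ∷ 0F ∷ 3F ∷ 2F ∷ []))
    ∷ ((1F ∷ 2F ∷ 0F ∷ 3F ∷ []) , (2F ∷ 0F ∷ 1F ∷ 3F ∷ []))
    ∷ ((1F ∷ 2F ∷ 3F ∷ 0F ∷ []) , (3F ∷ 0F ∷ 1F ∷ 2F ∷ []))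
    ∷ ((1F ∷ 3F ∷ 0F ∷ 2F ∷ []) , (2F ∷ 0F ∷ 3F ∷ 1F ∷ []))
    ∷ ((1F ∷ 3F ∷ 2F ∷ 0F ∷ []) , (3F ∷ 0F ∷ 2F ∷ 1F ∷ []))
    ∷ ((2F ∷ 0F ∷ 1F ∷ 3F ∷ []) , (1F ∷ 2F ∷ 0F ∷ 3F ∷ []))
    ∷ ((2F ∷ 0F ∷ 3F ∷ 1F ∷ []) , (1F ∷ 3F ∷ 0F ∷ 2F ∷ []))
    ∷ ((2F ∷ 1F ∷ 0F ∷ 3F ∷ []) , (2F ∷ 1F ∷ 0F ∷ 3F ∷ []))
    ∷ ((2F ∷ 1F ∷ 3F ∷ 0F ∷ []) , (3F ∷ 1F ∷ 0F ∷ 2F ∷ []))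
    ∷ ((2F ∷ 3F ∷ 0F ∷ 1F ∷ []) , (2F ∷ 3F ∷ 0F ∷ 1F ∷ []))
    ∷ ((2F ∷ 3F ∷ 1F ∷ 0F ∷ []) , (3F ∷ 2F ∷ 0F ∷ 1F ∷ []))
    ∷ ((3F ∷ 0F ∷ 1F ∷ 2F ∷ []) , (1F ∷ 2F ∷ 3F ∷ 0F ∷ []))
    ∷ ((3F ∷ 0F ∷ 2F ∷ 1F ∷ []) , (1F ∷ 3F ∷ 2F ∷ 0F ∷ []))
    ∷ ((3F ∷ 1F ∷ 0F ∷ 2F ∷ []) , (2F ∷ 1F ∷ 3F ∷ 0F ∷ []))
    ∷ ((3F ∷ 1F ∷ 2F ∷ 0F ∷ []) , (3F ∷ 1F ∷ 2F ∷ 0F ∷ []))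
    ∷ ((3F ∷ 2F ∷ 0F ∷ 1F ∷ []) , (2F ∷ 3F ∷ 1F ∷ 0F ∷ []))
    ∷ ((3F ∷ 2F ∷ 1F ∷ 0F ∷ []) , (3F ∷ 2F ∷ 1F ∷ 0F ∷ []))
    ∷ []

  keys : List ℕ
  keys = 27 ∷ 30 ∷ 39 ∷ 45 ∷ 54 ∷ 57 ∷ 75 ∷ 78 ∷ 99 ∷ 108 ∷ 114 ∷ 120 ∷ 135 ∷ 141 ∷ 147 ∷ 156 ∷ 177 ∷ 180 ∷ 198 ∷ 201 ∷ 210 ∷ 216 ∷ 225 ∷ 228 ∷ []

  code : ℕ → Vec (Fin 4) 4 × Vec (Fin 4) 4
  code = nth (V.replicate 4 0F , V.replicate 4 0F) codes

  -- These indices and directions are only proposed: `byTable⇒unforced` is sound for arbitrary ones,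
  -- so no correctness of the tables of codes and dual matrices has to be proved.
  elements : Frame → Vec (ℕ × Vec ℤ 16) 9
  elements (frame g h _) = V.map (λ (b , W) →
    position (key (V.map (λ i → lookup (proj₁ (code g)) (lookup (proj₁ (code b)) i)) (proj₁ (code h)))) keys ,
    direction (proj₂ (code g)) (proj₁ (code h)) W) basis

  -- The direction of the outlier becomes the shift e. To first order it moves the outlier by one
  -- pivot and, by duality, leaves the other eight patterns alone.
  out : Frame → ℕ × Vec ℤ 16
  out f = lookup (elements f) (Frame.outlier f)

  kept : Frame → Vec (ℕ × Vec ℤ 16) 8
  kept f = V.removeAt (elements f) (Frame.outlier f)

  -- This is 4 · 9216² · 10^39: the scale of the dual basis, the multiple of the inverse matrix in
  -- `dual` once for rows and once for columns, and the cube of the cell weight.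
  pivot : ℕ
  pivot = 339738624000000000000000000000000000000000000000

  -- The eight patterns kept by a frame settle 70 sets of four at once, so about four hundred frames
  -- are enough for all sets that are independent modulo the all-ones matrix.
  frames : List Frame
  frames =
      frame 23 15 1F ∷ frame 11 16 6F ∷ frame 14 7 0F ∷ frame 11 17 1F ∷ frame 19 4 0F ∷ frame 4 0 7F ∷ frame 22 15 0F ∷ frame 3 18 2F ∷
      frame 16 3 6F ∷ frame 13 15 7F ∷ frame 18 12 6F ∷ frame 3 20 0F ∷ frame 2 19 3F ∷ frame 4 1 2F ∷ frame 23 3 5F ∷ frame 2 4 4F ∷
      frame 16 6 0F ∷ frame 16 11 1F ∷ frame 16 7 0F ∷ frame 13 16 7F ∷ frame 7 13 1F ∷ frame 0 7 5F ∷ frame 22 22 6F ∷ frame 11 15 0F ∷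
      frame 11 7 5F ∷ frame 19 13 5F ∷ frame 3 11 7F ∷ frame 15 22 4F ∷ frame 8 14 5F ∷ frame 3 16 2F ∷ frame 19 1 6F ∷ frame 19 16 0F ∷
      frame 4 9 1F ∷ frame 16 15 2F ∷ frame 0 9 8F ∷ frame 4 21 0F ∷ frame 23 7 6F ∷ frame 10 3 3F ∷ frame 12 15 4F ∷ frame 0 8 6F ∷
      frame 10 12 7F ∷ frame 4 11 1F ∷ frame 2 16 0F ∷ frame 7 12 2F ∷ frame 12 20 5F ∷ frame 17 12 7F ∷ frame 18 18 7F ∷ frame 4 8 1F ∷
      frame 18 17 2F ∷ frame 7 7 3F ∷ frame 18 16 7F ∷ frame 0 21 7F ∷ frame 7 4 6F ∷ frame 17 23 7F ∷ frame 14 3 5F ∷ frame 3 0 3F ∷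
      frame 17 22 4F ∷ frame 9 15 6F ∷ frame 4 4 6F ∷ frame 11 8 0F ∷ frame 9 19 6F ∷ frame 20 21 4F ∷ frame 15 4 5F ∷ frame 13 8 8F ∷
      frame 15 1 2F ∷ frame 16 12 0F ∷ frame 12 17 4F ∷ frame 0 6 5F ∷ frame 14 19 6F ∷ frame 23 23 6F ∷ frame 5 3 3F ∷ frame 14 10 6F ∷
      frame 20 11 4F ∷ frame 22 19 2F ∷ frame 14 15 0F ∷ frame 4 20 6F ∷ frame 16 1 3F ∷ frame 23 19 7F ∷ frame 1 19 2F ∷ frame 12 8 7F ∷
      frame 22 16 2F ∷ frame 8 12 8F ∷ frame 13 23 2F ∷ frame 3 7 0F ∷ frame 0 4 4F ∷ frame 2 20 3F ∷ frame 0 14 5F ∷ frame 17 11 7F ∷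
      frame 0 2 4F ∷ frame 21 4 5F ∷ frame 9 12 3F ∷ frame 5 16 6F ∷ frame 12 19 2F ∷ frame 19 0 3F ∷ frame 2 23 3F ∷ frame 22 23 5F ∷
      frame 10 22 4F ∷ frame 19 8 6F ∷ frame 4 5 2F ∷ frame 14 18 7F ∷ frame 6 3 6F ∷ frame 20 20 1F ∷ frame 22 8 6F ∷ frame 17 16 7F ∷
      frame 21 16 5F ∷ frame 9 6 6F ∷ frame 7 20 3F ∷ frame 0 12 6F ∷ frame 12 21 0F ∷ frame 18 13 7F ∷ frame 23 0 2F ∷ frame 1 11 3F ∷
      frame 12 0 3F ∷ frame 5 0 3F ∷ frame 12 3 0F ∷ frame 8 0 5F ∷ frame 11 18 1F ∷ frame 23 4 0F ∷ frame 18 8 2F ∷ frame 21 19 6F ∷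
      frame 8 11 2F ∷ frame 7 0 6F ∷ frame 6 8 7F ∷ frame 5 11 6F ∷ frame 0 13 2F ∷ frame 20 6 3F ∷ frame 7 3 3F ∷ frame 21 8 6F ∷
      frame 13 2 6F ∷ frame 11 4 6F ∷ frame 13 12 4F ∷ frame 6 2 2F ∷ frame 10 14 2F ∷ frame 13 11 5F ∷ frame 15 15 2F ∷ frame 0 19 2F ∷
      frame 9 0 2F ∷ frame 4 12 4F ∷ frame 1 4 3F ∷ frame 6 16 0F ∷ frame 9 9 5F ∷ frame 18 22 5F ∷ frame 2 10 6F ∷ frame 3 2 2F ∷
      frame 17 8 3F ∷ frame 21 12 3F ∷ frame 13 7 3F ∷ frame 12 11 6F ∷ frame 10 13 5F ∷ frame 8 8 3F ∷ frame 19 15 2F ∷ frame 3 17 6F ∷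
      frame 19 10 0F ∷ frame 8 16 1F ∷ frame 21 5 5F ∷ frame 16 17 4F ∷ frame 21 0 2F ∷ frame 11 14 5F ∷ frame 13 0 5F ∷ frame 7 18 3F ∷
      frame 18 4 2F ∷ frame 21 6 2F ∷ frame 14 9 8F ∷ frame 22 6 6F ∷ frame 21 22 5F ∷ frame 15 5 1F ∷ frame 7 14 1F ∷ frame 16 9 3F ∷
      frame 8 19 5F ∷ frame 22 14 5F ∷ frame 10 2 5F ∷ frame 11 12 2F ∷ frame 7 5 5F ∷ frame 4 15 7F ∷ frame 22 9 8F ∷ frame 21 11 5F ∷
      frame 3 23 3F ∷ frame 20 2 5F ∷ frame 14 12 5F ∷ frame 10 19 0F ∷ frame 8 1 5F ∷ frame 17 20 1F ∷ frame 13 13 5F ∷ frame 21 17 7F ∷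
      frame 19 7 6F ∷ frame 11 20 3F ∷ frame 6 22 6F ∷ frame 6 21 5F ∷ frame 14 23 3F ∷ frame 23 20 3F ∷ frame 23 8 0F ∷ frame 15 11 6F ∷
      frame 15 13 2F ∷ frame 6 15 5F ∷ frame 1 13 1F ∷ frame 4 19 5F ∷ frame 22 12 3F ∷ frame 23 14 2F ∷ frame 19 22 1F ∷ frame 15 14 4F ∷
      frame 3 9 6F ∷ frame 10 16 0F ∷ frame 6 4 5F ∷ frame 19 14 2F ∷ frame 6 6 5F ∷ frame 6 5 0F ∷ frame 14 2 8F ∷ frame 4 17 4F ∷
      frame 17 19 3F ∷ frame 8 23 4F ∷ frame 7 6 3F ∷ frame 11 10 6F ∷ frame 10 8 5F ∷ frame 20 10 8F ∷ frame 6 18 5F ∷ frame 1 3 3F ∷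
      frame 6 17 3F ∷ frame 13 5 5F ∷ frame 22 0 5F ∷ frame 2 12 3F ∷ frame 20 19 2F ∷ frame 6 10 1F ∷ frame 18 0 3F ∷ frame 7 22 5F ∷
      frame 4 16 5F ∷ frame 20 5 6F ∷ frame 19 9 5F ∷ frame 9 13 2F ∷ frame 17 3 1F ∷ frame 3 10 5F ∷ frame 19 3 5F ∷ frame 19 20 1F ∷
      frame 20 12 6F ∷ frame 6 23 2F ∷ frame 2 3 5F ∷ frame 8 2 3F ∷ frame 18 3 0F ∷ frame 10 5 3F ∷ frame 7 16 1F ∷ frame 13 21 5F ∷
      frame 2 1 5F ∷ frame 0 0 0F ∷ frame 20 1 2F ∷ frame 16 10 2F ∷ frame 10 1 2F ∷ frame 11 3 3F ∷ frame 8 21 8F ∷ frame 21 3 6F ∷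
      frame 17 14 6F ∷ frame 15 16 4F ∷ frame 23 17 3F ∷ frame 6 7 1F ∷ frame 18 11 3F ∷ frame 2 0 5F ∷ frame 13 18 3F ∷ frame 16 5 5F ∷
      frame 0 16 2F ∷ frame 21 21 1F ∷ frame 22 18 1F ∷ frame 4 7 6F ∷ frame 20 13 2F ∷ frame 12 23 6F ∷ frame 4 14 3F ∷ frame 5 15 3F ∷
      frame 3 1 5F ∷ frame 10 23 3F ∷ frame 1 21 8F ∷ frame 6 11 2F ∷ frame 17 15 7F ∷ frame 13 3 3F ∷ frame 0 22 5F ∷ frame 17 7 4F ∷
      frame 14 1 6F ∷ frame 7 17 8F ∷ frame 14 17 3F ∷ frame 18 7 2F ∷ frame 10 10 5F ∷ frame 21 23 6F ∷ frame 17 1 5F ∷ frame 16 2 3F ∷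
      frame 16 19 6F ∷ frame 15 21 5F ∷ frame 5 14 5F ∷ frame 1 8 4F ∷ frame 0 11 1F ∷ frame 14 7 7F ∷ frame 12 2 0F ∷ frame 11 23 5F ∷
      frame 3 18 5F ∷ frame 7 1 3F ∷ frame 8 17 5F ∷ frame 9 20 4F ∷ frame 2 8 5F ∷ frame 20 15 3F ∷ frame 15 7 6F ∷ frame 17 11 6F ∷
      frame 22 5 5F ∷ frame 3 21 5F ∷ frame 9 11 2F ∷ frame 12 7 4F ∷ frame 18 6 7F ∷ frame 1 22 6F ∷ frame 1 1 2F ∷ frame 1 10 0F ∷
      frame 23 11 3F ∷ frame 23 10 4F ∷ frame 1 17 6F ∷ frame 16 18 5F ∷ frame 18 19 7F ∷ frame 3 14 3F ∷ frame 6 14 6F ∷ frame 0 20 6F ∷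
      frame 7 11 5F ∷ frame 6 19 2F ∷ frame 14 16 1F ∷ frame 15 17 5F ∷ frame 17 17 6F ∷ frame 14 0 4F ∷ frame 2 15 2F ∷ frame 22 1 0F ∷
      frame 6 9 6F ∷ frame 22 7 2F ∷ frame 6 12 0F ∷ frame 20 4 7F ∷ frame 11 1 2F ∷ frame 21 14 6F ∷ frame 2 18 5F ∷ frame 5 23 5F ∷
      frame 0 1 6F ∷ frame 5 19 3F ∷ frame 13 15 5F ∷ frame 8 4 3F ∷ frame 16 23 5F ∷ frame 1 2 6F ∷ frame 3 7 3F ∷ frame 4 17 5F ∷
      frame 2 13 6F ∷ frame 3 8 8F ∷ frame 12 0 8F ∷ frame 4 18 5F ∷ frame 18 1 4F ∷ frame 21 18 3F ∷ frame 4 22 4F ∷ frame 15 9 6F ∷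
      frame 9 7 2F ∷ frame 8 18 6F ∷ frame 23 2 8F ∷ frame 18 20 1F ∷ frame 5 5 2F ∷ frame 21 20 7F ∷ frame 22 20 5F ∷ frame 10 7 8F ∷
      frame 2 11 2F ∷ frame 21 15 6F ∷ frame 4 19 6F ∷ frame 13 8 3F ∷ frame 19 4 8F ∷ frame 7 18 2F ∷ frame 11 21 5F ∷ frame 14 3 2F ∷
      frame 5 17 8F ∷ frame 14 20 0F ∷ frame 18 2 0F ∷ frame 22 11 4F ∷ frame 14 17 8F ∷ frame 16 16 5F ∷ frame 22 17 7F ∷ frame 18 7 1F ∷
      frame 4 8 0F ∷ frame 20 8 6F ∷ frame 20 23 2F ∷ frame 21 2 4F ∷ frame 7 23 6F ∷ frame 13 12 5F ∷ frame 17 0 4F ∷ frame 14 22 1F ∷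
      frame 0 15 1F ∷ frame 11 17 3F ∷ frame 9 17 5F ∷ frame 12 1 7F ∷ frame 18 0 5F ∷ frame 3 2 0F ∷ frame 13 9 1F ∷ frame 22 8 7F ∷
      frame 21 17 6F ∷ frame 8 10 3F ∷ frame 0 22 6F ∷ frame 4 21 1F ∷ frame 8 14 4F ∷ frame 14 15 1F ∷ frame 23 22 3F ∷ frame 1 7 2F ∷
      frame 14 13 8F ∷ frame 10 13 2F ∷ frame 23 16 7F ∷ frame 2 2 7F ∷ []

-- Evaluation of the tests and the lower bound

open Sums
open QuadrilinearForms
open Checking
open import Data.Bool using (true)
open import Data.Empty using (⊥-elim)
open import Data.Fin.Patterns
open import Data.List as L using (List; length; _++_)
open import Data.List.Relation.Unary.All as All using (All)
import Data.List.Relation.Unary.All.Properties as AllP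
open import Data.Nat as ℕ using (ℕ; _≤_)
open import Data.Nat.Properties as ℕP using (≤-refl)
open import Data.Product using (proj₁)
open import Data.Vec as V using (toList)
open Gradients
open Covering
open Certificates
open FrameData
open import Relation.Binary.PropositionalEquality
open import Relation.Nullary using (yes; no)

frameSets certificateSets : List (List ℕ)
frameSets = L.map (λ f → toList (V.map proj₁ (kept f))) frames
certificateSets = L.map (λ c → toList (Certificate.patterns c)) certificates

-- The final `refl` makes the type checker compute the gradients at the grid and test every frame;
-- the next two proofs run the other tests in the same way.
frames-unforced : All UnforcedSet frameSets
frames-unforced = allByTable⇒unforced grid 576 pivot out kept (allPerms 4) frames ≤-refl refl

certificates-unforced : All UnforcedSet certificateSets
certificates-unforced = allValid⇒unforced perm₄ 576 certificates ≤-refl refl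

sets-cover : covers 4 indices (frameSets ++ certificateSets) ≡ true
sets-cover = refl

theorem1 : (S : List (Perm 4)) → NoDup S → QuasirandomForcing S → 5 ≤ length S
theorem1 S _ forcing with 5 ℕ.≤? length S
... | yes 5≤ = 5≤
... | no 5≰ = ⊥-elim (not-forcing 4 (frameSets ++ certificateSets) sets-cover
  (AllP.++⁺ frames-unforced certificates-unforced) S (ℕ.s≤s⁻¹ (ℕP.≰⇒> 5≰)) forcing)
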